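{- Let $q$ be a prime power, let $f\in\mathbb F_q[x]$ be an irreducible polynomial of degree $k$ and order $e$, and let $n$ be a positive integer with $\gcd(n,q)=1$, $\gcd(n,ek)=1$ and $\gcd(k,s_n)=1$. Let $m=n/\gcd(n,q^{s_n}-1)$. For each positive divisor $t$ of $m$ let $r_{n,t}$ be the smallest positive divisor $\rho$ of $s_n$ with $\gcd\!\left(\frac{\gcd(n,q^{s_n}-1)}{\gcd(n,q^{\rho}-1)},t\right)=1$, and for each positive divisor $v$ of $s_n$ let $m_v$ be the largest divisor $t$ of $m$ such that $\gcd\!\left(\frac{\gcd(n,q^{s_n}-1)}{\gcd(n,q^{v}-1)},t\right)=1$. Then the number of irreducible factors of $f(x^n)$ in $\mathbb F_q[x]$ equals $$\frac1{s_n}\sum_{t\mid m}\frac{\varphi(t)}{t}\sum_{r_{n,t}\mid v\mid s_n}\gcd(n,q^v-1)\,\varphi\!\left(\frac{s_n}{v}\right),$$ and equivalently $$\frac1{s_n}\sum_{v\mid s_n}\gcd(n,q^v-1)\,\varphi\!\left(\frac{s_n}{v}\right)\prod_{\substack{p\mid m_v\\ p\ \text{prime}}}\left(1+\nu_p(m_v)\frac{p-1}{p}\right).$$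
   Context: For a positive integer $n$ with $\gcd(n,q)=1$, let $\mathrm{rad}(n)$ be the product of the distinct primes dividing $n$ and $S_n=\mathrm{ord}_{\mathrm{rad}(n)}q$ (multiplicative order of $q$ modulo $\mathrm{rad}(n)$). Define $s_n=2S_n$ if both $q^{S_n}\equiv3\pmod4$ and $8\mid n$, and $s_n=S_n$ otherwise. $\varphi$ is Euler's totient function and $\nu_p$ the $p$-adic valuation. The order of a polynomial $f$ with $f(0)\ne0$ is the least positive integer $e$ with $f(x)\mid x^e-1$. -}

module Defs where

open import Level using (Level; _⊔_) renaming (suc to lsuc)
open import Data.Nat as ℕ using (ℕ; zero; suc; _∸_; _^_; _<_; _≤_)
open import Data.Nat.DivMod using (_%_)
import Data.Nat.DivMod as DM
open import Data.Nat.Divisibility using (_∣_; _∣?_)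
open import Data.Nat.GCD using (gcd)
open import Data.Nat.Coprimality using (Coprime; coprime?)
open import Data.Nat.Primality using (Prime; prime?)
open import Data.Integer using (+_)
open import Data.Rational as ℚ using (ℚ; 0ℚ; 1ℚ)
open import Data.List using (List; []; _∷_; _++_; map; filter; head; last; upTo; replicate; foldr; length)
open import Data.Nat.ListAction using (product)
open import Data.List.Relation.Unary.All using (All)
open import Data.Maybe using (fromMaybe)
open import Data.Fin using (Fin)
open import Data.Bool using (Bool; if_then_else_; _∧_)
open import Data.Product using (Σ; ∃; _×_; _,_)
open import Data.Sum using (_⊎_)
open import Relation.Nullary using (¬_; does)
open import Relation.Nullary.Decidable using (_×-dec_)
open import Relation.Binary.PropositionalEquality using (_≡_)
open import Algebra.Bundles using (CommutativeRing)

record FiniteField (c ℓ : Level) (q : ℕ) : Set (lsuc (c ⊔ ℓ)) where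
  field
    ring : CommutativeRing c ℓ
  open CommutativeRing ring
  field
    0≉1       : ¬ (0# ≈ 1#)
    inverse   : ∀ x → ¬ (x ≈ 0#) → ∃ λ y → x * y ≈ 1#
    enum      : Fin q → Carrier
    enum-inj  : ∀ i j → enum i ≈ enum j → i ≡ j
    enum-surj : ∀ x → ∃ λ i → enum i ≈ x

-- Univariate polynomials over a commutative ring, as coefficient lists
-- (constant coefficient first); equality is coefficientwise.

module PolyOver {c ℓ : Level} (R : CommutativeRing c ℓ) where
  open CommutativeRing R

  Poly : Set c
  Poly = List Carrier

  coeff : Poly → ℕ → Carrier
  coeff []       _       = 0#
  coeff (a ∷ _)  zero    = a
  coeff (_ ∷ as) (suc i) = coeff as i

  infix 4 _≈ₚ_
  _≈ₚ_ : Poly → Poly → Set ℓ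
  p ≈ₚ r = ∀ i → coeff p i ≈ coeff r i

  infixl 6 _+ₚ_
  _+ₚ_ : Poly → Poly → Poly
  []       +ₚ r        = r
  (a ∷ p)  +ₚ []       = a ∷ p
  (a ∷ p)  +ₚ (b ∷ r)  = (a + b) ∷ (p +ₚ r)

  infixl 7 _*ₚ_
  _*ₚ_ : Poly → Poly → Poly
  []      *ₚ r = []
  (a ∷ p) *ₚ r = map (a *_) r +ₚ (0# ∷ (p *ₚ r))

  constₚ : Carrier → Poly
  constₚ a = a ∷ []

  oneₚ : Poly
  oneₚ = constₚ 1#

  productₚ : List Poly → Poly
  productₚ = foldr _*ₚ_ oneₚ

  monomial : ℕ → Poly
  monomial e = replicate e 0# ++ (1# ∷ [])

  xᵉ-1 : ℕ → Poly
  xᵉ-1 e = monomial e +ₚ constₚ (- 1#)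

  -- p(x^n)  (for n ≥ 1)
  substXⁿ : ℕ → Poly → Poly
  substXⁿ n []       = []
  substXⁿ n (a ∷ as) = a ∷ (replicate (n ∸ 1) 0# ++ substXⁿ n as)

  HasDegree : Poly → ℕ → Set ℓ
  HasDegree p d = ¬ (coeff p d ≈ 0#) × (∀ i → d < i → coeff p i ≈ 0#)

  infix 4 _∣ₚ_
  _∣ₚ_ : Poly → Poly → Set (c ⊔ ℓ)
  f ∣ₚ g = ∃ λ h → f *ₚ h ≈ₚ g

  IsUnitₚ : Poly → Set (c ⊔ ℓ)
  IsUnitₚ p = p ∣ₚ oneₚ

  Irreducible : Poly → Set (c ⊔ ℓ)
  Irreducible p = ¬ (p ≈ₚ []) × ¬ IsUnitₚ p
                × (∀ g h → g *ₚ h ≈ₚ p → IsUnitₚ g ⊎ IsUnitₚ h)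

  IsOrder : Poly → ℕ → Set (c ⊔ ℓ)
  IsOrder f e = 0 < e × f ∣ₚ xᵉ-1 e
              × (∀ e′ → 0 < e′ → e′ < e → ¬ (f ∣ₚ xᵉ-1 e′))

  IrredFactorization : Poly → List Poly → Set (c ⊔ ℓ)
  IrredFactorization g fs = All Irreducible fs × ∃ λ u → g ≈ₚ constₚ u *ₚ productₚ fs

-- total versions of division / remainder (divisor 0 never occurs below)
_div_ : ℕ → ℕ → ℕ
a div zero  = 0
a div suc b = a DM./ suc b

_mod_ : ℕ → ℕ → ℕ
a mod zero  = a
a mod suc b = a % suc b

oneTo : ℕ → List ℕ
oneTo n = map suc (upTo n)

divisors : ℕ → List ℕ
divisors n = filter (_∣? n) (oneTo n)

primeDivisors : ℕ → List ℕ
primeDivisors n = filter (λ p → prime? p ×-dec p ∣? n) (oneTo n)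

φ : ℕ → ℕ
φ n = length (filter (λ i → coprime? i n) (oneTo n))

rad : ℕ → ℕ
rad n = product (primeDivisors n)

-- multiplicative order of q modulo r (least e ≥ 1 with q^e ≡ 1 mod r;
-- for gcd(q,r) = 1 it is ≤ r so the search range suffices)
ord : ℕ → ℕ → ℕ
ord r q = fromMaybe 0 (head (filter (λ e → (q ^ e) mod r ℕ.≟ 1 mod r) (oneTo r)))

ν : ℕ → ℕ → ℕ
ν p m = fromMaybe 0 (last (filter (λ a → p ^ a ∣? m) (upTo (suc m))))

S : ℕ → ℕ → ℕ
S n q = ord (rad n) q

s : ℕ → ℕ → ℕ
s n q = if does ((q ^ S n q) mod 4 ℕ.≟ 3) ∧ does (8 ∣? n) then 2 ℕ.* S n q else S n q

g : ℕ → ℕ → ℕ → ℕ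
g n q v = gcd n (q ^ v ∸ 1)

mm : ℕ → ℕ → ℕ
mm n q = n div g n q (s n q)

r : ℕ → ℕ → ℕ → ℕ
r n q t = fromMaybe (s n q)
  (head (filter (λ ρ → coprime? (g n q (s n q) div g n q ρ) t) (divisors (s n q))))

mᵥ : ℕ → ℕ → ℕ → ℕ
mᵥ n q v = fromMaybe 1
  (last (filter (λ t → coprime? (g n q (s n q) div g n q v) t) (divisors (mm n q))))

_÷_ : ℕ → ℕ → ℚ
a ÷ zero  = 0ℚ
a ÷ suc b = (+ a) ℚ./ suc b

sumℚ : List ℚ → ℚ
sumℚ = foldr ℚ._+_ 0ℚ

prodℚ : List ℚ → ℚ
prodℚ = foldr ℚ._*_ 1ℚ

formula₁ : ℕ → ℕ → ℚ
formula₁ n q = (1 ÷ s n q) ℚ.*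
  sumℚ (map (λ t → (φ t ÷ t) ℚ.*
           sumℚ (map (λ v → (g n q v ℕ.* φ (s n q div v)) ÷ 1)
                     (filter (λ v → r n q t ∣? v) (divisors (s n q)))))
            (divisors (mm n q)))

formula₂ : ℕ → ℕ → ℚ
formula₂ n q = (1 ÷ s n q) ℚ.*
  sumℚ (map (λ v → ((g n q v ℕ.* φ (s n q div v)) ÷ 1) ℚ.*
                   prodℚ (map (λ p → 1ℚ ℚ.+ ((ν p (mᵥ n q v) ÷ 1) ℚ.* ((p ∸ 1) ÷ p)))
                              (primeDivisors (mᵥ n q v))))
            (divisors (s n q)))

{-# OPTIONS --safe #-}
-- Berlekamp: for squarefree h, the number N of irreducible factors of h satisfies
-- q^N = #{b ∈ F[x]/h : b^q = b}.  For h = f(x^n), let α be a root of f in K = F[x]/f.  As n is prime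
-- to the order of α, there is γ ∈ K with γ^n = α, and z = x/γ gives F[x]/h ≅ K[z]/(z^n − 1), where
-- Frobenius sends Σ cᵢ zⁱ to Σ cᵢ^q z^(qi).  As k is prime to the period of multiplication by q on
-- ℤ/n, fixed elements have coefficients in F that are constant on the orbits of i ↦ qi, so N is the
-- number of these orbits; h is squarefree, as Frobenius is injective.  By Burnside,
-- s·m·N = Σ_{j < sm} gcd(n, q^j − 1), and lifting the exponent shows
-- gcd(n, q^j − 1) = gcd(n, q^v − 1)·gcd(m_v, j/v) for v = gcd(j, s).  Summing the last factor
-- with gcd(M, i) = Σ_{t ∣ M, t ∣ i} φ(t) yields both formulas.

module Submission where

open import Defs
open import Level using (Level; _⊔_)
open import Algebra.Bundles using (CommutativeRing; CommutativeMonoid)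
import Data.Nat as ℕ
import Data.Nat.Properties as ℕₚ
import Data.Nat.Divisibility as ℕ∣
open ℕ using (ℕ; zero; suc; NonZero; z<s; s≤s; z≤n; >-nonZero)
open import Data.Nat.DivMod using (_%_; _/_; m%n<n; m≡m%n+[m/n]*n)
open import Data.Nat.GCD using (module Bézout)
open import Data.Nat.Coprimality using (Coprime; coprime-Bézout; coprime-divisor)
open import Data.Nat.Primality using (Prime; euclidsLemma; prime⇒nonZero; prime⇒nonTrivial; ¬prime[0])
open import Data.Nat.Tactic.RingSolver using (solve-∀)
open import Data.Fin using (Fin; toℕ; fromℕ<; punchIn; funToFin; finToFun)
import Data.Fin as Fin
import Data.Fin.Properties as Finₚ
open import Data.Fin.Permutation using (Permutation; permutation; _⟨$⟩ʳ_; _⟨$⟩ˡ_; inverseˡ; inverseʳ)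
open import Data.List using (List; []; _∷_; _++_; length; lookup; foldr; applyUpTo; replicate)
open import Data.List.Relation.Unary.All using (All; []; _∷_)
open import Data.List.Relation.Unary.All.Properties using (++⁺)
open import Data.Product using (∃; _×_; _,_; proj₁; proj₂)
open import Data.Sum using (_⊎_; inj₁; inj₂; [_,_]′)
open import Data.Empty using (⊥; ⊥-elim)
open import Relation.Nullary using (¬_; Dec; yes; no)
open import Relation.Binary.PropositionalEquality as ≡ using (_≡_; _≢_; cong; subst)

-- Write a multiple of e as 1 + nw. Then γ = α^(-w) satisfies γ^n = α^(-nw) = α, and z = X·α^w is
-- the class of X^(1+nw) modulo h, since α is the class of X^n. So K is never adjoined: it sits in
-- F[X]/h as c ↦ c(X^n), and only generation by the z^i with i < n and their independence over K
-- have to be shown. The fixed algebra is not treated as a vector space either. It gets two systems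
-- of coordinates, the residues modulo the irreducible factors and the values on the orbits. Each
-- identifies it with a power of the finite set F, and comparing cardinalities equates the two
-- exponents. The doubling in s_n is due to the prime 2, where lifting the exponent requires 4 ∣ q^v
-- - 1. If this fails although gcd(n, q^v - 1) and gcd(n, q^s - 1) have the same 2-part, then 8 does
-- not divide n, and the only case that still needs lifting, 4 ∣ n, is settled directly. At a prime
-- p where these two gcds have different p-parts, m_v is prime to p and nothing has to be lifted.

-- The ring solver with integer coefficients, so that additive cancellations are found.
module IntegerSolver {c ℓ : Level} (R : CommutativeRing c ℓ) where
  open CommutativeRing R
  open import Algebra.Properties.Semiring.Mult semiring using (×-homo-+; ×-homo-1; ×1-homo-*) renaming (_×_ to _·_)
  open import Algebra.Properties.Ring ring using (-‿distribˡ-*; -‿distribʳ-*)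
  open import Algebra.Properties.Group +-group using (ε⁻¹≈ε; ⁻¹-involutive)
  open import Algebra.Properties.AbelianGroup +-abelianGroup using (⁻¹-∙-comm)
  open import Algebra.Solver.Ring.AlmostCommutativeRing
    using (fromCommutativeRing; _-Raw-AlmostCommutative⟶_)
  open import Relation.Binary.Reasoning.Setoid setoid
  open import Relation.Nullary using (yes; no)
  open import Data.Maybe using (just; nothing)
  import Data.Integer as ℤ
  import Data.Integer.Properties as ℤₚ
  open ℤ using (ℤ; +_; -[1+_])

  embed : ℤ → Carrier
  embed (+ n)    = n · 1#
  embed -[1+ n ] = - (suc n · 1#)

  embed-⊖ : ∀ m n → embed (m ℤ.⊖ n) ≈ m · 1# - n · 1#
  embed-⊖ m zero = sym (trans (+-congˡ ε⁻¹≈ε) (+-identityʳ _))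
  embed-⊖ zero (suc n) = sym (+-identityˡ _)
  embed-⊖ (suc m) (suc n) = begin
    embed (suc m ℤ.⊖ suc n)               ≡⟨ cong embed (ℤₚ.[1+m]⊖[1+n]≡m⊖n m n) ⟩
    embed (m ℤ.⊖ n)                       ≈⟨ embed-⊖ m n ⟩
    m · 1# - n · 1#                       ≈⟨ +-congʳ (sym (+-identityˡ _)) ⟩
    (0# + m · 1#) - n · 1#                ≈⟨ +-congʳ (+-congʳ (sym (-‿inverseʳ 1#))) ⟩
    ((1# - 1#) + m · 1#) - n · 1#         ≈⟨ +-congʳ (trans (+-assoc _ _ _) (trans (+-congˡ (+-comm _ _)) (sym (+-assoc _ _ _)))) ⟩
    ((1# + m · 1#) - 1#) - n · 1#         ≈⟨ +-assoc _ _ _ ⟩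
    (1# + m · 1#) + (- 1# - n · 1#)       ≈⟨ +-congˡ (⁻¹-∙-comm _ _) ⟩
    (1# + m · 1#) - (1# + n · 1#)         ∎

  embed-+ : ∀ i j → embed (i ℤ.+ j) ≈ embed i + embed j
  embed-+ (+ m)    (+ n)    = ×-homo-+ 1# m n
  embed-+ (+ m)    -[1+ n ] = embed-⊖ m (suc n)
  embed-+ -[1+ m ] (+ n)    = trans (embed-⊖ n (suc m)) (+-comm _ _)
  embed-+ -[1+ m ] -[1+ n ] = begin
    - (suc (suc (m ℕ.+ n)) · 1#)       ≡⟨ cong (λ k → - (k · 1#)) (≡.sym (ℕₚ.+-suc (suc m) n)) ⟩
    - ((suc m ℕ.+ suc n) · 1#)         ≈⟨ -‿cong (×-homo-+ 1# (suc m) (suc n)) ⟩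
    - (suc m · 1# + suc n · 1#)        ≈⟨ sym (⁻¹-∙-comm _ _) ⟩
    - (suc m · 1#) - (suc n · 1#)      ∎

  embed-neg : ∀ i → embed (ℤ.- i) ≈ - embed i
  embed-neg (+ zero)  = sym ε⁻¹≈ε
  embed-neg (+ suc n) = refl
  embed-neg -[1+ n ]  = sym (⁻¹-involutive _)

  embed-*⁺ : ∀ m j → embed (+ m ℤ.* j) ≈ m · 1# * embed j
  embed-*⁺ m (+ n) = trans (reflexive (cong embed (≡.sym (ℤₚ.pos-* m n)))) (×1-homo-* m n)
  embed-*⁺ m -[1+ n ] = begin
    embed (+ m ℤ.* -[1+ n ])        ≡⟨ cong embed (≡.sym (ℤₚ.neg-distribʳ-* (+ m) (+ suc n))) ⟩
    embed (ℤ.- (+ m ℤ.* + suc n))   ≈⟨ embed-neg (+ m ℤ.* + suc n) ⟩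
    - embed (+ m ℤ.* + suc n)       ≈⟨ -‿cong (embed-*⁺ m (+ suc n)) ⟩
    - (m · 1# * suc n · 1#)         ≈⟨ -‿distribʳ-* _ _ ⟩
    m · 1# * - (suc n · 1#)         ∎

  embed-* : ∀ i j → embed (i ℤ.* j) ≈ embed i * embed j
  embed-* (+ m) j = embed-*⁺ m j
  embed-* -[1+ m ] j = begin
    embed (-[1+ m ] ℤ.* j)          ≡⟨ cong embed (≡.sym (ℤₚ.neg-distribˡ-* (+ suc m) j)) ⟩
    embed (ℤ.- (+ suc m ℤ.* j))     ≈⟨ embed-neg (+ suc m ℤ.* j) ⟩
    - embed (+ suc m ℤ.* j)         ≈⟨ -‿cong (embed-*⁺ (suc m) j) ⟩
    - (suc m · 1# * embed j)        ≈⟨ -‿distribˡ-* _ _ ⟩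
    - (suc m · 1#) * embed j        ∎

  morphism : ℤ.+-*-rawRing -Raw-AlmostCommutative⟶ fromCommutativeRing R
  morphism = record
    { ⟦_⟧    = embed
    ; +-homo = embed-+
    ; *-homo = embed-*
    ; -‿homo = embed-neg
    ; 0-homo = refl
    ; 1-homo = ×-homo-1 1#
    }

  private
    _coeff≟_ : ∀ i j → _
    i coeff≟ j with i ℤ.≟ j
    ... | yes eq = just (reflexive (cong embed eq))
    -- Unequal integers can still have equal images in positive characteristic.
    ... | no  _  = nothing

  open import Algebra.Solver.Ring ℤ.+-*-rawRing (fromCommutativeRing R) morphism _coeff≟_ public
    using (solve; _:=_; _:+_; _:*_; _:-_; :-_)

-- The ring of polynomials
module PolynomialRing {c ℓ : Level} (R : CommutativeRing c ℓ) where
  open CommutativeRing R hiding (isCommutativeRing)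
  open PolyOver R
  open import Data.List using (List; []; _∷_; map; replicate; _++_)
  open import Data.Product using (_,_)
  open import Algebra.Structures using (IsCommutativeRing)
  open import Relation.Binary.Reasoning.Setoid setoid
  open import Algebra.Properties.CommutativeSemigroup +-commutativeSemigroup using (x∙yz≈y∙xz; interchange)
  open import Algebra.Properties.Group +-group using (ε⁻¹≈ε)

  -ₚ_ : Poly → Poly
  -ₚ_ = map (-_)

  scale : Carrier → Poly → Poly
  scale a = map (a *_)

  coeff-+ : ∀ p r i → coeff (p +ₚ r) i ≈ coeff p i + coeff r i
  coeff-+ []      r       i       = sym (+-identityˡ _)
  coeff-+ (a ∷ p) []      i       = sym (+-identityʳ _)
  coeff-+ (a ∷ p) (b ∷ r) zero    = refl
  coeff-+ (a ∷ p) (b ∷ r) (suc i) = coeff-+ p r i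

  coeff-scale : ∀ a p i → coeff (scale a p) i ≈ a * coeff p i
  coeff-scale a []      i       = sym (zeroʳ a)
  coeff-scale a (b ∷ p) zero    = refl
  coeff-scale a (b ∷ p) (suc i) = coeff-scale a p i

  coeff-neg : ∀ p i → coeff (-ₚ p) i ≈ - coeff p i
  coeff-neg []      i       = sym ε⁻¹≈ε
  coeff-neg (b ∷ p) zero    = refl
  coeff-neg (b ∷ p) (suc i) = coeff-neg p i

  coeff-∷* : ∀ a p r i → coeff ((a ∷ p) *ₚ r) i ≈ a * coeff r i + coeff (0# ∷ (p *ₚ r)) i
  coeff-∷* a p r i = trans (coeff-+ (scale a r) (0# ∷ (p *ₚ r)) i) (+-congʳ (coeff-scale a r i))

  ∷-cong : ∀ {a b p r} → a ≈ b → p ≈ₚ r → (a ∷ p) ≈ₚ (b ∷ r)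
  ∷-cong a≈b p≈r zero    = a≈b
  ∷-cong a≈b p≈r (suc i) = p≈r i

  +ₚ-cong : ∀ {p p′ r r′} → p ≈ₚ p′ → r ≈ₚ r′ → p +ₚ r ≈ₚ p′ +ₚ r′
  +ₚ-cong {p} {p′} {r} {r′} e e′ i =
    trans (coeff-+ p r i) (trans (+-cong (e i) (e′ i)) (sym (coeff-+ p′ r′ i)))

  +ₚ-assoc : ∀ p r t → (p +ₚ r) +ₚ t ≈ₚ p +ₚ (r +ₚ t)
  +ₚ-assoc p r t i = begin
    coeff ((p +ₚ r) +ₚ t) i              ≈⟨ trans (coeff-+ (p +ₚ r) t i) (+-congʳ (coeff-+ p r i)) ⟩
    (coeff p i + coeff r i) + coeff t i  ≈⟨ +-assoc _ _ _ ⟩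
    coeff p i + (coeff r i + coeff t i)  ≈⟨ sym (trans (coeff-+ p (r +ₚ t) i) (+-congˡ (coeff-+ r t i))) ⟩
    coeff (p +ₚ (r +ₚ t)) i              ∎

  +ₚ-comm : ∀ p r → p +ₚ r ≈ₚ r +ₚ p
  +ₚ-comm p r i = trans (coeff-+ p r i) (trans (+-comm _ _) (sym (coeff-+ r p i)))

  -ₚ-cong : ∀ {p r} → p ≈ₚ r → -ₚ p ≈ₚ -ₚ r
  -ₚ-cong {p} {r} e i = trans (coeff-neg p i) (trans (-‿cong (e i)) (sym (coeff-neg r i)))

  -ₚ-inverseˡ : ∀ p → (-ₚ p) +ₚ p ≈ₚ []
  -ₚ-inverseˡ p i = trans (coeff-+ (-ₚ p) p i) (trans (+-congʳ (coeff-neg p i)) (-‿inverseˡ _))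

  -ₚ-inverseʳ : ∀ p → p +ₚ (-ₚ p) ≈ₚ []
  -ₚ-inverseʳ p i = trans (+ₚ-comm p (-ₚ p) i) (-ₚ-inverseˡ p i)

  *ₚ-congˡ : ∀ p {r r′} → r ≈ₚ r′ → p *ₚ r ≈ₚ p *ₚ r′
  *ₚ-congˡ []      e i = refl
  *ₚ-congˡ (a ∷ p) {r} {r′} e i = begin
    coeff ((a ∷ p) *ₚ r) i                     ≈⟨ coeff-∷* a p r i ⟩
    a * coeff r i + coeff (0# ∷ (p *ₚ r)) i    ≈⟨ +-cong (*-congˡ (e i)) (∷-cong refl (*ₚ-congˡ p e) i) ⟩
    a * coeff r′ i + coeff (0# ∷ (p *ₚ r′)) i  ≈⟨ coeff-∷* a p r′ i ⟨
    coeff ((a ∷ p) *ₚ r′) i                    ∎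

  *ₚ-zeroʳ : ∀ p → p *ₚ [] ≈ₚ []
  *ₚ-zeroʳ []      i       = refl
  *ₚ-zeroʳ (a ∷ p) zero    = refl
  *ₚ-zeroʳ (a ∷ p) (suc i) = *ₚ-zeroʳ p i

  -- The mirror image of `coeff-∷*`. Multiplication recurses on its left factor only, and this rule
  -- for the right factor lets commutativity go through by induction.
  coeff-*∷ : ∀ p b r i → coeff (p *ₚ (b ∷ r)) i ≈ coeff p i * b + coeff (0# ∷ (p *ₚ r)) i
  coeff-*∷ [] b r zero    = sym (trans (+-congʳ (zeroˡ b)) (+-identityʳ _))
  coeff-*∷ [] b r (suc i) = sym (trans (+-congʳ (zeroˡ b)) (+-identityʳ _))
  coeff-*∷ (a ∷ p) b r zero    = refl
  coeff-*∷ (a ∷ p) b r (suc i) = begin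
    coeff (scale a r +ₚ (p *ₚ (b ∷ r))) i
      ≈⟨ trans (coeff-+ (scale a r) _ i) (+-cong (coeff-scale a r i) (coeff-*∷ p b r i)) ⟩
    a * coeff r i + (coeff p i * b + coeff (0# ∷ (p *ₚ r)) i)
      ≈⟨ x∙yz≈y∙xz _ _ _ ⟩
    coeff p i * b + (a * coeff r i + coeff (0# ∷ (p *ₚ r)) i)
      ≈⟨ +-congˡ (coeff-∷* a p r i) ⟨
    coeff p i * b + coeff ((a ∷ p) *ₚ r) i ∎

  *ₚ-comm : ∀ p r → p *ₚ r ≈ₚ r *ₚ p
  *ₚ-comm []      r i = sym (*ₚ-zeroʳ r i)
  *ₚ-comm (a ∷ p) r i = begin
    coeff ((a ∷ p) *ₚ r) i                   ≈⟨ coeff-∷* a p r i ⟩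
    a * coeff r i + coeff (0# ∷ (p *ₚ r)) i  ≈⟨ +-cong (*-comm _ _) (∷-cong refl (*ₚ-comm p r) i) ⟩
    coeff r i * a + coeff (0# ∷ (r *ₚ p)) i  ≈⟨ coeff-*∷ r a p i ⟨
    coeff (r *ₚ (a ∷ p)) i                   ∎

  -- Coefficientwise equal lists may differ in length, so the left factor admits no parallel
  -- induction; commutativity moves it to the right.
  *ₚ-cong : ∀ {p p′ r r′} → p ≈ₚ p′ → r ≈ₚ r′ → p *ₚ r ≈ₚ p′ *ₚ r′
  *ₚ-cong {p} {p′} {r} {r′} e e′ i = begin
    coeff (p *ₚ r) i    ≈⟨ *ₚ-congˡ p e′ i ⟩
    coeff (p *ₚ r′) i   ≈⟨ *ₚ-comm p r′ i ⟩
    coeff (r′ *ₚ p) i   ≈⟨ *ₚ-congˡ r′ e i ⟩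
    coeff (r′ *ₚ p′) i  ≈⟨ *ₚ-comm r′ p′ i ⟩
    coeff (p′ *ₚ r′) i  ∎

  *ₚ-distribˡ : ∀ p r t → p *ₚ (r +ₚ t) ≈ₚ (p *ₚ r) +ₚ (p *ₚ t)
  *ₚ-distribˡ []      r t i = refl
  *ₚ-distribˡ (a ∷ p) r t i = begin
    coeff ((a ∷ p) *ₚ (r +ₚ t)) i
      ≈⟨ coeff-∷* a p (r +ₚ t) i ⟩
    a * coeff (r +ₚ t) i + coeff (0# ∷ (p *ₚ (r +ₚ t))) i
      ≈⟨ +-cong (trans (*-congˡ (coeff-+ r t i)) (distribˡ _ _ _)) (shifted i) ⟩
    (a * coeff r i + a * coeff t i) + (coeff (0# ∷ (p *ₚ r)) i + coeff (0# ∷ (p *ₚ t)) i)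
      ≈⟨ interchange _ _ _ _ ⟩
    (a * coeff r i + coeff (0# ∷ (p *ₚ r)) i) + (a * coeff t i + coeff (0# ∷ (p *ₚ t)) i)
      ≈⟨ sym (trans (coeff-+ ((a ∷ p) *ₚ r) _ i) (+-cong (coeff-∷* a p r i) (coeff-∷* a p t i))) ⟩
    coeff (((a ∷ p) *ₚ r) +ₚ ((a ∷ p) *ₚ t)) i ∎
    where
    shifted : ∀ i → coeff (0# ∷ (p *ₚ (r +ₚ t))) i ≈ coeff (0# ∷ (p *ₚ r)) i + coeff (0# ∷ (p *ₚ t)) i
    shifted zero    = sym (+-identityʳ _)
    shifted (suc i) = trans (*ₚ-distribˡ p r t i) (coeff-+ (p *ₚ r) (p *ₚ t) i)

  *ₚ-distribʳ : ∀ p r t → (r +ₚ t) *ₚ p ≈ₚ (r *ₚ p) +ₚ (t *ₚ p)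
  *ₚ-distribʳ p r t i = begin
    coeff ((r +ₚ t) *ₚ p) i           ≈⟨ *ₚ-comm (r +ₚ t) p i ⟩
    coeff (p *ₚ (r +ₚ t)) i           ≈⟨ *ₚ-distribˡ p r t i ⟩
    coeff ((p *ₚ r) +ₚ (p *ₚ t)) i    ≈⟨ +ₚ-cong {p *ₚ r} {r *ₚ p} {p *ₚ t} (*ₚ-comm p r) (*ₚ-comm p t) i ⟩
    coeff ((r *ₚ p) +ₚ (t *ₚ p)) i    ∎

  scale-* : ∀ a p r → scale a p *ₚ r ≈ₚ scale a (p *ₚ r)
  scale-* a []      r i = refl
  scale-* a (b ∷ p) r i = begin
    coeff (scale a (b ∷ p) *ₚ r) i
      ≈⟨ coeff-∷* (a * b) (scale a p) r i ⟩
    a * b * coeff r i + coeff (0# ∷ (scale a p *ₚ r)) i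
      ≈⟨ +-cong (*-assoc _ _ _) (shifted i) ⟩
    a * (b * coeff r i) + a * coeff (0# ∷ (p *ₚ r)) i
      ≈⟨ distribˡ _ _ _ ⟨
    a * (b * coeff r i + coeff (0# ∷ (p *ₚ r)) i)
      ≈⟨ sym (trans (coeff-scale a ((b ∷ p) *ₚ r) i) (*-congˡ (coeff-∷* b p r i))) ⟩
    coeff (scale a ((b ∷ p) *ₚ r)) i ∎
    where
    shifted : ∀ i → coeff (0# ∷ (scale a p *ₚ r)) i ≈ a * coeff (0# ∷ (p *ₚ r)) i
    shifted zero    = sym (zeroʳ a)
    shifted (suc i) = trans (scale-* a p r i) (coeff-scale a (p *ₚ r) i)

  shift-* : ∀ p r → (0# ∷ p) *ₚ r ≈ₚ 0# ∷ (p *ₚ r)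
  shift-* p r i = trans (coeff-∷* 0# p r i) (trans (+-congʳ (zeroˡ _)) (+-identityˡ _))

  *ₚ-assoc : ∀ p r t → (p *ₚ r) *ₚ t ≈ₚ p *ₚ (r *ₚ t)
  *ₚ-assoc []      r t i = refl
  *ₚ-assoc (a ∷ p) r t i = begin
    coeff ((scale a r +ₚ (0# ∷ (p *ₚ r))) *ₚ t) i
      ≈⟨ *ₚ-distribʳ t (scale a r) (0# ∷ (p *ₚ r)) i ⟩
    coeff ((scale a r *ₚ t) +ₚ ((0# ∷ (p *ₚ r)) *ₚ t)) i
      ≈⟨ +ₚ-cong {scale a r *ₚ t} {scale a (r *ₚ t)} {(0# ∷ (p *ₚ r)) *ₚ t} {0# ∷ (p *ₚ (r *ₚ t))}
           (scale-* a r t)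
           (λ j → trans (shift-* (p *ₚ r) t j) (∷-cong refl (*ₚ-assoc p r t) j)) i ⟩
    coeff (scale a (r *ₚ t) +ₚ (0# ∷ (p *ₚ (r *ₚ t)))) i ∎

  coeff-const* : ∀ a p i → coeff (constₚ a *ₚ p) i ≈ a * coeff p i
  coeff-const* a p i = trans (coeff-∷* a [] p i) (trans (+-congˡ (zero-tail i)) (+-identityʳ _))
    where
    zero-tail : ∀ i → coeff (0# ∷ []) i ≈ 0#
    zero-tail zero    = refl
    zero-tail (suc i) = refl

  *ₚ-identityˡ : ∀ p → oneₚ *ₚ p ≈ₚ p
  *ₚ-identityˡ p i = trans (coeff-const* 1# p i) (*-identityˡ _)

  -- A record around _≈ₚ_, from which both sides can be inferred.
  infix 4 _≋_
  record _≋_ (p r : Poly) : Set ℓ where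
    constructor wrap
    field unwrap : p ≈ₚ r
  open _≋_ public

  -- Opaque copies of the operations: they do not reduce, so arguments can be inferred.
  infixl 6 _⊕_
  infixl 7 _⊛_
  opaque
    _⊕_ _⊛_ : Poly → Poly → Poly
    _⊕_ = _+ₚ_
    _⊛_ = _*ₚ_

    ⊝_ : Poly → Poly
    ⊝_ = -ₚ_

    ⊕-def : ∀ p r → p ⊕ r ≡ p +ₚ r
    ⊕-def p r = ≡.refl

    ⊛-def : ∀ p r → p ⊛ r ≡ p *ₚ r
    ⊛-def p r = ≡.refl

    coeff-⊕ : ∀ p r i → coeff (p ⊕ r) i ≈ coeff p i + coeff r i
    coeff-⊕ = coeff-+

    coeff-⊝ : ∀ p i → coeff (⊝ p) i ≈ - coeff p i
    coeff-⊝ = coeff-neg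

    coeff-∷⊛ : ∀ a p r i → coeff ((a ∷ p) ⊛ r) i ≈ a * coeff r i + coeff (0# ∷ (p ⊛ r)) i
    coeff-∷⊛ = coeff-∷*

    coeff-⊛∷ : ∀ p b r i → coeff (p ⊛ (b ∷ r)) i ≈ coeff p i * b + coeff (0# ∷ (p ⊛ r)) i
    coeff-⊛∷ = coeff-*∷

    coeff-const⊛ : ∀ a p i → coeff (constₚ a ⊛ p) i ≈ a * coeff p i
    coeff-const⊛ = coeff-const*

    isCommutativeRing : IsCommutativeRing _≋_ _⊕_ _⊛_ ⊝_ [] oneₚ
    isCommutativeRing = record
      { isRing = record
        { +-isAbelianGroup = record
          { isGroup = record
            { isMonoid = record
              { isSemigroup = record
                { isMagma = record
                  { isEquivalence = record
                    { refl  = wrap λ i → refl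
                    ; sym   = λ e → wrap λ i → sym (unwrap e i)
                    ; trans = λ e e′ → wrap λ i → trans (unwrap e i) (unwrap e′ i)
                    }
                  ; ∙-cong = λ {p} {p′} {r} {r′} e e′ → wrap (+ₚ-cong {p} {p′} {r} {r′} (unwrap e) (unwrap e′))
                  }
                ; assoc = λ p r t → wrap (+ₚ-assoc p r t)
                }
              ; identity = (λ p → wrap λ i → refl) , λ p → wrap (+ₚ-comm p [])
              }
            ; inverse = (λ p → wrap (-ₚ-inverseˡ p)) , λ p → wrap (-ₚ-inverseʳ p)
            ; ⁻¹-cong = λ {p} {r} e → wrap (-ₚ-cong {p} {r} (unwrap e))
            }
          ; comm = λ p r → wrap (+ₚ-comm p r)
          }
        ; *-cong = λ {p} {p′} {r} {r′} e e′ → wrap (*ₚ-cong {p} {p′} {r} {r′} (unwrap e) (unwrap e′))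
        ; *-assoc = λ p r t → wrap (*ₚ-assoc p r t)
        ; *-identity = (λ p → wrap (*ₚ-identityˡ p))
                     , λ p → wrap λ i → trans (*ₚ-comm p oneₚ i) (*ₚ-identityˡ p i)
        ; distrib = (λ p r t → wrap (*ₚ-distribˡ p r t)) , λ p r t → wrap (*ₚ-distribʳ p r t)
        }
      ; *-comm = λ p r → wrap (*ₚ-comm p r)
      }

  polynomialRing : CommutativeRing c ℓ
  polynomialRing = record { isCommutativeRing = isCommutativeRing }

-- Prime divisors of binomial coefficients

module BinomialDivisibility where
  open import Data.Nat.Divisibility using (_∣_; m∣m*n; ∣⇒≤)
  open import Data.Nat.DivMod using (m/n*n≡m)
  open import Data.Nat using (_!)
  open import Data.Nat.Properties using (_!*_!≢0)
  open import Data.Nat.Combinatorics using (_C_; k![n∸k]!∣n!)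
  open import Data.Nat.Combinatorics.Specification using (nCk≡n!/k![n-k]!)

  -- p divides p! = C(p, k)·k!·(p - k)!, but it divides no factorial of a number below p.
  prime∣C : ∀ {p k} → Prime p → 0 ℕ.< k → k ℕ.< p → p ∣ p C k
  prime∣C {p} {k} p-prime 0<k k<p with euclidsLemma (p C k) (k ! ℕ.* (p ℕ.∸ k) !) p-prime p∣product
    where
    instance _ = k !* (p ℕ.∸ k) !≢0
    p∣p! : ∀ {m} → 0 ℕ.< m → m ∣ m !
    p∣p! {suc m} _ = m∣m*n (m !)
    p∣product : p ∣ (p C k) ℕ.* (k ! ℕ.* (p ℕ.∸ k) !)
    p∣product = subst (p ∣_)
      (≡.sym (≡.trans (cong (ℕ._* (k ! ℕ.* (p ℕ.∸ k) !)) (nCk≡n!/k![n-k]! (ℕₚ.<⇒≤ k<p)))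
                  (m/n*n≡m (k![n∸k]!∣n! (ℕₚ.<⇒≤ k<p)))))
      (p∣p! (ℕₚ.<-trans 0<k k<p))
  ... | inj₁ p∣C = p∣C
  ... | inj₂ p∣k![p-k]! = ⊥-elim ([ ∤! k<p , ∤! (ℕₚ.∸-monoʳ-< 0<k (ℕₚ.<⇒≤ k<p)) ]′
          (euclidsLemma (k !) ((p ℕ.∸ k) !) p-prime p∣k![p-k]!))
    where
    ∤! : ∀ {m} → m ℕ.< p → ¬ p ∣ m !
    ∤! {zero}  m<p p∣1 = ℕₚ.<⇒≱ (ℕ.nonTrivial⇒n>1 p {{prime⇒nonTrivial p-prime}}) (∣⇒≤ p∣1)
    ∤! {suc m} m<p p∣  with euclidsLemma (suc m) (m !) p-prime p∣
    ... | inj₁ p∣m  = ℕₚ.<⇒≱ m<p (∣⇒≤ p∣m)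
    ... | inj₂ p∣m! = ∤! (ℕₚ.<-trans (ℕₚ.n<1+n m) m<p) p∣m!

-- The Frobenius map and polynomial functions
module Frobenius {c ℓ : Level} (R : CommutativeRing c ℓ) where
  open CommutativeRing R hiding (zero)
  open import Algebra.Properties.CommutativeSemiring.Binomial commutativeSemiring
    using (theorem; binomialTerm)
  open import Algebra.Properties.Semiring.Exp semiring
  open import Algebra.Properties.Semiring.Mult semiring renaming (_×_ to _·_; ×-congʳ to ·-congʳ; ×-assoc-* to ·-assoc-*; ×1-homo-* to ·1-homo-*)
  open import Algebra.Properties.Semiring.Sum semiring
  open import Relation.Binary.Reasoning.Setoid setoid
  open import Data.Fin using (Fin; zero; suc; toℕ; fromℕ; inject₁)
  open import Data.Fin.Properties using (toℕ-fromℕ; toℕ-inject₁; toℕ<n)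
  open import Function using (_∘_)
  open import Data.Nat.Combinatorics using (_C_; nCn≡1)
  open import Data.Nat.Divisibility using (_∣_; divides)
  open BinomialDivisibility

  module _ {p : ℕ} (p-prime : Prime p) (char : p · 1# ≈ 0#) where

    multiple≈0 : ∀ {m} → p ∣ m → ∀ x → m · x ≈ 0#
    multiple≈0 (divides t ≡.refl) x = begin
      (t ℕ.* p) · x       ≈⟨ ·-congʳ (t ℕ.* p) (sym (*-identityˡ x)) ⟩
      (t ℕ.* p) · (1# * x)  ≈⟨ ·-assoc-* (t ℕ.* p) 1# x ⟨
      (t ℕ.* p) · 1# * x  ≈⟨ *-congʳ (·1-homo-* t p) ⟩
      t · 1# * p · 1# * x ≈⟨ *-congʳ (trans (*-congˡ char) (zeroʳ _)) ⟩
      0# * x              ≈⟨ zeroˡ x ⟩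
      0#                  ∎

    freshman : ∀ x y → (x + y) ^ p ≈ x ^ p + y ^ p
    freshman x y = lemma p ≡.refl
      where
      -- A variable stands for the prime, so that it can be split as a successor and the two outer
      -- terms of the binomial sum come apart.
      lemma : ∀ p′ → p ≡ p′ → (x + y) ^ p′ ≈ x ^ p′ + y ^ p′
      lemma zero     eq = ⊥-elim (¬prime[0] (subst Prime eq p-prime))
      lemma (suc p′) eq = begin
        (x + y) ^ suc p′           ≈⟨ theorem (suc p′) x y ⟩
        sum t                      ≈⟨ +-cong first (sum-init-last (t ∘ suc)) ⟩
        y ^ suc p′ + (sum (λ i → t (suc (inject₁ i))) + t (fromℕ (suc p′)))
          ≈⟨ +-congˡ (+-cong (trans (sum-cong-≋ middle) (sum-replicate-zero p′)) final) ⟩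
        y ^ suc p′ + (0# + x ^ suc p′)  ≈⟨ trans (+-comm _ _) (+-congʳ (+-identityˡ _)) ⟩
        x ^ suc p′ + y ^ suc p′    ∎
        where
        t = binomialTerm x y (suc p′)
        first : t zero ≈ y ^ suc p′
        first = trans (+-identityʳ _) (*-identityˡ _)
        middle : ∀ i → t (suc (inject₁ i)) ≈ 0#
        middle i = multiple≈0 (subst (λ r → p ∣ r C suc (toℕ (inject₁ i))) eq
                                (prime∣C p-prime (ℕ.s≤s ℕ.z≤n)
                                  (subst (suc (toℕ (inject₁ i)) ℕ.<_) (≡.sym eq)
                                    (ℕ.s≤s (subst (ℕ._< p′) (≡.sym (toℕ-inject₁ i)) (toℕ<n i)))))) _
        final : t (fromℕ (suc p′)) ≈ x ^ suc p′
        final rewrite toℕ-fromℕ p′ | nCn≡1 (suc p′) | ℕₚ.n∸n≡0 p′ =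
          trans (+-identityʳ _) (*-identityʳ _)

    frobenius-+ : ∀ a x y → (x + y) ^ (p ℕ.^ a) ≈ x ^ (p ℕ.^ a) + y ^ (p ℕ.^ a)
    frobenius-+ zero x y = trans (*-identityʳ _) (sym (+-cong (*-identityʳ _) (*-identityʳ _)))
    frobenius-+ (suc a) x y = begin
      (x + y) ^ (p ℕ.* p ℕ.^ a)             ≈⟨ ^-assocʳ (x + y) p (p ℕ.^ a) ⟨
      ((x + y) ^ p) ^ (p ℕ.^ a)             ≈⟨ ^-congˡ (p ℕ.^ a) (freshman x y) ⟩
      (x ^ p + y ^ p) ^ (p ℕ.^ a)           ≈⟨ frobenius-+ a _ _ ⟩
      (x ^ p) ^ (p ℕ.^ a) + (y ^ p) ^ (p ℕ.^ a)  ≈⟨ +-cong (^-assocʳ x p _) (^-assocʳ y p _) ⟩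
      x ^ (p ℕ.* p ℕ.^ a) + y ^ (p ℕ.* p ℕ.^ a)  ∎

    frobenius-sum : ∀ a {n} (v : Fin n → Carrier) → sum v ^ (p ℕ.^ a) ≈ sum (λ i → v i ^ (p ℕ.^ a))
    frobenius-sum a {zero}  v = 0^ (p ℕ.^ a) (ℕₚ.m^n≢0 p a {{prime⇒nonZero p-prime}})
      where
      0^ : ∀ m → ℕ.NonZero m → 0# ^ m ≈ 0#
      0^ (suc m) _ = zeroˡ _
    frobenius-sum a {suc n} v = trans (frobenius-+ a _ _) (+-congˡ (frobenius-sum a (v ∘ suc)))

-- Polynomial functions and their roots

module RootFactorization {c ℓ : Level} (R : CommutativeRing c ℓ) where
  open CommutativeRing R hiding (zero)
  open IntegerSolver R
  open import Algebra.Properties.Semiring.Exp semiring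
  open import Algebra.Properties.CommutativeMonoid.Sum *-commutativeMonoid
    using () renaming (sum to product)
  open import Relation.Binary.Reasoning.Setoid setoid
  open import Data.Fin using (Fin; zero; suc)

  -- G is a polynomial function of degree at most d whose coefficient of y^d is l,
  -- expressed through iterated division by linear factors.
  data LeadingCoeff : ℕ → Carrier → (Carrier → Carrier) → Set (c ⊔ ℓ) where
    constant : ∀ {l G} → (∀ y → G y ≈ l) → LeadingCoeff zero l G
    divided  : ∀ {d l G} →
      (∀ r → ∃ λ G′ → LeadingCoeff d l G′ × (∀ y → G y ≈ G r + (y - r) * G′ y)) →
      LeadingCoeff (suc d) l G

  leading-resp : ∀ d {l l′ G} → l ≈ l′ → LeadingCoeff d l G → LeadingCoeff d l′ G
  leading-resp zero    e (constant h) = constant λ y → trans (h y) e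
  leading-resp (suc d) e (divided h) = divided λ r → let G′ , h′ , eq = h r in G′ , leading-resp d e h′ , eq

  leading-+ : ∀ d {l l′ G H} → LeadingCoeff d l G → LeadingCoeff d l′ H →
              LeadingCoeff d (l + l′) (λ y → G y + H y)
  leading-+ zero    (constant h) (constant k) = constant λ y → +-cong (h y) (k y)
  leading-+ (suc d) {G = G} {H} (divided h) (divided k) = divided λ r →
    let G′ , h′ , eq = h r ; H′ , k′ , eq′ = k r in _ , leading-+ d h′ k′ , λ y →
    trans (+-cong (eq y) (eq′ y))
      (solve 5 (λ a b w u v → (a :+ w :* u) :+ (b :+ w :* v) := (a :+ b) :+ w :* (u :+ v)) refl
        (G r) (H r) (y - r) (G′ y) (H′ y))

  leading-* : ∀ d {l G} a → LeadingCoeff d l G → LeadingCoeff d (a * l) (λ y → a * G y)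
  leading-* zero    a (constant h) = constant λ y → *-congˡ (h y)
  leading-* (suc d) {G = G} a (divided h) = divided λ r → let G′ , h′ , eq = h r in _ , leading-* d a h′ , λ y →
    trans (*-congˡ (eq y))
      (solve 4 (λ a b w u → a :* (b :+ w :* u) := a :* b :+ w :* (a :* u)) refl a (G r) (y - r) (G′ y))

  -- Pads the formal degree, so that `leading-+` can add functions of different degrees.
  leading-raise : ∀ d {l G} → LeadingCoeff d l G → LeadingCoeff (suc d) 0# G
  leading-raise zero    (constant h) = divided λ r → (λ _ → 0#) , constant (λ _ → refl) , λ y →
    trans (h y) (sym (trans (+-cong (h r) (zeroʳ _)) (+-identityʳ _)))
  leading-raise (suc d) (divided h) = divided λ r → let G′ , h′ , eq = h r in G′ , leading-raise d h′ , eq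

  leading-^ : ∀ d → LeadingCoeff (suc d) 1# (_^ suc d)
  leading-^ zero = divided λ r → (λ _ → 1#) , constant (λ _ → refl) , λ y →
    solve 3 (λ y r u → y :* u := r :* u :+ (y :- r) :* u) refl y r 1#
  leading-^ (suc d) with leading-^ d
  ... | divided h = divided λ r → let G′ , h′ , eq = h r in _ , leading-resp (suc d) (trans (+-congˡ (zeroʳ r)) (+-identityʳ 1#))
                             (leading-+ (suc d) (leading-^ d) (leading-* (suc d) r (leading-raise d h′))) , λ y → begin
    y * y ^ suc d
      ≈⟨ solve 3 (λ y r a → y :* a := r :* a :+ (y :- r) :* a) refl y r (y ^ suc d) ⟩
    r * y ^ suc d + (y - r) * y ^ suc d
      ≈⟨ +-congʳ (*-congˡ (eq y)) ⟩
    r * (r ^ suc d + (y - r) * G′ y) + (y - r) * y ^ suc d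
      ≈⟨ solve 5 (λ r b w u a → r :* (b :+ w :* u) :+ w :* a := r :* b :+ w :* (a :+ r :* u)) refl
           r (r ^ suc d) (y - r) (G′ y) (y ^ suc d) ⟩
    r * r ^ suc d + (y - r) * (y ^ suc d + r * G′ y) ∎

  -- Dividing by y - r₀ leaves a quotient G′ of lower degree. At another root rᵢ the product (rᵢ -
  -- r₀)·G′(rᵢ) vanishes; cancelling the difference makes rᵢ a root of G′.
  factor : ∀ d {l G} → LeadingCoeff d l G → (r : Fin d → Carrier) →
           (∀ i j → i ≢ j → ∀ x → (r i - r j) * x ≈ 0# → x ≈ 0#) →
           (∀ i → G (r i) ≈ 0#) → ∀ y → G y ≈ l * product (λ i → y - r i)
  factor zero    (constant h) r cancel root y = trans (h y) (sym (*-identityʳ _))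
  factor (suc d) {l} {G} (divided h) r cancel root y with h (r zero)
  ... | G′ , h′ , eq = begin
    G y                                             ≈⟨ trans (eq y) (trans (+-congʳ (root zero)) (+-identityˡ _)) ⟩
    (y - r zero) * G′ y                             ≈⟨ *-congˡ (factor d h′ (λ i → r (suc i))
                                                         (λ i j i≢j → cancel (suc i) (suc j) (i≢j ∘ suc-injective)) root′ y) ⟩
    (y - r zero) * (l * product (λ i → y - r (suc i)))
      ≈⟨ solve 3 (λ a b c → a :* (b :* c) := b :* (a :* c)) refl _ _ _ ⟩
    l * ((y - r zero) * product (λ i → y - r (suc i)))  ∎
    where
    open import Data.Fin.Properties using (suc-injective)
    open import Function using (_∘_)
    root′ : ∀ i → G′ (r (suc i)) ≈ 0#
    root′ i = cancel (suc i) zero (λ ()) _ (trans (sym (trans (+-congʳ (root zero)) (+-identityˡ _)))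
                (trans (sym (eq (r (suc i)))) (root (suc i))))

-- Quotient rings

-- The quotient keeps the carrier of R and only coarsens the equality.
module Quotient {c ℓ : Level} (R : CommutativeRing c ℓ) (f : CommutativeRing.Carrier R) where
  open CommutativeRing R hiding (zero)
  open IntegerSolver R

  infix 4 _≡ₘ_
  record _≡ₘ_ (x y : Carrier) : Set (c ⊔ ℓ) where
    constructor mod
    field
      {multiplier} : Carrier
      difference   : x ≈ y + f * multiplier
  open _≡ₘ_ public

  ≈⇒≡ₘ : ∀ {x y} → x ≈ y → x ≡ₘ y
  ≈⇒≡ₘ e = mod {multiplier = 0#} (trans e (sym (trans (+-congˡ (zeroʳ f)) (+-identityʳ _))))

  ≡ₘ-sym : ∀ {x y} → x ≡ₘ y → y ≡ₘ x
  ≡ₘ-sym {x} {y} (mod {h} e) = mod {multiplier = - h}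
    (sym (trans (+-congʳ e) (solve 3 (λ y f h → y :+ f :* h :+ f :* :- h := y) refl y f h)))

  ≡ₘ-trans : ∀ {x y z} → x ≡ₘ y → y ≡ₘ z → x ≡ₘ z
  ≡ₘ-trans {x} {y} {z} (mod {h} e) (mod {h′} e′) = mod {multiplier = h + h′}
    (trans e (trans (+-congʳ e′) (solve 4 (λ z f h h′ → z :+ f :* h′ :+ f :* h := z :+ f :* (h :+ h′)) refl z f h h′)))

  +-≡ₘ : ∀ {x x′ y y′} → x ≡ₘ x′ → y ≡ₘ y′ → x + y ≡ₘ x′ + y′
  +-≡ₘ {x} {x′} {y} {y′} (mod {h} e) (mod {h′} e′) = mod {multiplier = h + h′}
    (trans (+-cong e e′) (solve 5 (λ x y f h h′ → (x :+ f :* h) :+ (y :+ f :* h′) := x :+ y :+ f :* (h :+ h′)) refl x′ y′ f h h′))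

  *-≡ₘ : ∀ {x x′ y y′} → x ≡ₘ x′ → y ≡ₘ y′ → x * y ≡ₘ x′ * y′
  *-≡ₘ {x} {x′} {y} {y′} (mod {h} e) (mod {h′} e′) = mod {multiplier = x′ * h′ + h * y′ + f * h * h′}
    (trans (*-cong e e′) (solve 5 (λ x y f h h′ → (x :+ f :* h) :* (y :+ f :* h′)
      := x :* y :+ f :* (x :* h′ :+ h :* y :+ f :* h :* h′)) refl x′ y′ f h h′))

  neg-≡ₘ : ∀ {x y} → x ≡ₘ y → - x ≡ₘ - y
  neg-≡ₘ {x} {y} (mod {h} e) = mod {multiplier = - h}
    (trans (-‿cong e) (solve 3 (λ y f h → :- (y :+ f :* h) := :- y :+ f :* :- h) refl y f h))

  quotientRing : CommutativeRing c (c ⊔ ℓ)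
  quotientRing = record
    { Carrier = Carrier
    ; _≈_ = _≡ₘ_
    ; _+_ = _+_
    ; _*_ = _*_
    ; -_  = -_
    ; 0#  = 0#
    ; 1#  = 1#
    ; isCommutativeRing = record
      { isRing = record
        { +-isAbelianGroup = record
          { isGroup = record
            { isMonoid = record
              { isSemigroup = record
                { isMagma = record
                  { isEquivalence = record { refl = ≈⇒≡ₘ refl ; sym = ≡ₘ-sym ; trans = ≡ₘ-trans }
                  ; ∙-cong = +-≡ₘ
                  }
                ; assoc = λ x y z → ≈⇒≡ₘ (+-assoc x y z)
                }
              ; identity = (λ x → ≈⇒≡ₘ (+-identityˡ x)) , λ x → ≈⇒≡ₘ (+-identityʳ x)
              }
            ; inverse = (λ x → ≈⇒≡ₘ (-‿inverseˡ x)) , λ x → ≈⇒≡ₘ (-‿inverseʳ x)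
            ; ⁻¹-cong = neg-≡ₘ
            }
          ; comm = λ x y → ≈⇒≡ₘ (+-comm x y)
          }
        ; *-cong = *-≡ₘ
        ; *-assoc = λ x y z → ≈⇒≡ₘ (*-assoc x y z)
        ; *-identity = (λ x → ≈⇒≡ₘ (*-identityˡ x)) , λ x → ≈⇒≡ₘ (*-identityʳ x)
        ; distrib = (λ x y z → ≈⇒≡ₘ (distribˡ x y z)) , λ x y z → ≈⇒≡ₘ (distribʳ x y z)
        }
      ; *-comm = λ x y → ≈⇒≡ₘ (*-comm x y)
      }
    }

  open import Algebra.Properties.Semiring.Exp semiring using (_^_)
  open import Algebra.Properties.Semiring.Sum semiring using (sum)
  module Q = CommutativeRing quotientRing
  import Algebra.Properties.Semiring.Exp Q.semiring as QExp
  open import Data.Fin using (Fin; zero; suc)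

  ^-≡ₘ : ∀ n {x y} → x ≡ₘ y → x ^ n ≡ₘ y ^ n
  ^-≡ₘ zero    e = Q.refl
  ^-≡ₘ (suc n) e = *-≡ₘ e (^-≡ₘ n e)

  -- The two powers agree by computation only for literal exponents.
  ^-quotient : ∀ x n → x QExp.^ n ≡ x ^ n
  ^-quotient x zero    = ≡.refl
  ^-quotient x (suc n) = cong (x *_) (^-quotient x n)

  sum-≡ₘ : ∀ {n} {v w : Fin n → Carrier} → (∀ i → v i ≡ₘ w i) → sum v ≡ₘ sum w
  sum-≡ₘ {zero}  e = Q.refl
  sum-≡ₘ {suc n} e = +-≡ₘ (e zero) (sum-≡ₘ (λ i → e (suc i)))

-- Digit vectors as numbers

funToFin-cong : ∀ {m n} {f g : Fin m → Fin n} → (∀ i → f i ≡ g i) → funToFin f ≡ funToFin g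
funToFin-cong {zero}  e = ≡.refl
funToFin-cong {suc m} e = ≡.cong₂ Fin.combine (e Fin.zero) (funToFin-cong (λ i → e (Fin.suc i)))

finToFun-injective : ∀ {m n} (i j : Fin (m ℕ.^ n)) → (∀ t → finToFun {m} {n} i t ≡ finToFun j t) → i ≡ j
finToFun-injective {m} {n} i j e =
  ≡.trans (≡.sym (Finₚ.funToFin-finToFin {n} {m} i))
    (≡.trans (funToFin-cong {f = finToFun {m} {n} i} {finToFun j} e) (Finₚ.funToFin-finToFin {n} {m} j))

-- Finite fields

module FieldTheory {c ℓ : Level} {q : ℕ} (F : FiniteField c ℓ q) where
  open FiniteField F public
  open CommutativeRing ring hiding (zero; ring)
  open import Algebra.Properties.Semiring.Exp semiring using (_^_; ^-congˡ)
  open import Algebra.Properties.Semiring.Mult semiring using () renaming (_×_ to _·_)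
  open import Algebra.Properties.Group +-group using (identityˡ-unique)
  open import Data.Fin.Permutation using (Permutation; permutation; _⟨$⟩ʳ_)
  import Algebra.Properties.CommutativeMonoid.Sum as Sum
  open import Relation.Binary.Reasoning.Setoid setoid

  index : Carrier → Fin q
  index x = proj₁ (enum-surj x)

  enum-index : ∀ x → enum (index x) ≈ x
  enum-index x = proj₂ (enum-surj x)

  index-cong : ∀ {x y} → x ≈ y → index x ≡ index y
  index-cong {x} {y} e = enum-inj _ _ (trans (enum-index x) (trans e (sym (enum-index y))))

  index-enum : ∀ i → index (enum i) ≡ i
  index-enum i = enum-inj _ _ (enum-index (enum i))

  infix 4 _≟_
  _≟_ : ∀ x y → Dec (x ≈ y)
  x ≟ y with index x Fin.≟ index y
  ... | yes e = yes (trans (sym (enum-index x)) (trans (reflexive (cong enum e)) (enum-index y)))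
  ... | no ¬e = no λ e → ¬e (index-cong e)

  cancel-nonzero : ∀ {x y} → ¬ x ≈ 0# → x * y ≈ 0# → y ≈ 0#
  cancel-nonzero {x} {y} x≉0 xy≈0 with inverse x x≉0
  ... | x⁻¹ , xx⁻¹≈1 = begin
    y              ≈⟨ sym (trans (*-congʳ (trans (*-comm _ _) xx⁻¹≈1)) (*-identityˡ y)) ⟩
    x⁻¹ * x * y    ≈⟨ *-assoc _ _ _ ⟩
    x⁻¹ * (x * y)  ≈⟨ trans (*-congˡ xy≈0) (zeroʳ _) ⟩
    0#             ∎

  *-nonzero : ∀ {x y} → ¬ x ≈ 0# → ¬ y ≈ 0# → ¬ x * y ≈ 0#
  *-nonzero x≉0 y≉0 xy≈0 = y≉0 (cancel-nonzero x≉0 xy≈0)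

  module _ {a b} (M : CommutativeMonoid a b) where
    private module M = CommutativeMonoid M
    open Sum M using (sum; sum-cong-≋; sum-permute)

    -- A bijection of the field permutes its enumeration. The monoid is arbitrary because this
    -- serves sums under translation and products under dilation.
    sum-reindex : (w : Carrier → M.Carrier) → (∀ {x y} → x ≈ y → w x M.≈ w y) →
      (τ τ⁻¹ : Carrier → Carrier) → (∀ {x y} → x ≈ y → τ x ≈ τ y) → (∀ {x y} → x ≈ y → τ⁻¹ x ≈ τ⁻¹ y) →
      (∀ x → τ (τ⁻¹ x) ≈ x) → (∀ x → τ⁻¹ (τ x) ≈ x) →
      sum (λ i → w (enum i)) M.≈ sum (λ i → w (τ (enum i)))
    sum-reindex w w-cong τ τ⁻¹ τ-cong τ⁻¹-cong ττ⁻¹ τ⁻¹τ =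
      M.trans (sum-permute (λ i → w (enum i)) π) (sum-cong-≋ λ i → w-cong (enum-index (τ (enum i))))
      where
      π : Permutation q q
      π = permutation (λ i → index (τ (enum i))) (λ i → index (τ⁻¹ (enum i)))
        (λ i → ≡.trans (index-cong (trans (τ-cong (enum-index _)) (ττ⁻¹ _))) (index-enum i))
        (λ i → ≡.trans (index-cong (trans (τ⁻¹-cong (enum-index _)) (τ⁻¹τ _))) (index-enum i))

  -- Translating all elements by 1 does not change their sum.
  size·1≈0 : q · 1# ≈ 0#
  size·1≈0 = identityˡ-unique _ (sum (λ i → enum i)) (sym (begin
    sum (λ i → enum i)
      ≈⟨ sum-reindex +-commutativeMonoid (λ x → x) (λ e → e) (1# +_) (- 1# +_) +-congˡ +-congˡ
           (λ x → trans (sym (+-assoc _ _ _)) (trans (+-congʳ (-‿inverseʳ 1#)) (+-identityˡ x)))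
           (λ x → trans (sym (+-assoc _ _ _)) (trans (+-congʳ (-‿inverseˡ 1#)) (+-identityˡ x))) ⟩
    sum (λ i → 1# + enum i)
      ≈⟨ ∑-distrib-+ {q} (λ _ → 1#) enum ⟩
    sum {q} (λ _ → 1#) + sum enum
      ≈⟨ +-congʳ (sum-replicate q) ⟩
    q · 1# + sum enum ∎))
    where open Sum +-commutativeMonoid

  size-suc : ∃ λ q′ → q ≡ suc q′
  size-suc = positive (index 0#)
    where
    positive : ∀ {n} → Fin n → ∃ λ n′ → n ≡ suc n′
    positive {suc n} _ = n , ≡.refl

  private
    -- Replaces zero by one, so that a product over the whole enumeration becomes the product of the
    -- nonzero elements.
    nonzeroPart : Carrier → Carrier
    nonzeroPart x with x ≟ 0#
    ... | yes _ = 1#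
    ... | no  _ = x

    nonzeroPart-cong : ∀ {x y} → x ≈ y → nonzeroPart x ≈ nonzeroPart y
    nonzeroPart-cong {x} {y} e with x ≟ 0# | y ≟ 0#
    ... | yes _ | yes _ = refl
    ... | yes a | no  b = ⊥-elim (b (trans (sym e) a))
    ... | no  a | yes b = ⊥-elim (a (trans e b))
    ... | no  _ | no  _ = e

    nonzeroPart≉0 : ∀ x → ¬ nonzeroPart x ≈ 0#
    nonzeroPart≉0 x with x ≟ 0#
    ... | yes _ = λ e → 0≉1 (sym e)
    ... | no  a = a

    -- The factor that `nonzeroPart` picks up under x ↦ a·x; it is one at zero, which contributes
    -- nothing.
    multiplier : Carrier → Carrier → Carrier
    multiplier a x with x ≟ 0#
    ... | yes _ = 1#
    ... | no  _ = a

    nonzeroPart-* : ∀ {a} → ¬ a ≈ 0# → ∀ x → nonzeroPart (a * x) ≈ multiplier a x * nonzeroPart x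
    nonzeroPart-* {a} a≉0 x with x ≟ 0# | a * x ≟ 0#
    ... | yes _ | yes _ = sym (*-identityˡ 1#)
    ... | yes e | no  b = ⊥-elim (b (trans (*-congˡ e) (zeroʳ a)))
    ... | no  b | yes e = ⊥-elim (*-nonzero a≉0 b e)
    ... | no  _ | no  _ = refl

    multiplier-0 : ∀ a x → x ≈ 0# → multiplier a x ≈ 1#
    multiplier-0 a x e with x ≟ 0#
    ... | yes _ = refl
    ... | no  b = ⊥-elim (b e)

    multiplier-nonzero : ∀ a x → ¬ x ≈ 0# → multiplier a x ≈ a
    multiplier-nonzero a x x≉0 with x ≟ 0#
    ... | yes e = ⊥-elim (x≉0 e)
    ... | no  _ = refl

  -- For nonzero x, dilation by x permutes the nonzero elements, so it fixes their product while
  -- multiplying it by x^(q-1). That product is nonzero and cancels.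
  fermat : ∀ x → x ^ q ≈ x
  fermat x with size-suc | x ≟ 0#
  ... | q′ , ≡.refl | yes x≈0 = trans (*-congʳ x≈0) (trans (zeroˡ _) (sym x≈0))
  ... | q′ , ≡.refl | no  x≉0 = begin
    x * x ^ q′                          ≈⟨ *-congˡ (sym (trans (prod-cong (λ j → multiplier-nonzero x _ (others j))) (prod-replicate q′))) ⟩
    x * prod (removeAt m (index 0#))    ≈⟨ *-congˡ (trans (sym (*-identityˡ _)) (*-congʳ (sym (multiplier-0 x _ (enum-index 0#))))) ⟩
    x * (m (index 0#) * prod (removeAt m (index 0#)))  ≈⟨ *-congˡ (sym (prod-remove m)) ⟩
    x * prod m                          ≈⟨ *-congˡ prod-m≈1 ⟩
    x * 1#                              ≈⟨ *-identityʳ x ⟩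
    x                                   ∎
    where
    open Sum *-commutativeMonoid
      renaming (sum to prod; sum-cong-≋ to prod-cong; sum-remove to prod-remove; sum-replicate to prod-replicate)
    open import Data.Vec.Functional using (removeAt)
    m W : Fin q → Carrier
    m i = multiplier x (enum i)
    W i = nonzeroPart (enum i)
    others : ∀ j → ¬ enum (punchIn (index 0#) j) ≈ 0#
    others j e = Finₚ.punchInᵢ≢i (index 0#) j (enum-inj _ _ (trans e (sym (enum-index 0#))))
    x⁻¹ = proj₁ (inverse x x≉0)
    xx⁻¹≈1 = proj₂ (inverse x x≉0)
    prod≉0 : ∀ {n} (v : Fin n → Carrier) → (∀ i → ¬ v i ≈ 0#) → ¬ prod v ≈ 0#
    prod≉0 {zero}  v v≉0 e = 0≉1 (sym e)
    prod≉0 {suc n} v v≉0 e = *-nonzero (v≉0 Fin.zero) (prod≉0 (λ i → v (Fin.suc i)) (λ i → v≉0 (Fin.suc i))) e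
    invariant : prod W ≈ prod m * prod W
    invariant = begin
      prod W
        ≈⟨ sum-reindex *-commutativeMonoid nonzeroPart nonzeroPart-cong (x *_) (x⁻¹ *_) *-congˡ *-congˡ
             (λ y → trans (sym (*-assoc _ _ _)) (trans (*-congʳ xx⁻¹≈1) (*-identityˡ y)))
             (λ y → trans (sym (*-assoc _ _ _)) (trans (*-congʳ (trans (*-comm _ _) xx⁻¹≈1)) (*-identityˡ y))) ⟩
      prod (λ i → nonzeroPart (x * enum i))  ≈⟨ prod-cong (λ i → nonzeroPart-* x≉0 (enum i)) ⟩
      prod (λ i → m i * W i)                 ≈⟨ ∑-distrib-+ m W ⟩
      prod m * prod W                        ∎
    open IntegerSolver ring
    open import Algebra.Properties.Group +-group using (x∙y⁻¹≈ε⇒x≈y)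
    prod-m≈1 : prod m ≈ 1#
    prod-m≈1 = x∙y⁻¹≈ε⇒x≈y _ _ (cancel-nonzero (prod≉0 W (λ i → nonzeroPart≉0 (enum i))) (begin
      prod W * (prod m - 1#)         ≈⟨ solve 3 (λ w m u → w :* (m :- u) := m :* w :- w :* u) refl _ _ _ ⟩
      prod m * prod W - prod W * 1#  ≈⟨ +-cong (sym invariant) (-‿cong (*-identityʳ _)) ⟩
      prod W - prod W                ≈⟨ -‿inverseʳ _ ⟩
      0#                             ∎))

-- Polynomials over a finite field
module FieldPolynomials {c ℓ : Level} {q : ℕ} (F : FiniteField c ℓ q) where
  module F where
    open FieldTheory F public
    open CommutativeRing ring hiding (zero; ring) public
  open PolyOver F.ring
    using (Poly; coeff; constₚ; oneₚ; HasDegree; Irreducible; IsUnitₚ; _∣ₚ_) public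
  open PolynomialRing F.ring
    using (_≋_; wrap; unwrap; ⊛-def; polynomialRing)
    renaming (coeff-⊕ to coeff-+; coeff-⊝ to coeff-neg; coeff-∷⊛ to coeff-∷*; coeff-⊛∷ to coeff-*∷; coeff-const⊛ to coeff-const*) public
  open CommutativeRing polynomialRing hiding (zero) public
  open IntegerSolver polynomialRing using (solve; _:=_; _:+_; _:*_; _:-_; :-_) public
  open import Relation.Binary.Reasoning.Setoid setoid
  module F-Reasoning where
    open import Relation.Binary.Reasoning.Setoid F.setoid public

  infix 4 _∣_
  record _∣_ (f g : Poly) : Set (c ⊔ ℓ) where
    constructor divs
    field
      {quot}   : Poly
      multiple : f * quot ≈ g
  open _∣_ public

  ∣⇒∣ₚ : ∀ {f g} → f ∣ g → f ∣ₚ g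
  ∣⇒∣ₚ {f} (divs {h} e) = h , unwrap (≡.subst (_≋ _) (⊛-def f h) e)

  ∣ₚ⇒∣ : ∀ {f g} → f ∣ₚ g → f ∣ g
  ∣ₚ⇒∣ {f} (h , e) = divs {quot = h} (≡.subst (_≋ _) (≡.sym (⊛-def f h)) (wrap e))

  ∣-refl : ∀ {f} → f ∣ f
  ∣-refl {f} = divs (*-identityʳ f)

  ∣-trans : ∀ {f g h} → f ∣ g → g ∣ h → f ∣ h
  ∣-trans (divs e) (divs e′) = divs (trans (sym (*-assoc _ _ _)) (trans (*-congʳ e) e′))

  ∣-resp : ∀ {f g h} → g ≈ h → f ∣ g → f ∣ h
  ∣-resp e (divs e′) = divs (trans e′ e)

  ∣-+ : ∀ {f g h} → f ∣ g → f ∣ h → f ∣ g + h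
  ∣-+ (divs e) (divs e′) = divs (trans (distribˡ _ _ _) (+-cong e e′))

  ∣-*ʳ : ∀ {f g} h → f ∣ g → f ∣ g * h
  ∣-*ʳ h (divs e) = divs (trans (sym (*-assoc _ _ _)) (*-congʳ e))

  ∣-*ˡ : ∀ {f g} h → f ∣ g → f ∣ h * g
  ∣-*ˡ h d = ∣-resp (*-comm _ h) (∣-*ʳ h d)

  ∣-zero : ∀ {f g} → g ≈ 0# → f ∣ g
  ∣-zero {f} e = divs (trans (zeroʳ f) (sym e))

  ∣-neg : ∀ {f g} → f ∣ g → f ∣ - g
  ∣-neg {f} (divs {h} e) = divs {quot = - h} (trans (solve 2 (λ f h → f :* :- h := :- (f :* h)) refl f h) (-‿cong e))

  record Below (m : ℕ) (p : Poly) : Set ℓ where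
    constructor below
    field coeff≈0 : ∀ i → m ℕ.≤ i → coeff p i F.≈ F.0#
  open Below public

  record Degree (p : Poly) (d : ℕ) : Set ℓ where
    constructor degree
    field
      leading≉0 : ¬ (coeff p d F.≈ F.0#)
      bounded   : Below (suc d) p
  open Degree public

  below-0 : ∀ {p} → Below 0 p → p ≈ 0#
  below-0 b = wrap λ i → coeff≈0 b i ℕ.z≤n

  below-zero : ∀ {m p} → p ≈ 0# → Below m p
  below-zero p≈0 = below λ i _ → unwrap p≈0 i

  below-mono : ∀ {m m′ p} → m ℕ.≤ m′ → Below m p → Below m′ p
  below-mono m≤m′ b = below λ i m′≤i → coeff≈0 b i (ℕₚ.≤-trans m≤m′ m′≤i)

  below-+ : ∀ {m p r} → Below m p → Below m r → Below m (p + r)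
  below-+ {m} {p} {r} b b′ = below λ i m≤i →
    F.trans (coeff-+ p r i) (F.trans (F.+-cong (coeff≈0 b i m≤i) (coeff≈0 b′ i m≤i)) (F.+-identityˡ F.0#))

  below-neg : ∀ {m p} → Below m p → Below m (- p)
  below-neg {m} {p} b = below λ i m≤i → F.trans (coeff-neg p i) (F.trans (F.-‿cong (coeff≈0 b i m≤i)) ε⁻¹≈ε)
    where open import Algebra.Properties.Group F.+-group using (ε⁻¹≈ε)

  zero-or-degree : ∀ p → p ≈ 0# ⊎ ∃ (Degree p)
  zero-or-degree [] = inj₁ refl
  zero-or-degree (a ∷ p) with zero-or-degree p
  ... | inj₂ (d , degree top above) = inj₂ (suc d , degree top (below λ { (suc i) (ℕ.s≤s d<i) → coeff≈0 above i d<i }))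
  ... | inj₁ p≈0 with a F.≟ F.0#
  ...   | yes a≈0 = inj₁ (wrap λ { zero → a≈0 ; (suc i) → unwrap p≈0 i })
  ...   | no  a≉0 = inj₂ (0 , degree a≉0 (below λ { (suc i) _ → unwrap p≈0 i }))

  below-resp : ∀ {m p r} → p ≈ r → Below m p → Below m r
  below-resp e b = below λ i m≤i → F.trans (F.sym (unwrap e i)) (coeff≈0 b i m≤i)

  degree-resp : ∀ {p r d} → p ≈ r → Degree p d → Degree r d
  degree-resp e (degree top above) = degree (λ z → top (F.trans (unwrap e _) z)) (below-resp e above)

  degree<below : ∀ {p d m} → Degree p d → Below m p → d ℕ.< m
  degree<below {d = d} {m} (degree top _) b with d ℕ.<? m
  ... | yes d<m = d<m
  ... | no  d≮m = ⊥-elim (top (coeff≈0 b d (ℕₚ.≮⇒≥ d≮m)))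

  degree-unique : ∀ {p d d′} → Degree p d → Degree p d′ → d ≡ d′
  degree-unique D D′ = ℕₚ.≤-antisym (ℕₚ.≤-pred (degree<below D (bounded D′))) (ℕₚ.≤-pred (degree<below D′ (bounded D)))

  degree⇒≉0 : ∀ {p d} → Degree p d → ¬ p ≈ 0#
  degree⇒≉0 (degree top _) e = top (unwrap e _)

  coeff-*-below : ∀ d e p r → Below (suc d) p → Below (suc e) r →
    coeff (p * r) (d ℕ.+ e) F.≈ coeff p d F.* coeff r e × Below (suc (d ℕ.+ e)) (p * r)
  coeff-*-below d e [] r bp br = F.trans (unwrap (zeroˡ r) _) (F.sym (F.zeroˡ _)) , below-zero (zeroˡ r)
  coeff-*-below zero e (a ∷ p) r bp br =
    value e , below λ i e<i → F.trans (value i) (F.trans (F.*-congˡ (coeff≈0 br i e<i)) (F.zeroʳ a))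
    where
    p≈0 : p ≈ 0#
    p≈0 = wrap λ i → coeff≈0 bp (suc i) (ℕ.s≤s ℕ.z≤n)
    value : ∀ i → coeff ((a ∷ p) * r) i F.≈ a F.* coeff r i
    value i = F.trans (coeff-∷* a p r i) (F.trans (F.+-congˡ (vanish i)) (F.+-identityʳ _))
      where
      vanish : ∀ i → coeff (F.0# ∷ (p * r)) i F.≈ F.0#
      vanish zero    = F.refl
      vanish (suc i) = unwrap (trans (*-congʳ p≈0) (zeroˡ r)) i
  coeff-*-below (suc d) e (a ∷ p) r bp br
    with coeff-*-below d e p r (below λ i d<i → coeff≈0 bp (suc i) (ℕ.s≤s d<i)) br
  ... | top , above =
    F.trans (coeff-∷* a p r (suc (d ℕ.+ e)))
      (F.trans (F.+-congʳ (F.trans (F.*-congˡ (coeff≈0 br _ (ℕ.s≤s (ℕₚ.m≤n+m e d)))) (F.zeroʳ a))) (F.trans (F.+-identityˡ _) top))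
    , below λ { (suc i) (ℕ.s≤s lt) →
      F.trans (coeff-∷* a p r (suc i))
        (F.trans (F.+-cong (F.trans (F.*-congˡ (coeff≈0 br _ (ℕₚ.≤-trans (ℕ.s≤s (ℕₚ.m≤n+m e d)) (ℕₚ.≤-trans lt (ℕₚ.n≤1+n i))))) (F.zeroʳ a)) (coeff≈0 above i lt))
          (F.+-identityˡ _)) }

  degree-* : ∀ {p r d e} → Degree p d → Degree r e → Degree (p * r) (d ℕ.+ e)
  degree-* {p} {r} {d} {e} (degree top above) (degree top′ above′) with coeff-*-below d e p r above above′
  ... | eq , b = degree (λ z → F.*-nonzero top top′ (F.trans (F.sym eq) z)) b

  cancel-nonzero : ∀ {p r} → ¬ p ≈ 0# → p * r ≈ 0# → r ≈ 0#
  cancel-nonzero {p} {r} p≉0 pr≈0 with zero-or-degree p | zero-or-degree r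
  ... | inj₁ p≈0 | _ = ⊥-elim (p≉0 p≈0)
  ... | inj₂ _   | inj₁ r≈0 = r≈0
  ... | inj₂ (_ , D) | inj₂ (_ , D′) = ⊥-elim (degree⇒≉0 (degree-* D D′) pr≈0)

  multiple-below : ∀ {f d r} → Degree f d → f ∣ r → Below d r → r ≈ 0#
  multiple-below {f} {d} D (divs {h} e) b with zero-or-degree h
  ... | inj₁ h≈0 = trans (sym e) (trans (*-congˡ h≈0) (zeroʳ f))
  ... | inj₂ (d′ , D′) = ⊥-elim (ℕₚ.<⇒≱ (degree<below (degree-resp e (degree-* D D′)) b) (ℕₚ.m≤m+n d d′))

  coeff-- : ∀ p a g i → coeff (p - constₚ a * g) i F.≈ coeff p i F.- a F.* coeff g i
  coeff-- p a g i = F.trans (coeff-+ p (- (constₚ a * g)) i)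
    (F.+-congˡ (F.trans (coeff-neg (constₚ a * g) i) (F.-‿cong (coeff-const* a g i))))

  divMod : ∀ {g d} → Degree g d → ∀ p → ∃ λ Q → ∃ λ r → p ≈ g * Q + r × Below d r
  divMod {g} {d} D [] = 0# , 0# , sym (trans (+-congʳ (zeroʳ g)) (+-identityˡ _)) , below-zero refl
  divMod {g} {d} D (a ∷ p) with divMod D p | F.inverse (coeff g d) (leading≉0 D)
  ... | Q , r , eq , b | l⁻¹ , ll⁻¹≈1 = (t ∷ Q) , ((a ∷ r) - constₚ t * g) , wrap equation , below remainder
    where
    -- From p = g·Q + r follows a + X·p = g·(X·Q) + (a + X·r). Only the coefficient of degree d in a
    -- + X·r may be too high, and subtracting t·g removes it.
    t = coeff (a ∷ r) d F.* l⁻¹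
    step : ∀ i → coeff (a ∷ p) i F.≈ coeff (F.0# ∷ (g * Q)) i F.+ coeff (a ∷ r) i
    step zero    = F.sym (F.+-identityˡ a)
    step (suc i) = F.trans (unwrap eq i) (coeff-+ (g * Q) r i)
    module S = IntegerSolver F.ring
    equation : ∀ i → coeff (a ∷ p) i F.≈ coeff (g * (t ∷ Q) + ((a ∷ r) - constₚ t * g)) i
    equation i = F.trans (step i) (F.sym (F.trans (coeff-+ (g * (t ∷ Q)) _ i)
      (F.trans (F.+-cong (coeff-*∷ g t Q i) (coeff-- (a ∷ r) t g i))
        (S.solve 4 (λ x y u v → (x S.:* y S.:+ u) S.:+ (v S.:- y S.:* x) S.:= u S.:+ v) F.refl
          (coeff g i) t (coeff (F.0# ∷ (g * Q)) i) (coeff (a ∷ r) i)))))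
    remainder : ∀ i → d ℕ.≤ i → coeff ((a ∷ r) - constₚ t * g) i F.≈ F.0#
    remainder i d≤i = F.trans (coeff-- (a ∷ r) t g i) (vanish i d≤i)
      where
      vanish : ∀ i → d ℕ.≤ i → coeff (a ∷ r) i F.- t F.* coeff g i F.≈ F.0#
      vanish i d≤i with ℕₚ.m≤n⇒m<n∨m≡n d≤i
      ... | inj₂ ≡.refl = F.trans (F.+-congˡ (F.-‿cong (F.trans (F.*-assoc _ _ _)
              (F.trans (F.*-congˡ (F.trans (F.*-comm _ _) ll⁻¹≈1)) (F.*-identityʳ _))))) (F.-‿inverseʳ _)
      ... | inj₁ d<i = F.trans (F.+-cong (high i d<i) (F.-‿cong (F.trans (F.*-congˡ (coeff≈0 (bounded D) i d<i)) (F.zeroʳ t)))) (F.-‿inverseʳ _)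
        where
        high : ∀ i → d ℕ.< i → coeff (a ∷ r) i F.≈ F.0#
        high (suc i) (ℕ.s≤s d≤i) = coeff≈0 b i d≤i

  ∣? : ∀ g p → Dec (g ∣ p)
  ∣? g p with zero-or-degree g
  ... | inj₁ g≈0 with zero-or-degree p
  ...   | inj₁ p≈0 = yes (∣-zero p≈0)
  ...   | inj₂ (_ , D) = no λ { (divs e) → degree⇒≉0 D (trans (sym e) (trans (*-congʳ g≈0) (zeroˡ _))) }
  ∣? g p | inj₂ (d , D) with divMod D p
  ... | Q , r , eq , b with zero-or-degree r
  ...   | inj₁ r≈0 = yes (divs (sym (trans eq (trans (+-congˡ r≈0) (+-identityʳ _)))))
  ...   | inj₂ (_ , D′) = no λ g∣p → degree⇒≉0 D′ (multiple-below D
            (∣-resp (trans (+-congʳ eq) (solve 2 (λ u v → (u :+ v) :- u := v) refl (g * Q) r))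
              (∣-+ g∣p (∣-neg (∣-*ʳ Q ∣-refl)))) b)

  record GcdCombination (p g : Poly) : Set (c ⊔ ℓ) where
    field
      {divisor u w} : Poly
      combination   : divisor ≈ u * p + w * g
      divisor∣ˡ     : divisor ∣ p
      divisor∣ʳ     : divisor ∣ g

  -- The Euclidean algorithm; the bound m on the second polynomial decreases at each division.
  bézout : ∀ m p g → Below m g → GcdCombination p g
  bézout m p g b with zero-or-degree g
  ... | inj₁ g≈0 = record
    { divisor = p ; u = 1# ; w = 0#
    ; combination = sym (trans (+-cong (*-identityˡ p) (zeroˡ g)) (+-identityʳ p))
    ; divisor∣ˡ = ∣-refl ; divisor∣ʳ = ∣-zero g≈0 }
  bézout zero p g b | inj₂ (_ , D) = ⊥-elim (degree⇒≉0 D (below-0 b))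
  bézout (suc m) p g b | inj₂ (d , D) with divMod D p
  ... | Q , r , eq , br = record
    { combination = trans combination (trans (+-congˡ (*-congˡ r≈)) (solve 5 (λ u g w p Q →
        u :* g :+ w :* (p :- g :* Q) := w :* p :+ (u :- w :* Q) :* g) refl u g w p Q))
    ; divisor∣ˡ = ∣-resp (sym eq) (∣-+ (∣-*ʳ Q divisor∣ˡ) divisor∣ʳ)
    ; divisor∣ʳ = divisor∣ˡ }
    where
    open GcdCombination (bézout m g r (below-mono (ℕₚ.≤-pred (degree<below D b)) br))
    r≈ : r ≈ p - g * Q
    r≈ = sym (trans (+-congʳ eq) (solve 2 (λ u v → (u :+ v) :- u := v) refl (g * Q) r))

  CoprimeTo : Poly → Poly → Set (c ⊔ ℓ)
  CoprimeTo h g = ∃ λ u → ∃ λ w → u * h + w * g ≈ 1#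

  unit-inverse : ∀ {g} (u : IsUnitₚ g) → g * proj₁ u ≈ 1#
  unit-inverse {g} (v , e) = ≡.subst (_≋ 1#) (≡.sym (⊛-def g v)) (wrap e)

  -- The greatest common divisor of h and g divides h, so it is a unit or an associate of h.
  irreducible-dichotomy : ∀ {h} → Irreducible h → ∀ g → h ∣ g ⊎ CoprimeTo h g
  irreducible-dichotomy {h} (_ , _ , split) g
    with bézout (suc (proj₁ bound)) h g (proj₂ bound)
    where
    bound : ∃ λ m → Below (suc m) g
    bound with zero-or-degree g
    ... | inj₁ g≈0 = 0 , below-zero g≈0
    ... | inj₂ (d , D) = d , bounded D
  ... | record { divisor = D ; u = u ; w = w ; combination = eq ; divisor∣ˡ = divs {D′} e ; divisor∣ʳ = D∣g }
      with split D D′ (unwrap (≡.subst (_≋ h) (⊛-def D D′) e))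
  ...   | inj₁ D-unit@(v , _) = inj₂ (u * v , w * v ,
          trans (solve 5 (λ u v h w g → (u :* v) :* h :+ (w :* v) :* g := (u :* h :+ w :* g) :* v) refl u v h w g)
            (trans (*-congʳ (sym eq)) (unit-inverse D-unit)))
  ...   | inj₂ D′-unit@(v , _) = inj₁ (∣-trans (divs (trans (trans (*-congʳ (sym e)) (*-assoc D D′ v))
            (trans (*-congˡ (unit-inverse D′-unit)) (*-identityʳ D)))) D∣g)

  irreducible-prime : ∀ {h} → Irreducible h → ∀ a b → h ∣ a * b → h ∣ a ⊎ h ∣ b
  irreducible-prime {h} irr a b h∣ab with irreducible-dichotomy irr a
  ... | inj₁ h∣a = inj₁ h∣a
  ... | inj₂ (u , w , eq) = inj₂ (∣-resp
          (trans (solve 5 (λ u h w a b → (u :* h) :* b :+ w :* (a :* b) := (u :* h :+ w :* a) :* b) refl u h w a b)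
            (trans (*-congʳ eq) (*-identityˡ b)))
          (∣-+ (∣-*ʳ b (∣-*ˡ u ∣-refl)) (∣-*ˡ w h∣ab)))

  irreducible∤1 : ∀ {h} → Irreducible h → ¬ h ∣ 1#
  irreducible∤1 (_ , nonunit , _) d = nonunit (∣⇒∣ₚ d)

  fromDigits : ∀ {m} → (Fin m → F.Carrier) → Poly
  fromDigits = Data.List.tabulate
    where import Data.List

  coeff-fromDigits : ∀ {m} (v : Fin m → F.Carrier) i → coeff (fromDigits v) (toℕ i) ≡ v i
  coeff-fromDigits v Fin.zero    = ≡.refl
  coeff-fromDigits v (Fin.suc i) = coeff-fromDigits (λ j → v (Fin.suc j)) i

  below-fromDigits : ∀ {m} (v : Fin m → F.Carrier) → Below m (fromDigits v)
  below-fromDigits {zero}  v = below λ _ _ → F.refl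
  below-fromDigits {suc m} v = below λ { (suc i) (ℕ.s≤s m≤i) → coeff≈0 (below-fromDigits (λ j → v (Fin.suc j))) i m≤i }

  below-ext : ∀ {m p r} → Below m p → Below m r → (∀ (i : Fin m) → coeff p (toℕ i) F.≈ coeff r (toℕ i)) → p ≈ r
  below-ext {m} {p} {r} b b′ e = wrap λ i → agree i
    where
    agree : ∀ i → coeff p i F.≈ coeff r i
    agree i with i ℕ.<? m
    ... | yes i<m = subst (λ j → coeff p j F.≈ coeff r j) (Finₚ.toℕ-fromℕ< i<m) (e (fromℕ< i<m))
    ... | no  i≮m = F.trans (coeff≈0 b i (ℕₚ.≮⇒≥ i≮m)) (F.sym (coeff≈0 b′ i (ℕₚ.≮⇒≥ i≮m)))

  -- Serves twice: as a system of representatives modulo a polynomial of degree m, and as the finite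
  -- search space for factors.
  enumBelow : ∀ m → Fin (q ℕ.^ m) → Poly
  enumBelow m i = fromDigits (λ t → F.enum (finToFun {q} {m} i t))

  enumBelow-surj : ∀ {m r} → Below m r → ∃ λ i → enumBelow m i ≈ r
  enumBelow-surj {m} {r} b = i , below-ext (below-fromDigits _) b λ t →
      F.trans (F.reflexive (≡.trans (coeff-fromDigits (λ t → F.enum (finToFun {q} {m} i t)) t)
                (cong F.enum (Finₚ.finToFun-funToFin {m} {q} digits t)))) (F.enum-index _)
    where
    digits : Fin m → Fin q
    digits t = F.index (coeff r (toℕ t))
    i = funToFin digits

  module ResidueField {f : Poly} {k : ℕ} (irr : Irreducible f) (D : Degree f k) where
    open Quotient polynomialRing f public

    ≡ₘ⇒∣ : ∀ {x y} → x ≡ₘ y → f ∣ x - y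
    ≡ₘ⇒∣ {x} {y} (mod {h} e) = divs {quot = h} (sym (trans (+-congʳ e)
      (solve 2 (λ y u → (y :+ u) :- y := u) refl y (f * h))))

    residueField : FiniteField c (c ⊔ ℓ) (q ℕ.^ k)
    residueField = record
      { ring = quotientRing
      ; 0≉1 = λ e → irreducible∤1 irr (∣-resp (solve 1 (λ u → u :- (u :- u) := u) refl 1#) (∣-neg′ (≡ₘ⇒∣ e)))
      ; inverse = inverse
      ; enum = enumBelow k
      ; enum-inj = injective
      ; enum-surj = surjective
      }
      where
      ∣-neg′ : f ∣ 0# - 1# → f ∣ 1# - (1# - 1#)
      ∣-neg′ d = ∣-resp (trans (-‿cong (+-congʳ {x = - 1#} (sym (-‿inverseʳ 1#))))
                   (solve 1 (λ u → :- ((u :- u) :- u) := u :- (u :- u)) refl 1#)) (∣-neg d)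
      inverse : ∀ x → ¬ x ≡ₘ 0# → ∃ λ y → x * y ≡ₘ 1#
      inverse x x≢0 with irreducible-dichotomy irr x
      ... | inj₁ (divs {h} e) = ⊥-elim (x≢0 (mod {multiplier = h} (trans (sym e) (sym (+-identityˡ _)))))
      ... | inj₂ (u , w , eq) = w , mod {multiplier = - u} (trans
              (solve 4 (λ x w u f → x :* w := (u :* f :+ w :* x) :+ f :* :- u) refl x w u f) (+-congʳ eq))
      injective : ∀ i j → enumBelow k i ≡ₘ enumBelow k j → i ≡ j
      injective i j e = finToFun-injective {q} {k} i j λ t → F.enum-inj _ _
          (F.trans (F.reflexive (≡.sym (coeff-fromDigits (digits i) t)))
            (F.trans (unwrap same (toℕ t)) (F.reflexive (coeff-fromDigits (digits j) t))))
        where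
        open import Algebra.Properties.Group +-group using (x∙y⁻¹≈ε⇒x≈y)
        digits : Fin (q ℕ.^ k) → Fin k → F.Carrier
        digits i t = F.enum (finToFun {q} {k} i t)
        same : enumBelow k i ≈ enumBelow k j
        same = x∙y⁻¹≈ε⇒x≈y _ _ (multiple-below D (≡ₘ⇒∣ e)
          (below-+ (below-fromDigits (digits i)) (below-neg (below-fromDigits (digits j)))))
      surjective : ∀ x → ∃ λ i → enumBelow k i ≡ₘ x
      surjective x with divMod D x
      ... | Q , r , eq , b with enumBelow-surj b
      ...   | i , e = i , ≡ₘ-sym (mod {multiplier = Q} (trans eq (trans (+-comm _ _) (+-congʳ (sym e)))))

-- Factorisation and Berlekamp's subalgebra
module Berlekamp {c ℓ : Level} {q : ℕ} (F : FiniteField c ℓ q) where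
  open FieldPolynomials F public
  open PolyOver F.ring using (_*ₚ_; _≈ₚ_; productₚ; IrredFactorization) public
  open import Algebra.Properties.Semiring.Exp semiring using (_^_)
  open import Algebra.Properties.CommutativeMonoid.Sum *-commutativeMonoid
    using () renaming (sum to product)
  open import Algebra.Properties.Group +-group using (x∙y⁻¹≈ε⇒x≈y)
  open import Algebra.Properties.Group F.+-group using () renaming (x∙y⁻¹≈ε⇒x≈y to F-x∙y⁻¹≈ε⇒x≈y)
  import Algebra.Properties.Semiring.Exp F.semiring as FExp

  toDegree : ∀ {p d} → HasDegree p d → Degree p d
  toDegree (top , above) = degree top (below above)

  const-cong : ∀ {x y} → x F.≈ y → constₚ x ≈ constₚ y
  const-cong e = wrap λ { zero → e ; (suc i) → F.refl }

  const-* : ∀ x y → constₚ x * constₚ y ≈ constₚ (x F.* y)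
  const-* x y = wrap λ i → F.trans (coeff-const* x (constₚ y) i) (rest i)
    where
    rest : ∀ i → x F.* coeff (constₚ y) i F.≈ coeff (constₚ (x F.* y)) i
    rest zero    = F.refl
    rest (suc i) = F.zeroʳ x

  const-- : ∀ x y → constₚ x - constₚ y ≈ constₚ (x F.- y)
  const-- x y = wrap λ i → F.trans (coeff-+ (constₚ x) (- constₚ y) i)
                  (F.trans (F.+-congˡ (coeff-neg (constₚ y) i)) (rest i))
    where
    open import Algebra.Properties.Group F.+-group using (ε⁻¹≈ε)
    rest : ∀ i → coeff (constₚ x) i F.- coeff (constₚ y) i F.≈ coeff (constₚ (x F.- y)) i
    rest zero    = F.refl
    rest (suc i) = F.trans (F.+-identityˡ _) ε⁻¹≈ε

  const-^ : ∀ x m → constₚ x ^ m ≈ constₚ (x FExp.^ m)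
  const-^ x zero    = refl
  const-^ x (suc m) = trans (*-congˡ (const-^ x m)) (const-* x _)

  const-injective : ∀ {x y} → constₚ x ≈ constₚ y → x F.≈ y
  const-injective e = unwrap e 0

  degree-0⇒unit : ∀ {g} → Degree g 0 → IsUnitₚ g
  degree-0⇒unit {g} D with F.inverse (coeff g 0) (leading≉0 D)
  ... | l⁻¹ , ll⁻¹≈1 = ∣⇒∣ₚ {g} {1#} (divs {quot = constₚ l⁻¹} (trans (*-comm g (constₚ l⁻¹)) (wrap λ i →
          F.trans (coeff-const* l⁻¹ g i) (value i))))
    where
    value : ∀ i → l⁻¹ F.* coeff g i F.≈ coeff oneₚ i
    value zero    = F.trans (F.*-comm _ _) ll⁻¹≈1
    value (suc i) = F.trans (F.*-congˡ (coeff≈0 (bounded D) (suc i) (ℕ.s≤s ℕ.z≤n))) (F.zeroʳ _)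

  degree-1 : Degree 1# 0
  degree-1 = degree (λ e → F.0≉1 (F.sym e)) (below λ { (suc i) _ → F.refl })

  divisor-degree : ∀ {p d g h} → Degree p d → g * h ≈ p →
    ∃ λ e → ∃ λ e′ → Degree g e × Degree h e′ × e ℕ.+ e′ ≡ d
  divisor-degree {g = g} {h} D eq with zero-or-degree g | zero-or-degree h
  ... | inj₁ g≈0 | _ = ⊥-elim (degree⇒≉0 D (trans (sym eq) (trans (*-congʳ g≈0) (zeroˡ h))))
  ... | inj₂ _ | inj₁ h≈0 = ⊥-elim (degree⇒≉0 D (trans (sym eq) (trans (*-congˡ h≈0) (zeroʳ g))))
  ... | inj₂ (e , E) | inj₂ (e′ , E′) = e , e′ , E , E′ , degree-unique (degree-resp eq (degree-* E E′)) D

  irreducible-degree : ∀ {h} → Irreducible h → ∃ λ d → Degree h (suc d)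
  irreducible-degree {h} (h≉0 , nonunit , _) with zero-or-degree h
  ... | inj₁ h≈0 = ⊥-elim (h≉0 (unwrap h≈0))
  ... | inj₂ (zero  , D) = ⊥-elim (nonunit (degree-0⇒unit D))
  ... | inj₂ (suc d , D) = d , D

  ∏ : List Poly → Poly
  ∏ = foldr _*_ 1#

  ∏-def : ∀ fs → ∏ fs ≡ productₚ fs
  ∏-def []       = ≡.refl
  ∏-def (f ∷ fs) = ≡.trans (⊛-def f (∏ fs)) (cong (f *ₚ_) (∏-def fs))

  ∏-++ : ∀ fs gs → ∏ (fs ++ gs) ≈ ∏ fs * ∏ gs
  ∏-++ []       gs = sym (*-identityˡ _)
  ∏-++ (f ∷ fs) gs = trans (*-congˡ (∏-++ fs gs)) (sym (*-assoc _ _ _))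

  Factorisation : Poly → List Poly → Set (c ⊔ ℓ)
  Factorisation p fs = All Irreducible fs × ∃ λ u → p ≈ constₚ u * ∏ fs

  toFactorisation : ∀ {p fs} → IrredFactorization p fs → Factorisation p fs
  toFactorisation {p} {fs} (irr , u , e) = irr , u ,
    subst (p ≈_) (≡.sym (≡.trans (⊛-def (constₚ u) (∏ fs)) (cong (constₚ u *ₚ_) (∏-def fs)))) (wrap e)

  fromFactorisation : ∀ {p fs} → Factorisation p fs → IrredFactorization p fs
  fromFactorisation {p} {fs} (irr , u , e) = irr , u , unwrap
    (subst (p ≈_) (≡.trans (⊛-def (constₚ u) (∏ fs)) (cong (constₚ u *ₚ_) (∏-def fs))) e)

  -- An associate of p is not excluded here. The search in `factorise` excludes it by running only
  -- over polynomials of degree below that of p.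
  ProperDivisor : Poly → Poly → Set (c ⊔ ℓ)
  ProperDivisor p g = ∃ λ e → Degree g e × 0 ℕ.< e × g ∣ p

  properDivisor? : ∀ p g → Dec (ProperDivisor p g)
  properDivisor? p g with zero-or-degree g
  ... | inj₁ g≈0 = no λ { (_ , D , _) → degree⇒≉0 D g≈0 }
  ... | inj₂ (e , D) with 0 ℕ.<? e | ∣? g p
  ...   | yes 0<e | yes g∣p = yes (e , D , 0<e , g∣p)
  ...   | no  0≮e | _ = no λ { (e′ , D′ , 0<e′ , _) → 0≮e (subst (0 ℕ.<_) (degree-unique D′ D) 0<e′) }
  ...   | yes _ | no g∤p = no λ { (_ , _ , _ , g∣p) → g∤p g∣p }

  -- There are finitely many candidates of smaller degree. A divisor among them splits p into two
  -- factors of smaller degree; if there is none, p is irreducible. The bound m carries the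
  -- recursion.
  factorise : ∀ m {p d} → Degree p d → d ℕ.≤ m → ∃ (Factorisation p)
  factorise m {p} {zero} D _ = [] , [] , coeff p 0 , wrap λ i → F.sym (F.trans (coeff-const* (coeff p 0) 1# i) (value i))
    where
    value : ∀ i → coeff p 0 F.* coeff oneₚ i F.≈ coeff p i
    value zero    = F.*-identityʳ _
    value (suc i) = F.trans (F.zeroʳ _) (F.sym (coeff≈0 (bounded D) (suc i) (ℕ.s≤s ℕ.z≤n)))
  factorise (suc m) {p} {suc d} D (ℕ.s≤s d≤m) with Finₚ.any? (λ i → properDivisor? p (enumBelow (suc d) i))
  ... | yes (i , suc e , E , _ , divs {h} eq) with divisor-degree D eq
  ...   | e₁ , e₂ , E₁ , E₂ , sum-eq
      with factorise m E (ℕₚ.≤-trans (ℕₚ.≤-pred (degree<below E (below-fromDigits (λ t → F.enum (finToFun {q} {suc d} i t))))) d≤m)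
         | factorise m E₂ (ℕₚ.≤-trans (ℕₚ.≤-trans (ℕₚ.m≤n+m e₂ e) (ℕₚ.≤-reflexive
             (ℕₚ.suc-injective (≡.trans (cong (ℕ._+ e₂) (degree-unique E E₁)) sum-eq)))) d≤m)
  ...     | fs , irr , u , eq₁ | gs , irr′ , u′ , eq₂ = fs ++ gs , ++⁺ irr irr′ , u F.* u′ ,
        trans (sym eq) (trans (*-cong eq₁ eq₂)
          (trans (solve 4 (λ a b x y → (a :* x) :* (b :* y) := (a :* b) :* (x :* y)) refl
                   (constₚ u) (constₚ u′) (∏ fs) (∏ gs))
            (*-cong (const-* u u′) (sym (∏-++ fs gs)))))
  factorise (suc m) {p} {suc d} D (ℕ.s≤s d≤m) | no none =
      (p ∷ []) , (irreducible ∷ []) , F.1# , sym (trans (*-identityˡ _) (*-identityʳ p))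
    where
    no-proper : ∀ {g h e e′} → g * h ≈ p → Degree g (suc e) → suc e ℕ.+ suc e′ ≡ suc d → ⊥
    no-proper {g} {h} {e} {e′} eq E sum-eq with enumBelow-surj {suc d} {g} (below-mono small (bounded E))
      where
      small : suc (suc e) ℕ.≤ suc d
      small = ℕₚ.≤-trans (ℕₚ.≤-trans (ℕₚ.m≤m+n (suc (suc e)) e′) (ℕₚ.≤-reflexive (≡.sym (ℕₚ.+-suc (suc e) e′))))
                (ℕₚ.≤-reflexive sum-eq)
    ... | i , i≈g = none (i , suc e , degree-resp (sym i≈g) E , ℕ.s≤s ℕ.z≤n ,
                      divs {quot = h} (trans (*-congʳ i≈g) eq))
    irreducible : Irreducible p
    irreducible = (λ e → degree⇒≉0 D (wrap e)) , nonunit , split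
      where
      nonunit : ¬ IsUnitₚ p
      nonunit u with divisor-degree degree-1 (unit-inverse u)
      ... | e , _ , E , _ , sum-eq with degree-unique E D
      ...   | ≡.refl = ⊥-elim (ℕₚ.1+n≢0 sum-eq)
      split : ∀ g h → g *ₚ h ≈ₚ p → IsUnitₚ g ⊎ IsUnitₚ h
      split g h e with divisor-degree D (subst (_≋ p) (≡.sym (⊛-def g h)) (wrap e))
      ... | zero  , _ , E , _ = inj₁ (degree-0⇒unit E)
      ... | suc _ , zero , _ , E′ , _ = inj₂ (degree-0⇒unit E′)
      ... | suc e₁ , suc e₂ , E , E′ , sum-eq =
            ⊥-elim (no-proper (subst (_≋ p) (≡.sym (⊛-def g h)) (wrap e)) E sum-eq)

  size≥2 : ∃ λ q′ → q ≡ suc (suc q′)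
  size≥2 = two (F.index F.0#) (F.index F.1#) λ e →
      F.0≉1 (F.trans (F.sym (F.enum-index _)) (F.trans (F.reflexive (cong F.enum e)) (F.enum-index _)))
    where
    two : ∀ {n} (i j : Fin n) → i ≢ j → ∃ λ n′ → n ≡ suc (suc n′)
    two {suc zero}    Fin.zero Fin.zero i≢j = ⊥-elim (i≢j ≡.refl)
    two {suc (suc n)} i        j        i≢j = n , ≡.refl

  -- b^q − b vanishes at all constants, whence it is the product of the b − x.
  root-product : ∀ b → b ^ q - b ≈ product (λ i → b - constₚ (F.enum i))
  root-product b = trans (+-congˡ (sym (-1*x≈-x b)))
      (trans (factor q leading (λ i → constₚ (F.enum i)) distinct root b)
        (trans (*-congʳ (+-identityʳ 1#)) (*-identityˡ _)))
    where
    open RootFactorization polynomialRing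
    open import Algebra.Properties.Ring (CommutativeRing.ring polynomialRing) using (-1*x≈-x)
    -- Since q ≥ 2, the function -y has coefficient 0 in degree q, so y^q - y has leading
    -- coefficient 1.
    raise : ∀ m → LeadingCoeff (suc (suc m)) 0# (λ y → - 1# * y)
    raise zero = leading-raise 1 (leading-* 1 (- 1#) (divided λ r → (λ _ → 1#) , constant (λ _ → refl) ,
                   λ y → trans (solve 2 (λ y r → y := r :+ (y :- r)) refl y r) (+-congˡ (sym (*-identityʳ _)))))
    raise (suc m) = leading-raise (suc (suc m)) (raise m)
    leading : LeadingCoeff q (1# + 0#) (λ y → y ^ q + - 1# * y)
    leading = subst (λ d → LeadingCoeff d (1# + 0#) (λ y → y ^ d + - 1# * y)) (≡.sym (proj₂ size≥2))
      (leading-+ (suc (suc (proj₁ size≥2))) (leading-^ (suc (proj₁ size≥2))) (raise (proj₁ size≥2)))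
    distinct : ∀ i j → i ≢ j → ∀ x → (constₚ (F.enum i) - constₚ (F.enum j)) * x ≈ 0# → x ≈ 0#
    distinct i j i≢j x = cancel-nonzero λ e → i≢j (F.enum-inj i j (const-injective (x∙y⁻¹≈ε⇒x≈y _ _ e)))
    root : ∀ i → constₚ (F.enum i) ^ q + - 1# * constₚ (F.enum i) ≈ 0#
    root i = trans (+-cong (trans (const-^ _ q) (const-cong (F.fermat _))) (-1*x≈-x _)) (-‿inverseʳ _)

  ∣-product : ∀ {n} (v : Fin n → Poly) i → v i ∣ product v
  ∣-product v Fin.zero    = ∣-*ʳ _ ∣-refl
  ∣-product v (Fin.suc i) = ∣-*ˡ _ (∣-product (λ j → v (Fin.suc j)) i)

  prime∣product : ∀ {h} → Irreducible h → ∀ {n} (v : Fin n → Poly) → h ∣ product v → ∃ λ i → h ∣ v i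
  prime∣product irr {zero}  v d = ⊥-elim (irreducible∤1 irr d)
  prime∣product irr {suc n} v d with irreducible-prime irr _ _ d
  ... | inj₁ d₀ = Fin.zero , d₀
  ... | inj₂ d′ with prime∣product irr (λ j → v (Fin.suc j)) d′
  ...   | i , dᵢ = Fin.suc i , dᵢ

  opaque
    -- The irreducible h divides the product of all b - x, hence one of its factors.
    residue : ∀ {h b} → Irreducible h → h ∣ b ^ q - b → ∃ λ x → h ∣ b - constₚ x
    residue {b = b} irr d with prime∣product irr (λ i → b - constₚ (F.enum i)) (∣-resp (root-product b) d)
    ... | i , dᵢ = F.enum i , dᵢ

  residue⇒fixed : ∀ {h b x} → h ∣ b - constₚ x → h ∣ b ^ q - b
  residue⇒fixed {b = b} {x} d = ∣-resp (sym (root-product b))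
    (∣-trans (∣-resp (+-congˡ (-‿cong (const-cong (F.sym (F.enum-index x))))) d)
      (∣-product (λ i → b - constₚ (F.enum i)) (F.index x)))

  ∣-difference : ∀ {h a b d} → h ∣ a - b → h ∣ a - d → h ∣ b - d
  ∣-difference {a = a} {b} {d} u v = ∣-resp
    (solve 3 (λ a b d → :- (a :- b) :+ (a :- d) := b :- d) refl a b d) (∣-+ (∣-neg u) v)

  ∣-sym : ∀ {h a b} → h ∣ a - b → h ∣ b - a
  ∣-sym {a = a} {b} u = ∣-resp (solve 2 (λ a b → :- (a :- b) := b :- a) refl a b) (∣-neg u)

  ∣-chain : ∀ {h a b d} → h ∣ a - b → h ∣ b - d → h ∣ a - d
  ∣-chain {a = a} {b} {d} u v = ∣-resp
    (solve 3 (λ a b d → (a :- b) :+ (b :- d) := a :- d) refl a b d) (∣-+ u v)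

  -- x - y is a constant multiple of h, and h has positive degree, so the difference is zero.
  residue-unique : ∀ {h b x y} → Irreducible h → h ∣ b - constₚ x → h ∣ b - constₚ y → x F.≈ y
  residue-unique {h} {b} {x} {y} irr u v with irreducible-degree irr
  ... | d , D = F-x∙y⁻¹≈ε⇒x≈y _ _ (const-injective {y = F.0#} (trans (multiple-below D
        (∣-resp (const-- x y) (∣-difference u v)) (below λ { (suc i) _ → F.refl }))
        (wrap λ { zero → F.refl ; (suc i) → F.refl })))

  -- Pairwise coprimality in the form in which the Chinese remainder theorem recurses: each entry
  -- against the product of its successors.
  CoprimeChain : List Poly → Set (c ⊔ ℓ)
  CoprimeChain []       = Level.Lift _ ⊤
    where open import Data.Unit using (⊤)
  CoprimeChain (h ∷ hs) = CoprimeTo h (∏ hs) × CoprimeChain hs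

  lookup∣∏ : ∀ hs i → lookup hs i ∣ ∏ hs
  lookup∣∏ (h ∷ hs) Fin.zero    = ∣-*ʳ _ ∣-refl
  lookup∣∏ (h ∷ hs) (Fin.suc i) = ∣-*ˡ _ (lookup∣∏ hs i)

  chineseRemainder : ∀ hs → CoprimeChain hs → (a : Fin (length hs) → Poly) →
    ∃ λ b → ∀ i → lookup hs i ∣ b - a i
  chineseRemainder []       _ a = 0# , λ ()
  chineseRemainder (h ∷ hs) ((u , w , eq) , chain) a with chineseRemainder hs chain (λ i → a (Fin.suc i))
  ... | b , b≡a = b′ , λ
      { Fin.zero → ∣-resp (trans (solve 6 (λ h P u w a b → h :* (b :* u :- a :* u) :=
          (a :* (w :* P) :+ b :* (u :* h)) :- a :* (u :* h :+ w :* P)) refl h P u w (a Fin.zero) b)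
          (+-congˡ (-‿cong (trans (*-congˡ eq) (*-identityʳ _))))) (∣-*ʳ _ ∣-refl)
      ; (Fin.suc i) → ∣-resp (trans (solve 7 (λ h P u w a b aᵢ →
            (b :* (u :* h :+ w :* P) :- aᵢ) :+ P :* (a :* w :- b :* w) :=
            (a :* (w :* P) :+ b :* (u :* h)) :- aᵢ) refl h P u w (a Fin.zero) b (a (Fin.suc i))) refl)
          (∣-+ (∣-resp (+-congʳ (sym (trans (*-congˡ eq) (*-identityʳ b)))) (b≡a i)) (∣-*ʳ _ (lookup∣∏ hs i))) }
    where
    P = ∏ hs
    -- As uh + wP = 1, the element wP is 1 modulo h and 0 modulo P, and uh is the reverse.
    b′ = a Fin.zero * (w * P) + b * (u * h)

  -- In b = uh·b + wP·b, replace b by a multiple of P in the first term and by a multiple of h in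
  -- the second; both terms are then multiples of h·P.
  ∏-divides : ∀ hs → CoprimeChain hs → ∀ {b} → (∀ i → lookup hs i ∣ b) → ∏ hs ∣ b
  ∏-divides []       _ {b} d = divs (*-identityˡ b)
  ∏-divides (h ∷ hs) ((u , w , eq) , chain) {b} d with d Fin.zero | ∏-divides hs chain (λ i → d (Fin.suc i))
  ... | divs {x} hx≈b | divs {y} Py≈b = divs {quot = u * y + w * x}
      (trans (solve 6 (λ h P u w x y → (h :* P) :* (u :* y :+ w :* x) := (u :* h) :* (P :* y) :+ (w :* P) :* (h :* x))
               refl h (∏ hs) u w x y)
        (trans (+-cong (*-congˡ Py≈b) (*-congˡ hx≈b))
          (trans (sym (distribʳ b _ _)) (trans (*-congʳ eq) (*-identityˡ b)))))

  Fixed : Poly → Poly → Set (c ⊔ ℓ)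
  Fixed h b = h ∣ b ^ q - b

  -- A bijection of the Frobenius-fixed elements of F[X]/h with F^N, in relational form, where
  -- equality on one side is congruence modulo h.
  record Coordinates (h : Poly) (N : ℕ) : Set (Level.suc (c ⊔ ℓ)) where
    field
      _HasCoordinates_ : Poly → (Fin N → F.Carrier) → Set (c ⊔ ℓ)
      exists   : ∀ {b} → Fixed h b → ∃ λ a → b HasCoordinates a
      realises : ∀ a → ∃ λ b → Fixed h b × b HasCoordinates a
      injects  : ∀ {b b′ a a′} → b HasCoordinates a → b′ HasCoordinates a′ → (∀ i → a i F.≈ a′ i) → h ∣ b - b′
      unique   : ∀ {b b′ a a′} → b HasCoordinates a → b′ HasCoordinates a′ → h ∣ b - b′ → ∀ i → a i F.≈ a′ i

  -- Realising a vector of F^N and reading off the other coordinates injects F^N into F^M, so q^N ≤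
  -- q^M with q > 1.
  coordinates-≤ : ∀ {h N M} → Coordinates h N → Coordinates h M → N ℕ.≤ M
  coordinates-≤ {h} {N} {M} X Y = ℕₚ.≮⇒≥ λ M<N → ℕₚ.<⇒≱ (ℕₚ.^-monoʳ-< q 1<q M<N)
      (Finₚ.injective⇒≤ {f = f} injective)
    where
    module X = Coordinates X
    module Y = Coordinates Y
    1<q : 1 ℕ.< q
    1<q = subst (1 ℕ.<_) (≡.sym (proj₂ size≥2)) (ℕ.s≤s (ℕ.s≤s ℕ.z≤n))
    source : Fin (q ℕ.^ N) → Fin N → F.Carrier
    source i t = F.enum (finToFun {q} {N} i t)
    element : Fin (q ℕ.^ N) → Poly
    element i = proj₁ (X.realises (source i))
    target : ∀ i → ∃ (element i Y.HasCoordinates_)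
    target i = Y.exists (proj₁ (proj₂ (X.realises (source i))))
    digits : Fin (q ℕ.^ N) → Fin M → Fin q
    digits i t = F.index (proj₁ (target i) t)
    f : Fin (q ℕ.^ N) → Fin (q ℕ.^ M)
    f i = funToFin (digits i)
    injective : ∀ {i j} → f i ≡ f j → i ≡ j
    injective {i} {j} e = finToFun-injective {q} {N} i j λ t → F.enum-inj _ _
      (X.unique (proj₂ (proj₂ (X.realises (source i)))) (proj₂ (proj₂ (X.realises (source j))))
        (Y.injects (proj₂ (target i)) (proj₂ (target j)) λ s →
          F.trans (F.sym (F.enum-index _)) (F.trans (F.reflexive (cong F.enum (same s))) (F.enum-index _))) t)
      where
      same : ∀ s → digits i s ≡ digits j s
      same s = ≡.trans (≡.sym (Finₚ.finToFun-funToFin (digits i) s))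
                 (≡.trans (cong (λ z → finToFun {q} {M} z s) e) (Finₚ.finToFun-funToFin (digits j) s))

  coordinates-unique : ∀ {h N M} → Coordinates h N → Coordinates h M → N ≡ M
  coordinates-unique X Y = ℕₚ.≤-antisym (coordinates-≤ X Y) (coordinates-≤ Y X)

  -- Injectivity of Frobenius on F[X]/h, the form in which squarefreeness of h is established and
  -- used.
  Reduced : Poly → Set (c ⊔ ℓ)
  Reduced h = ∀ b → h ∣ b ^ q → h ∣ b

  ∣-cancelˡ : ∀ {a h g} → ¬ a ≈ 0# → a * h ∣ a * g → h ∣ g
  ∣-cancelˡ {a} {h} {g} a≉0 (divs {t} e) = divs {quot = t} (x∙y⁻¹≈ε⇒x≈y _ _ (cancel-nonzero a≉0
    (trans (solve 4 (λ a h g t → a :* (h :* t :- g) := (a :* h) :* t :- a :* g) refl a h g t)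
      (trans (+-congʳ e) (-‿inverseʳ _)))))

  ^q-square : ∀ b → b * b ∣ b ^ q
  ^q-square b = subst (λ m → b * b ∣ b ^ m) (≡.sym (proj₂ size≥2)) (divs (*-assoc b b _))

  -- `pre` is the product of the factors already passed, so h is an associate of pre·g·P. If g
  -- divided P, then (pre·P)² and with it (pre·P)^q would be multiples of h; reducedness would give
  -- h ∣ pre·P, and cancelling pre·P would leave g ∣ 1.
  reduced⇒coprimeChain : ∀ {h} → Reduced h → ∀ pre hs → ¬ pre * ∏ hs ≈ 0# →
    h ∣ pre * ∏ hs → pre * ∏ hs ∣ h → All Irreducible hs → CoprimeChain hs
  reduced⇒coprimeChain red pre [] ≉0 to from [] = _
  reduced⇒coprimeChain {h} red pre (g ∷ hs) ≉0 to from (irr ∷ irrs) = coprime ,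
      reduced⇒coprimeChain red (pre * g) hs
        (λ e → ≉0 (trans (sym (*-assoc _ _ _)) e)) (∣-resp (sym (*-assoc _ _ _)) to)
        (∣-trans (divs (trans (*-identityʳ _) (*-assoc _ _ _))) from) irrs
    where
    P = ∏ hs
    coprime : CoprimeTo g P
    coprime with irreducible-dichotomy irr P
    ... | inj₂ cop = cop
    ... | inj₁ (divs {t} gt≈P) = ⊥-elim (irreducible∤1 irr (∣-cancelˡ {a = pre * P}
            (λ e → ≉0 (trans (solve 3 (λ a g P → a :* (g :* P) := g :* (a :* P)) refl pre g P) (trans (*-congˡ e) (zeroʳ g))))
            (∣-resp (sym (*-identityʳ _)) (∣-trans (divs (trans (*-identityʳ _)
              (solve 3 (λ a g P → (a :* P) :* g := a :* (g :* P)) refl pre g P)))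
              (∣-trans from (red (pre * P) (∣-trans to (∣-trans (divs {quot = pre * t}
                (trans (solve 4 (λ a g P t → (a :* (g :* P)) :* (a :* t) := (a :* P) :* (a :* (g :* t))) refl pre g P t)
                  (*-congˡ (*-congˡ gt≈P))))
                (^q-square (pre * P))))))))))

  factorCoordinates : ∀ {h fs} → ¬ h ≈ 0# → Reduced h → Factorisation h fs → Coordinates h (length fs)
  factorCoordinates {h} {fs} h≉0 red (irr , u , e) = record
    { _HasCoordinates_ = λ b a → ∀ i → lookup fs i ∣ b - constₚ (a i)
    ; exists = λ fixed → (λ i → proj₁ (res fixed i)) , λ i → proj₂ (res fixed i)
    ; realises = λ a → let b , b≡a = chineseRemainder fs chain (λ i → constₚ (a i))
                       in b , h∣ (λ i → residue⇒fixed (b≡a i)) , b≡a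
    ; injects = λ {b} {b′} x x′ a≈a′ → h∣ λ i → ∣-difference {a = constₚ _}
        (∣-sym (x i)) (∣-sym (∣-resp (+-congˡ (-‿cong (const-cong (F.sym (a≈a′ i))))) (x′ i)))
    ; unique = λ {b} {b′} x x′ d i → residue-unique (irrᵢ i) (x i)
        (∣-chain (∣-trans (∣-trans (lookup∣∏ fs i) ∏∣h) d) (x′ i))
    }
    where
    irrᵢ : ∀ i → Irreducible (lookup fs i)
    irrᵢ = All-lookup irr
      where
      All-lookup : ∀ {xs} → All Irreducible xs → ∀ i → Irreducible (lookup xs i)
      All-lookup (x ∷ xs) Fin.zero    = x
      All-lookup (x ∷ xs) (Fin.suc i) = All-lookup xs i
    ∏∣h : ∏ fs ∣ h
    ∏∣h = divs (trans (*-comm _ _) (sym e))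
    ∏≉0 : ¬ ∏ fs ≈ 0#
    ∏≉0 z = h≉0 (trans e (trans (*-congˡ z) (zeroʳ _)))
    u≉0 : ¬ u F.≈ F.0#
    u≉0 z = h≉0 (trans e (trans (*-congʳ {x = ∏ fs} (trans (const-cong z) (wrap λ { zero → F.refl ; (suc i) → F.refl }))) (zeroˡ _)))
    h∣∏ : h ∣ ∏ fs
    h∣∏ with F.inverse u u≉0
    ... | v , uv≈1 = divs {quot = constₚ v} (trans (*-congʳ e) (trans
            (solve 3 (λ u p v → (u :* p) :* v := (u :* v) :* p) refl (constₚ u) (∏ fs) (constₚ v))
            (trans (*-congʳ (trans (const-* u v) (const-cong uv≈1))) (*-identityˡ _))))
    chain : CoprimeChain fs
    chain = reduced⇒coprimeChain red 1# fs (λ z → ∏≉0 (trans (sym (*-identityˡ _)) z))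
      (∣-resp (sym (*-identityˡ _)) h∣∏) (∣-trans (divs (trans (*-identityʳ _) (*-identityˡ _))) ∏∣h) irr
    h∣ : ∀ {b} → (∀ i → lookup fs i ∣ b) → h ∣ b
    h∣ d = ∣-trans h∣∏ (∏-divides fs chain d)
    res : ∀ {b} → Fixed h b → ∀ i → ∃ λ x → lookup fs i ∣ b - constₚ x
    res fixed i = residue (irrᵢ i) (∣-trans (∣-trans (lookup∣∏ fs i) ∏∣h) fixed)

-- Iteration and orbits

iterate : ∀ {a} {A : Set a} → (A → A) → ℕ → A → A
iterate σ zero    x = x
iterate σ (suc j) x = σ (iterate σ j x)

-- Orbits with chosen representatives. Forward iterates suffice to reach every point, so a function
-- invariant under σ is determined by its values at the representatives.
record OrbitSpace {n : ℕ} (σ : Fin n → Fin n) (C : ℕ) : Set where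
  field
    cls     : Fin n → Fin C
    rep     : Fin C → Fin n
    cls-rep : ∀ κ → cls (rep κ) ≡ κ
    cls-σ   : ∀ i → cls (σ i) ≡ cls i
    reach   : ∀ i → ∃ λ j → iterate σ j (rep (cls i)) ≡ i

-- Substitution of X^n and the components of a polynomial modulo n
module Substitution {c ℓ : Level} {q : ℕ} (F : FiniteField c ℓ q) (n : ℕ) {{n≢0 : ℕ.NonZero n}} where
  open Berlekamp F public
  open import Algebra.Properties.Semiring.Exp semiring public
  open import Algebra.Properties.CommutativeSemiring.Exp commutativeSemiring using (^-distrib-*) public
  open import Algebra.Properties.Semiring.Sum semiring public
  open import Algebra.Properties.Group +-group using (inverseˡ-unique)
  open import Relation.Binary.Reasoning.Setoid setoid

  X : Poly
  X = F.0# ∷ F.1# ∷ []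

  E : Poly → Poly
  E = PolyOver.substXⁿ F.ring n

  const-0 : constₚ F.0# ≈ 0#
  const-0 = wrap λ { zero → F.refl ; (suc i) → F.refl }

  shift-X : ∀ p → F.0# ∷ p ≈ X * p
  shift-X p = wrap λ i → F.sym (F.trans (coeff-∷* F.0# (F.1# ∷ []) p i)
    (F.trans (F.+-congʳ (F.zeroˡ _)) (F.trans (F.+-identityˡ _) (rest i))))
    where
    rest : ∀ i → coeff (F.0# ∷ (oneₚ * p)) i F.≈ coeff (F.0# ∷ p) i
    rest zero    = F.refl
    rest (suc i) = unwrap (*-identityˡ p) i

  cons : ∀ a p → a ∷ p ≈ constₚ a + X * p
  cons a p = trans (wrap λ i → F.sym (F.trans (coeff-+ (constₚ a) (F.0# ∷ p) i) (rest i))) (+-congˡ (shift-X p))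
    where
    rest : ∀ i → coeff (constₚ a) i F.+ coeff (F.0# ∷ p) i F.≈ coeff (a ∷ p) i
    rest zero    = F.+-identityʳ a
    rest (suc i) = F.+-identityˡ _

  cons-* : ∀ a p r → (a ∷ p) * r ≈ constₚ a * r + (F.0# ∷ (p * r))
  cons-* a p r = wrap λ i → F.trans (coeff-∷* a p r i) (F.sym
    (F.trans (coeff-+ (constₚ a * r) (F.0# ∷ (p * r)) i) (F.+-congʳ (coeff-const* a r i))))

  replicate-X : ∀ m p → replicate m F.0# ++ p ≈ X ^ m * p
  replicate-X zero    p = sym (*-identityˡ p)
  replicate-X (suc m) p = trans (shift-X _) (trans (*-congˡ (replicate-X m p)) (sym (*-assoc _ _ _)))

  E-cons : ∀ a p → E (a ∷ p) ≈ constₚ a + X ^ n * E p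
  E-cons a p = trans (cons a _) (+-congˡ (trans (*-congˡ (replicate-X (n ℕ.∸ 1) (E p)))
    (trans (sym (*-assoc _ _ _)) (*-congʳ (^-congʳ X (ℕₚ.suc-pred n))))))

  private
    uncons : ∀ {a b p r} → a ∷ p ≈ b ∷ r → a F.≈ b × p ≈ r
    uncons e = unwrap e 0 , wrap λ i → unwrap e (suc i)

  E-zero : ∀ p → p ≈ 0# → E p ≈ 0#
  E-zero [] e = refl
  E-zero (a ∷ p) e = trans (E-cons a p) (trans (+-cong (trans (const-cong (unwrap e 0)) const-0)
    (trans (*-congˡ (E-zero p (wrap λ i → unwrap e (suc i)))) (zeroʳ _))) (+-identityˡ _))

  E-cong : ∀ {p r} → p ≈ r → E p ≈ E r
  E-cong {[]} {r} e = sym (E-zero r (sym e))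
  E-cong {a ∷ p} {[]} e = E-zero (a ∷ p) e
  E-cong {a ∷ p} {b ∷ r} e = trans (E-cons a p) (trans
    (+-cong (const-cong (proj₁ (uncons e))) (*-congˡ (E-cong (proj₂ (uncons e))))) (sym (E-cons b r)))

  const-+ : ∀ x y → constₚ x + constₚ y ≈ constₚ (x F.+ y)
  const-+ x y = wrap λ i → F.trans (coeff-+ (constₚ x) (constₚ y) i) (rest i)
    where
    rest : ∀ i → coeff (constₚ x) i F.+ coeff (constₚ y) i F.≈ coeff (constₚ (x F.+ y)) i
    rest zero    = F.refl
    rest (suc i) = F.+-identityˡ _

  E-+ : ∀ p r → E (p + r) ≈ E p + E r
  E-+ [] r = trans (E-cong (+-identityˡ r)) (sym (+-identityˡ _))
  E-+ (a ∷ p) [] = trans (E-cong (+-identityʳ _)) (sym (+-identityʳ _))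
  E-+ (a ∷ p) (b ∷ r) = begin
    E ((a ∷ p) + (b ∷ r))                ≈⟨ E-cong (wrap λ i → F.trans (coeff-+ (a ∷ p) (b ∷ r) i) (split i)) ⟩
    E ((a F.+ b) ∷ (p + r))              ≈⟨ E-cons _ _ ⟩
    constₚ (a F.+ b) + X ^ n * E (p + r) ≈⟨ +-cong (sym (const-+ a b)) (*-congˡ (E-+ p r)) ⟩
    (constₚ a + constₚ b) + X ^ n * (E p + E r)
      ≈⟨ solve 5 (λ a b x p r → (a :+ b) :+ x :* (p :+ r) := (a :+ x :* p) :+ (b :+ x :* r)) refl
           (constₚ a) (constₚ b) (X ^ n) (E p) (E r) ⟩
    (constₚ a + X ^ n * E p) + (constₚ b + X ^ n * E r)  ≈⟨ +-cong (sym (E-cons a p)) (sym (E-cons b r)) ⟩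
    E (a ∷ p) + E (b ∷ r) ∎
    where
    split : ∀ i → coeff (a ∷ p) i F.+ coeff (b ∷ r) i F.≈ coeff ((a F.+ b) ∷ (p + r)) i
    split zero    = F.refl
    split (suc i) = F.sym (coeff-+ p r i)

  E-const* : ∀ a p → E (constₚ a * p) ≈ constₚ a * E p
  E-const* a [] = trans (E-zero _ (zeroʳ _)) (sym (zeroʳ _))
  E-const* a (b ∷ p) = begin
    E (constₚ a * (b ∷ p))                         ≈⟨ E-cong (wrap λ i → F.trans (coeff-const* a (b ∷ p) i) (split i)) ⟩
    E ((a F.* b) ∷ (constₚ a * p))                 ≈⟨ E-cons _ _ ⟩
    constₚ (a F.* b) + X ^ n * E (constₚ a * p)    ≈⟨ +-cong (sym (const-* a b)) (*-congˡ (E-const* a p)) ⟩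
    constₚ a * constₚ b + X ^ n * (constₚ a * E p)
      ≈⟨ solve 4 (λ a b x p → a :* b :+ x :* (a :* p) := a :* (b :+ x :* p)) refl (constₚ a) (constₚ b) (X ^ n) (E p) ⟩
    constₚ a * (constₚ b + X ^ n * E p)            ≈⟨ *-congˡ (sym (E-cons b p)) ⟩
    constₚ a * E (b ∷ p)                           ∎
    where
    split : ∀ i → a F.* coeff (b ∷ p) i F.≈ coeff ((a F.* b) ∷ (constₚ a * p)) i
    split zero    = F.refl
    split (suc i) = F.sym (coeff-const* a p i)

  E-shift : ∀ p → E (F.0# ∷ p) ≈ X ^ n * E p
  E-shift p = trans (E-cons F.0# p) (trans (+-congʳ const-0) (+-identityˡ _))

  E-* : ∀ p r → E (p * r) ≈ E p * E r
  E-* [] r = trans (E-zero _ (zeroˡ r)) (sym (zeroˡ _))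
  E-* (a ∷ p) r = begin
    E ((a ∷ p) * r)                           ≈⟨ E-cong (cons-* a p r) ⟩
    E (constₚ a * r + (F.0# ∷ (p * r)))       ≈⟨ E-+ (constₚ a * r) _ ⟩
    E (constₚ a * r) + E (F.0# ∷ (p * r))     ≈⟨ +-cong (E-const* a r) (trans (E-shift (p * r)) (*-congˡ (E-* p r))) ⟩
    constₚ a * E r + X ^ n * (E p * E r)
      ≈⟨ solve 4 (λ a x p r → a :* r :+ x :* (p :* r) := (a :+ x :* p) :* r) refl (constₚ a) (X ^ n) (E p) (E r) ⟩
    (constₚ a + X ^ n * E p) * E r            ≈⟨ *-congʳ (sym (E-cons a p)) ⟩
    E (a ∷ p) * E r                           ∎

  E-const : ∀ a → E (constₚ a) ≈ constₚ a
  E-const a = trans (E-cons a []) (trans (+-congˡ (zeroʳ _)) (+-identityʳ _))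

  E-^ : ∀ p m → E (p ^ m) ≈ E p ^ m
  E-^ p zero    = E-const F.1#
  E-^ p (suc m) = trans (E-* p (p ^ m)) (*-congˡ (E-^ p m))

  E-neg : ∀ p → E (- p) ≈ - E p
  E-neg p = inverseˡ-unique _ _ (trans (sym (E-+ (- p) p)) (E-zero _ (-‿inverseˡ p)))

  E-- : ∀ p r → E (p - r) ≈ E p - E r
  E-- p r = trans (E-+ p (- r)) (+-congˡ (E-neg r))

  E-X^ : ∀ m → E (X ^ m) ≈ X ^ (n ℕ.* m)
  E-X^ m = trans (E-^ X m) (trans (^-congˡ m E-X) (^-assocʳ X n m))
    where
    E-X : E X ≈ X ^ n
    E-X = trans (E-shift 1#) (trans (*-congˡ (E-const F.1#)) (*-identityʳ _))

  E-∣ : ∀ {g p} → g ∣ p → E g ∣ E p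
  E-∣ {g} (divs {t} e) = divs {quot = E t} (trans (sym (E-* g t)) (E-cong e))

  coeff-X^-above : ∀ m v j → coeff (X ^ m * v) (m ℕ.+ j) F.≈ coeff v j
  coeff-X^-above zero    v j = unwrap (*-identityˡ v) j
  coeff-X^-above (suc m) v j = F.trans (unwrap (trans (*-assoc _ _ _) (sym (shift-X _))) (suc (m ℕ.+ j))) (coeff-X^-above m v j)

  coeff-X^-under : ∀ m v {j} → j ℕ.< m → coeff (X ^ m * v) j F.≈ F.0#
  coeff-X^-under (suc m) v {zero}  _ = unwrap (trans (*-assoc _ _ _) (sym (shift-X _))) 0
  coeff-X^-under (suc m) v {suc j} (ℕ.s≤s j<m) =
    F.trans (unwrap (trans (*-assoc _ _ _) (sym (shift-X _))) (suc j)) (coeff-X^-under m v j<m)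

  coeff-beyond : ∀ p {i} → length p ℕ.≤ i → coeff p i ≡ F.0#
  coeff-beyond []      _           = ≡.refl
  coeff-beyond (a ∷ p) (ℕ.s≤s len) = coeff-beyond p len

  coeff-applyUpTo : ∀ g m j → (m ℕ.≤ j → g j F.≈ F.0#) → coeff (applyUpTo g m) j F.≈ g j
  coeff-applyUpTo g zero    j       z = F.sym (z ℕ.z≤n)
  coeff-applyUpTo g (suc m) zero    z = F.refl
  coeff-applyUpTo g (suc m) (suc j) z = coeff-applyUpTo (λ i → g (suc i)) m j (λ m≤j → z (ℕ.s≤s m≤j))

  -- p = Σ_{i<n} X^i · E (component i p)
  component : ℕ → Poly → Poly
  component i p = applyUpTo (λ j → coeff p (i ℕ.+ n ℕ.* j)) (length p)

  coeff-component : ∀ i p j → coeff (component i p) j F.≈ coeff p (i ℕ.+ n ℕ.* j)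
  -- The list may stop at `length p`: as n ≥ 1, the index i + n·j is at least j, so the entries cut
  -- off are zero.
  coeff-component i p j = coeff-applyUpTo _ (length p) j λ len≤j → F.reflexive (coeff-beyond p
    (ℕₚ.≤-trans len≤j (ℕₚ.≤-trans (ℕₚ.m≤n*m j n) (ℕₚ.m≤n+m _ i))))

  component-cong : ∀ i {p r} → p ≈ r → component i p ≈ component i r
  component-cong i {p} {r} e = wrap λ j →
    F.trans (coeff-component i p j) (F.trans (unwrap e _) (F.sym (coeff-component i r j)))

  component-+ : ∀ i p r → component i (p + r) ≈ component i p + component i r
  component-+ i p r = wrap λ j → F.trans (coeff-component i (p + r) j) (F.trans (coeff-+ p r _)
    (F.sym (F.trans (coeff-+ (component i p) (component i r) j) (F.+-cong (coeff-component i p j) (coeff-component i r j)))))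

  component-const* : ∀ i a p → component i (constₚ a * p) ≈ constₚ a * component i p
  component-const* i a p = wrap λ j → F.trans (coeff-component i (constₚ a * p) j) (F.trans (coeff-const* a p _)
    (F.sym (F.trans (coeff-const* a (component i p) j) (F.*-congˡ (coeff-component i p j)))))

  component-X^n : ∀ {i} → i ℕ.< n → ∀ p → component i (X ^ n * p) ≈ F.0# ∷ component i p
  component-X^n {i} i<n p = wrap λ j → F.trans (coeff-component i (X ^ n * p) j) (value j)
    where
    value : ∀ j → coeff (X ^ n * p) (i ℕ.+ n ℕ.* j) F.≈ coeff (F.0# ∷ component i p) j
    value zero    = coeff-X^-under n p (subst (ℕ._< n) (≡.sym (≡.trans (cong (i ℕ.+_) (ℕₚ.*-zeroʳ n)) (ℕₚ.+-identityʳ i))) i<n)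
    value (suc j) = F.trans (F.reflexive (cong (coeff (X ^ n * p)) index-eq))
      (F.trans (coeff-X^-above n p _) (F.sym (coeff-component i p j)))
      where
      open import Algebra.Properties.CommutativeSemigroup ℕₚ.+-commutativeSemigroup using (x∙yz≈y∙xz)
      index-eq : i ℕ.+ n ℕ.* suc j ≡ n ℕ.+ (i ℕ.+ n ℕ.* j)
      index-eq = ≡.trans (cong (i ℕ.+_) (ℕₚ.*-suc n j)) (x∙yz≈y∙xz i n (n ℕ.* j))

  -- F[X] is a module over its subring F[X^n], the image of `E`, and taking a component is linear
  -- over that subring.
  component-E* : ∀ {i} → i ℕ.< n → ∀ c w → component i (E c * w) ≈ c * component i w
  component-E* {i} i<n [] w = trans (component-cong i (zeroˡ w)) (trans (component-0 i) (sym (zeroˡ _)))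
    where
    component-0 : ∀ i → component i 0# ≈ 0#
    component-0 i = refl
  component-E* {i} i<n (a ∷ c) w = begin
    component i (E (a ∷ c) * w)
      ≈⟨ component-cong i (trans (*-congʳ (E-cons a c)) (solve 4 (λ a x c w → (a :+ x :* c) :* w := a :* w :+ x :* (c :* w)) refl
           (constₚ a) (X ^ n) (E c) w)) ⟩
    component i (constₚ a * w + X ^ n * (E c * w))
      ≈⟨ trans (component-+ i (constₚ a * w) _) (+-cong (component-const* i a w) (component-X^n i<n _)) ⟩
    constₚ a * component i w + (F.0# ∷ component i (E c * w))
      ≈⟨ +-congˡ (wrap λ { zero → F.refl ; (suc j) → unwrap (component-E* i<n c w) j }) ⟩
    constₚ a * component i w + (F.0# ∷ (c * component i w))
      ≈⟨ cons-* a c (component i w) ⟨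
    (a ∷ c) * component i w ∎

  component-X^-same : ∀ {i} → component i (X ^ i) ≈ 1#
  component-X^-same {i} = wrap λ j → F.trans (coeff-component i (X ^ i) j) (F.trans
    (unwrap (sym (*-identityʳ (X ^ i))) _) (F.trans (coeff-X^-above i 1# (n ℕ.* j)) (value j)))
    where
    value : ∀ j → coeff oneₚ (n ℕ.* j) F.≈ coeff oneₚ j
    value zero    = F.reflexive (cong (coeff oneₚ) (ℕₚ.*-zeroʳ n))
    value (suc j) = beyond-0 (ℕₚ.≤-trans (ℕ.s≤s ℕ.z≤n) (ℕₚ.m≤n*m (suc j) n))
      where
      beyond-0 : ∀ {m} → 0 ℕ.< m → coeff oneₚ m F.≈ F.0#
      beyond-0 (ℕ.s≤s _) = F.refl

  component-X^-other : ∀ {i i′} → i ℕ.< n → i′ ℕ.< n → i ≢ i′ → component i (X ^ i′) ≈ 0#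
  component-X^-other {i} {i′} i<n i′<n i≢i′ = wrap λ j → F.trans (coeff-component i (X ^ i′) j)
      (F.trans (unwrap (sym (*-identityʳ (X ^ i′))) _) (value j))
    where
    no-overlap : ∀ j → i ℕ.+ n ℕ.* j ≢ i′
    no-overlap zero    eq = i≢i′ (≡.trans (≡.sym (≡.trans (cong (i ℕ.+_) (ℕₚ.*-zeroʳ n)) (ℕₚ.+-identityʳ i))) eq)
    no-overlap (suc j) eq = ℕₚ.<⇒≱ i′<n (ℕₚ.≤-trans (ℕₚ.≤-trans (ℕₚ.m≤m*n n (suc j)) (ℕₚ.m≤n+m _ i)) (ℕₚ.≤-reflexive eq))
    value : ∀ j → coeff (X ^ i′ * 1#) (i ℕ.+ n ℕ.* j) F.≈ F.0#
    value j with (i ℕ.+ n ℕ.* j) ℕ.<? i′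
    ... | yes lt = coeff-X^-under i′ 1# lt
    ... | no ≮ with ℕₚ.m≤n⇒∃[o]m+o≡n (ℕₚ.≮⇒≥ ≮)
    ...   | zero  , eq = ⊥-elim (no-overlap j (≡.sym (≡.trans (≡.sym (ℕₚ.+-identityʳ i′)) eq)))
    ...   | suc o , eq = F.trans (F.reflexive (cong (coeff (X ^ i′ * 1#)) (≡.sym eq))) (coeff-X^-above i′ 1# (suc o))

  component-sum : ∀ i {m} (v : Fin m → Poly) → component i (sum v) ≈ sum (λ j → component i (v j))
  component-sum i {zero}  v = refl
  component-sum i {suc m} v = trans (component-+ i (v Fin.zero) _) (+-congˡ (component-sum i (λ j → v (Fin.suc j))))

  sum-single : ∀ {m} (v : Fin m → Poly) j → (∀ i → i ≢ j → v i ≈ 0#) → sum v ≈ v j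
  sum-single {suc m} v j others = trans (sum-remove {i = j} v) (trans (+-congˡ
    (trans (sum-cong-≋ (λ i → others (Fin.punchIn j i) (Finₚ.punchInᵢ≢i j i))) (sum-replicate-zero m))) (+-identityʳ _))

-- Elementary number theory

module Arithmetic where
  open import Data.Nat
  open import Data.Nat.Properties
  open import Data.Nat.Divisibility
  open import Data.Nat.DivMod using (m%n<n; [m+kn]%n≡m%n; m<n⇒m%n≡m; %-distribˡ-*; m%n%n≡m%n; m*n/n≡m)
  open import Data.Nat.GCD
  open import Data.Nat.LCM using (lcm; m∣lcm[m,n]; n∣lcm[m,n]; lcm-least)
  open import Data.Nat.Coprimality using (coprime?; coprime⇒gcd≡1; gcd≡1⇒coprime)
  open import Data.Nat.Primality
  open import Data.Nat.Primality.Factorisation using (factorise)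
  open import Data.Nat.Induction using (<-rec)
  open import Data.Nat.ListAction using (sum; product)
  open import Data.Nat.ListAction.Properties using (∈⇒∣product; product≢0)
  import Data.Integer as ℤ
  import Data.Integer.Properties as ℤₚ
  open import Data.Rational as ℚ using (ℚ; 0ℚ; 1ℚ)
  import Data.Rational.Properties as ℚₚ
  import Data.Rational.Unnormalised as ℚᵘ
  import Data.Rational.Unnormalised.Properties as ℚᵘₚ
  open import Data.Bool using (if_then_else_; _∧_)
  open import Data.Maybe using (fromMaybe)
  open import Data.List using (map; filter; upTo; head; last)
  open import Data.List.Properties using (map-cong)
  open import Data.List.Membership.Propositional using (_∈_)
  open import Data.List.Membership.Propositional.Properties
    using (∈-filter⁺; ∈-filter⁻; ∈-map⁺; ∈-map⁻; ∈-upTo⁺; ∈-upTo⁻)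
  open import Data.List.Relation.Unary.Any using (here; there)
  import Data.List.Relation.Unary.All as All
  open import Data.List.Relation.Unary.AllPairs using (AllPairs; []; _∷_)
  import Data.List.Relation.Unary.AllPairs.Properties as AllPairsₚ
  open import Function using (_∘_)
  open import Relation.Nullary using (does)
  open import Relation.Nullary.Decidable using (_×-dec_)
  open import Relation.Unary using (Pred; Decidable)
  open import Relation.Binary.Definitions using (tri<; tri≈; tri>)
  open import Relation.Binary.PropositionalEquality
  import Algebra.Properties.Semiring.Sum +-*-semiring as S
  import Algebra.Properties.CommutativeMonoid.Sum +-0-commutativeMonoid as CS

  -- Sums over ranges and over divisors

  𝟙 : ∀ {p} {P : Set p} → Dec P → ℕ
  𝟙 (yes _) = 1
  𝟙 (no  _) = 0

  𝟙-cong : ∀ {p r} {P : Set p} {R : Set r} (P? : Dec P) (R? : Dec R) → (P → R) → (R → P) → 𝟙 P? ≡ 𝟙 R?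
  𝟙-cong (yes _) (yes _) f g = refl
  𝟙-cong (yes p) (no ¬r) f g = ⊥-elim (¬r (f p))
  𝟙-cong (no ¬p) (yes r) f g = ⊥-elim (¬p (g r))
  𝟙-cong (no _)  (no _)  f g = refl

  𝟙-yes : ∀ {p} {P : Set p} (P? : Dec P) → P → 𝟙 P? ≡ 1
  𝟙-yes (yes _) _ = refl
  𝟙-yes (no ¬p) p = ⊥-elim (¬p p)

  𝟙-no : ∀ {p} {P : Set p} (P? : Dec P) → ¬ P → 𝟙 P? ≡ 0
  𝟙-no (yes p) ¬p = ⊥-elim (¬p p)
  𝟙-no (no _)  _  = refl

  ∑ : ℕ → (ℕ → ℕ) → ℕ
  ∑ n F = S.sum {n} (F ∘ toℕ)

  sum-single : ∀ {n} (v : Fin n → ℕ) j → (∀ i → i ≢ j → v i ≡ 0) → S.sum v ≡ v j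
  sum-single {suc n} v j others = trans (CS.sum-remove {i = j} v)
    (trans (cong (v j +_) (trans (S.sum-cong-≋ (λ i → others _ (Finₚ.punchInᵢ≢i j i))) (S.sum-replicate-zero n))) (+-identityʳ _))

  module _ {n : ℕ} where
    ∑-cong : ∀ {F G : ℕ → ℕ} → (∀ i → i < n → F i ≡ G i) → ∑ n F ≡ ∑ n G
    ∑-cong e = S.sum-cong-≋ {n} (λ i → e (toℕ i) (Finₚ.toℕ<n i))

    ∑-+ : ∀ F G → ∑ n (λ i → F i + G i) ≡ ∑ n F + ∑ n G
    ∑-+ F G = S.∑-distrib-+ {n} (F ∘ toℕ) (G ∘ toℕ)

    ∑-*ˡ : ∀ c F → ∑ n (λ i → c * F i) ≡ c * ∑ n F
    ∑-*ˡ c F = sym (S.*-distribˡ-sum {n} c (F ∘ toℕ))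

    ∑-*ʳ : ∀ c F → ∑ n (λ i → F i * c) ≡ ∑ n F * c
    ∑-*ʳ c F = sym (S.*-distribʳ-sum {n} c (F ∘ toℕ))

    ∑-zero : ∀ {F} → (∀ i → i < n → F i ≡ 0) → ∑ n F ≡ 0
    ∑-zero e = trans (∑-cong e) (S.sum-replicate-zero n)

    ∑-swap : ∀ {m} (F : ℕ → ℕ → ℕ) → ∑ n (λ i → ∑ m (F i)) ≡ ∑ m (λ j → ∑ n (λ i → F i j))
    ∑-swap {m} F = S.∑-comm {n} {m} (λ i j → F (toℕ i) (toℕ j))

    ∑-single : ∀ {F : ℕ → ℕ} j → j < n → (∀ i → i < n → i ≢ j → F i ≡ 0) → ∑ n F ≡ F j
    ∑-single {F} j j<n others = trans (sum-single (F ∘ toℕ) (fromℕ< j<n) λ i i≢j →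
        others (toℕ i) (Finₚ.toℕ<n i) (λ e → i≢j (Finₚ.toℕ-injective (trans e (sym (Finₚ.toℕ-fromℕ< j<n))))))
      (cong F (Finₚ.toℕ-fromℕ< j<n))

  ∑-const : ∀ n c → ∑ n (λ _ → c) ≡ n * c
  ∑-const zero    c = refl
  ∑-const (suc n) c = cong (c +_) (∑-const n c)

  ∑-last : ∀ n F → ∑ (suc n) F ≡ ∑ n F + F n
  ∑-last zero    F = +-identityʳ (F 0)
  ∑-last (suc n) F = trans (cong (F 0 +_) (∑-last n (F ∘ suc))) (sym (+-assoc (F 0) _ _))

  ∑-split : ∀ m n F → ∑ (m + n) F ≡ ∑ m F + ∑ n (λ i → F (m + i))
  ∑-split zero    n F = refl
  ∑-split (suc m) n F = trans (cong (F 0 +_) (∑-split m n (F ∘ suc))) (sym (+-assoc (F 0) _ _))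

  ∑-rotate : ∀ n {F} → F n ≡ F 0 → ∑ n (F ∘ suc) ≡ ∑ n F
  ∑-rotate n {F} e = +-cancelˡ-≡ (F 0) _ _ (trans (∑-last n F) (trans (cong (∑ n F +_) e) (+-comm _ (F 0))))

  ∑-shift : ∀ n {F} → (∀ i → F (n + i) ≡ F i) → ∀ t → ∑ n (λ i → F (i + t)) ≡ ∑ n F
  ∑-shift n {F} per zero    = ∑-cong {n} λ i _ → cong F (+-identityʳ i)
  ∑-shift n {F} per (suc t) = trans (∑-cong {n} (λ i _ → cong F (+-suc i t)))
    (trans (∑-rotate n {λ i → F (i + t)} (per t)) (∑-shift n per t))

  ∑-periodic : ∀ a b {F} → (∀ i → F (a + i) ≡ F i) → ∑ (b * a) F ≡ b * ∑ a F
  ∑-periodic a zero    per = refl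
  ∑-periodic a (suc b) {F} per = trans (∑-split a (b * a) F)
    (cong (∑ a F +_) (trans (∑-cong {b * a} (λ i _ → per i)) (∑-periodic a b per)))

  -- Each block of d consecutive indices starting at a multiple of d contains just that one
  -- multiple.
  ∑-multiples : ∀ d .{{_ : NonZero d}} b (F : ℕ → ℕ) → ∑ (b * d) (λ i → 𝟙 (d ∣? i) * F i) ≡ ∑ b (λ i → F (i * d))
  ∑-multiples d zero    F = refl
  ∑-multiples d (suc b) F = trans (∑-split d (b * d) G) (cong₂ _+_
      (trans (∑-single {d} {G} 0 (>-nonZero⁻¹ d) first) (trans (cong (_* F 0) (𝟙-yes (d ∣? 0) (d ∣0))) (*-identityˡ (F 0))))
      (trans (∑-cong {b * d} (λ i _ → cong (_* F (d + i)) (𝟙-cong (d ∣? (d + i)) (d ∣? i)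
                (λ x → ∣m+n∣m⇒∣n x ∣-refl) (∣m∣n⇒∣m+n ∣-refl))))
        (∑-multiples d b (λ i → F (d + i)))))
    where
    G : ℕ → ℕ
    G i = 𝟙 (d ∣? i) * F i
    first : ∀ i → i < d → i ≢ 0 → G i ≡ 0
    first i i<d i≢0 = cong (_* F i) (𝟙-no (d ∣? i) (λ d∣i → <⇒≱ i<d (∣⇒≤ {{≢-nonZero i≢0}} d∣i)))

  ∑-extend : ∀ {N B} F → N ≤ B → (∀ i → N ≤ i → F i ≡ 0) → ∑ B F ≡ ∑ N F
  ∑-extend {N} {B} F N≤B z with m≤n⇒∃[o]m+o≡n N≤B
  ... | o , refl = trans (∑-split N o F) (trans (cong (∑ N F +_) (∑-zero {o} (λ i _ → z _ (m≤m+n N i)))) (+-identityʳ _))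

  -- Divisors are selected by an indicator over a range, so that `∑-swap` can interchange such sums.
  ∑∣ : ℕ → (ℕ → ℕ) → ℕ
  ∑∣ N F = ∑ N (λ i → 𝟙 (suc i ∣? N) * F (suc i))

  ∑∣-extend : ∀ {N B} .{{_ : NonZero N}} F → N ≤ B → ∑ B (λ i → 𝟙 (suc i ∣? N) * F (suc i)) ≡ ∑∣ N F
  ∑∣-extend {N} F N≤B = ∑-extend _ N≤B λ i N≤i → cong (_* F (suc i)) (𝟙-no (suc i ∣? N) (λ d → <⇒≱ (s≤s N≤i) (∣⇒≤ d)))

  ∑∣-cong : ∀ {N} {F G : ℕ → ℕ} → (∀ d → d ∣ N → F d ≡ G d) → ∑∣ N F ≡ ∑∣ N G
  ∑∣-cong {N} {F} {G} e = ∑-cong {N} λ i _ → term i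
    where
    term : ∀ i → 𝟙 (suc i ∣? N) * F (suc i) ≡ 𝟙 (suc i ∣? N) * G (suc i)
    term i with suc i ∣? N
    ... | yes d = cong (1 *_) (e (suc i) d)
    ... | no  _ = refl

  sum-filter : ∀ {p} {P : Pred ℕ p} (P? : Decidable P) (F : ℕ → ℕ) xs →
    sum (map F (filter P? xs)) ≡ sum (map (λ x → 𝟙 (P? x) * F x) xs)
  sum-filter P? F [] = refl
  sum-filter P? F (x ∷ xs) with P? x
  ... | yes _ = cong₂ _+_ (sym (*-identityˡ (F x))) (sum-filter P? F xs)
  ... | no  _ = sum-filter P? F xs

  sum-upTo : ∀ (G : ℕ → ℕ) (F : ℕ → ℕ) n → sum (map F (map G (upTo n))) ≡ ∑ n (F ∘ G)
  sum-upTo G F n = go (λ i → i) n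
    where
    go : ∀ H n → sum (map F (map G (applyUpTo H n))) ≡ ∑ n (F ∘ G ∘ H)
    go H zero    = refl
    go H (suc n) = cong (F (G (H 0)) +_) (go (H ∘ suc) n)

  sum-divisors : ∀ N F → sum (map F (divisors N)) ≡ ∑∣ N F
  sum-divisors N F = trans (sum-filter (_∣? N) F (oneTo N)) (sum-upTo suc (λ x → 𝟙 (x ∣? N) * F x) N)

  length-filter : ∀ {p} {P : Pred ℕ p} (P? : Decidable P) xs → length (filter P? xs) ≡ sum (map (𝟙 ∘ P?) xs)
  length-filter P? [] = refl
  length-filter P? (x ∷ xs) with P? x
  ... | yes _ = cong suc (length-filter P? xs)
  ... | no  _ = length-filter P? xs

  -- Euler's totient

  -- Moves the range from 1, ..., n to 0, ..., n - 1: n and 0 have the same common divisors with n.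
  φ-∑ : ∀ n → φ n ≡ ∑ n (λ i → 𝟙 (coprime? i n))
  φ-∑ n = trans (length-filter (λ i → coprime? i n) (oneTo n)) (trans (sum-upTo suc (λ i → 𝟙 (coprime? i n)) n)
    (∑-rotate n {λ i → 𝟙 (coprime? i n)} (𝟙-cong (coprime? n n) (coprime? 0 n)
      (λ c {d} (d∣0 , d∣n) → c (d∣n , d∣n)) (λ c {d} (d∣n , _) → c (_ ∣0 , d∣n)))))

  -- Every i < N contributes to exactly one divisor t of N, its order in ℤ/N.
  gauss : ∀ N .{{_ : NonZero N}} → ∑∣ N φ ≡ N
  gauss N = begin
    ∑ N (λ j → 𝟙 (suc j ∣? N) * φ (suc j))                      ≡⟨ ∑-cong {N} (λ j j<N → sym (column j)) ⟩
    ∑ N (λ j → ∑ N (λ i → 𝟙 (suc j * gcd i N ≟ N)))             ≡⟨ ∑-swap {N} {N} (λ j i → 𝟙 (suc j * gcd i N ≟ N)) ⟩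
    ∑ N (λ i → ∑ N (λ j → 𝟙 (suc j * gcd i N ≟ N)))             ≡⟨ ∑-cong {N} (λ i _ → row i) ⟩
    ∑ N (λ _ → 1)                                               ≡⟨ trans (∑-const N 1) (*-identityʳ N) ⟩
    N                                                           ∎
    where
    open ≡-Reasoning
    row : ∀ i → ∑ N (λ j → 𝟙 (suc j * gcd i N ≟ N)) ≡ 1
    row i with gcd[m,n]∣n i N
    ... | divides zero    eq = ⊥-elim (≢-nonZero⁻¹ N eq)
    ... | divides (suc t) eq = trans (∑-single {N} t t<N others) (𝟙-yes (suc t * gcd i N ≟ N) (sym eq))
      where
      instance
        gcd≢0 : NonZero (gcd i N)
        gcd≢0 = ≢-nonZero (gcd[m,n]≢0 i N (inj₂ (≢-nonZero⁻¹ N)))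
      t<N : t < N
      t<N = subst (suc t ≤_) (sym eq) (m≤m*n (suc t) (gcd i N))
      others : ∀ j → j < N → j ≢ t → 𝟙 (suc j * gcd i N ≟ N) ≡ 0
      others j _ j≢t = 𝟙-no (suc j * gcd i N ≟ N) λ e → j≢t (suc-injective (*-cancelʳ-≡ (suc j) (suc t) (gcd i N) (trans e eq)))
    column : ∀ j → ∑ N (λ i → 𝟙 (suc j * gcd i N ≟ N)) ≡ 𝟙 (suc j ∣? N) * φ (suc j)
    column j with suc j ∣? N
    ... | no  ∤ = ∑-zero {N} λ i _ → 𝟙-no (suc j * gcd i N ≟ N) λ e → ∤ (divides (gcd i N) (trans (sym e) (*-comm (suc j) _)))
    ... | yes (divides zero eq) = ⊥-elim (≢-nonZero⁻¹ N eq)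
    ... | yes (divides d@(suc _) eq) = begin
      ∑ N (λ i → 𝟙 (t * gcd i N ≟ N))                         ≡⟨ ∑-cong {N} (λ i _ → multiples i) ⟩
      ∑ N (λ i → 𝟙 (d ∣? i) * 𝟙 (t * gcd i N ≟ N))            ≡⟨ cong (λ B → ∑ B (λ i → 𝟙 (d ∣? i) * 𝟙 (t * gcd i N ≟ N))) (trans eq (*-comm d t)) ⟩
      ∑ (t * d) (λ i → 𝟙 (d ∣? i) * 𝟙 (t * gcd i N ≟ N))      ≡⟨ ∑-multiples d t (λ i → 𝟙 (t * gcd i N ≟ N)) ⟩
      ∑ t (λ i → 𝟙 (t * gcd (i * d) N ≟ N))                   ≡⟨ ∑-cong {t} (λ i _ → 𝟙-cong (t * gcd (i * d) N ≟ N) (coprime? i t) (to i) (from i)) ⟩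
      ∑ t (λ i → 𝟙 (coprime? i t))                            ≡⟨ φ-∑ t ⟨
      φ t                                                     ≡⟨ *-identityˡ (φ t) ⟨
      1 * φ t                                                 ∎
      where
      t = suc j
      gcd-d : ∀ i → gcd (i * d) N ≡ d * gcd i t
      gcd-d i = trans (cong₂ gcd (*-comm i d) eq) (sym (c*gcd[m,n]≡gcd[cm,cn] d i t))
      td≡N : t * d ≡ N
      td≡N = trans (*-comm t d) (sym eq)
      multiples : ∀ i → 𝟙 (t * gcd i N ≟ N) ≡ 𝟙 (d ∣? i) * 𝟙 (t * gcd i N ≟ N)
      multiples i with d ∣? i
      ... | yes _  = sym (*-identityˡ _)
      ... | no d∤i = 𝟙-no (t * gcd i N ≟ N) λ e → d∤i (subst (_∣ i) (*-cancelˡ-≡ (gcd i N) d t (trans e (sym td≡N))) (gcd[m,n]∣m i N))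
      to : ∀ i → t * gcd (i * d) N ≡ N → Coprime i t
      to i e = gcd≡1⇒coprime (*-cancelˡ-≡ (gcd i t) 1 d (trans (sym (gcd-d i))
                 (trans (*-cancelˡ-≡ (gcd (i * d) N) d t (trans e (sym td≡N))) (sym (*-identityʳ d)))))
      from : ∀ i → Coprime i t → t * gcd (i * d) N ≡ N
      from i c = trans (cong (t *_) (trans (gcd-d i) (trans (cong (d *_) (coprime⇒gcd≡1 c)) (*-identityʳ d)))) td≡N

  -- This is `gauss` at gcd(M, i), whose divisors are the common divisors of M and i. It makes the
  -- gcd a sum of divisibility indicators.
  gcd-∑ : ∀ M .{{_ : NonZero M}} i → gcd M i ≡ ∑∣ M (λ t → 𝟙 (t ∣? i) * φ t)
  gcd-∑ M i = begin
    gcd M i                                                          ≡⟨ gauss (gcd M i) ⟨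
    ∑∣ (gcd M i) φ                                                   ≡⟨ ∑∣-extend φ (∣⇒≤ (gcd[m,n]∣m M i)) ⟨
    ∑ M (λ j → 𝟙 (suc j ∣? gcd M i) * φ (suc j))                     ≡⟨ ∑-cong {M} (λ j _ → term (suc j)) ⟩
    ∑ M (λ j → 𝟙 (suc j ∣? M) * (𝟙 (suc j ∣? i) * φ (suc j)))        ∎
    where
    open ≡-Reasoning
    instance
      gcd≢0 : NonZero (gcd M i)
      gcd≢0 = ≢-nonZero (gcd[m,n]≢0 M i (inj₁ (≢-nonZero⁻¹ M)))
    term : ∀ t → 𝟙 (t ∣? gcd M i) * φ t ≡ 𝟙 (t ∣? M) * (𝟙 (t ∣? i) * φ t)
    term t = trans (cong (_* φ t) conjunction) (*-assoc (𝟙 (t ∣? M)) _ _)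
      where
      conjunction : 𝟙 (t ∣? gcd M i) ≡ 𝟙 (t ∣? M) * 𝟙 (t ∣? i)
      conjunction with t ∣? M | t ∣? i
      ... | yes a | yes b = 𝟙-yes (t ∣? gcd M i) (gcd-greatest a b)
      ... | yes a | no ¬b = 𝟙-no (t ∣? gcd M i) (λ c → ¬b (∣-trans c (gcd[m,n]∣n M i)))
      ... | no ¬a | _     = 𝟙-no (t ∣? gcd M i) (λ c → ¬a (∣-trans c (gcd[m,n]∣m M i)))

  -- Orbits
  record Classes {n : ℕ} (_~_ : Fin n → Fin n → Set) : Set where
    field
      {count}  : ℕ
      cls      : Fin n → Fin count
      rep      : Fin count → Fin n
      cls-rep  : ∀ κ → cls (rep κ) ≡ κ
      sound    : ∀ i → rep (cls i) ~ i
      complete : ∀ {i j} → i ~ j → cls i ≡ cls j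

  -- Elements are added one at a time: the new one joins the class of an element related to it, or
  -- it is related to none and forms a class of its own.
  classes : ∀ {n} (_~_ : Fin n → Fin n → Set) → (∀ i j → Dec (i ~ j)) → (∀ i → i ~ i) →
    (∀ {i j} → i ~ j → j ~ i) → (∀ {i j k} → i ~ j → j ~ k → i ~ k) → Classes _~_
  classes {zero}  _~_ ~? rfl sm tr = record
    { count = 0 ; cls = λ () ; rep = λ () ; cls-rep = λ () ; sound = λ () ; complete = λ {i} → ⊥-elim (Finₚ.¬Fin0 i) }
  classes {suc n} _~_ ~? rfl sm tr
    with classes (λ i j → Fin.suc i ~ Fin.suc j) (λ i j → ~? (Fin.suc i) (Fin.suc j)) (λ i → rfl (Fin.suc i)) sm tr
       | Finₚ.any? (λ i → ~? Fin.zero (Fin.suc i))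
  ... | rest | yes (i₀ , 0~i₀) = record
    { cls = cls′ ; rep = λ κ → Fin.suc (rep κ) ; cls-rep = cls-rep ; sound = sound′ ; complete = λ {i} {j} → complete′ i j }
    where
    open Classes rest
    cls′ : Fin (suc n) → Fin count
    cls′ Fin.zero    = cls i₀
    cls′ (Fin.suc i) = cls i
    sound′ : ∀ i → Fin.suc (rep (cls′ i)) ~ i
    sound′ Fin.zero    = tr (sound i₀) (sm 0~i₀)
    sound′ (Fin.suc i) = sound i
    complete′ : ∀ i j → i ~ j → cls′ i ≡ cls′ j
    complete′ Fin.zero    Fin.zero    _ = refl
    complete′ Fin.zero    (Fin.suc j) e = complete (tr (sm 0~i₀) e)
    complete′ (Fin.suc i) Fin.zero    e = complete (tr e 0~i₀)
    complete′ (Fin.suc i) (Fin.suc j) e = complete e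
  ... | rest | no isolated = record
    { cls = cls′ ; rep = rep′ ; cls-rep = cls-rep′ ; sound = sound′ ; complete = λ {i} {j} → complete′ i j }
    where
    open Classes rest
    cls′ : Fin (suc n) → Fin (suc count)
    cls′ Fin.zero    = Fin.zero
    cls′ (Fin.suc i) = Fin.suc (cls i)
    rep′ : Fin (suc count) → Fin (suc n)
    rep′ Fin.zero    = Fin.zero
    rep′ (Fin.suc κ) = Fin.suc (rep κ)
    cls-rep′ : ∀ κ → cls′ (rep′ κ) ≡ κ
    cls-rep′ Fin.zero    = refl
    cls-rep′ (Fin.suc κ) = cong Fin.suc (cls-rep κ)
    sound′ : ∀ i → rep′ (cls′ i) ~ i
    sound′ Fin.zero    = rfl Fin.zero
    sound′ (Fin.suc i) = sound i
    complete′ : ∀ i j → i ~ j → cls′ i ≡ cls′ j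
    complete′ Fin.zero    Fin.zero    _ = refl
    complete′ Fin.zero    (Fin.suc j) e = ⊥-elim (isolated (j , e))
    complete′ (Fin.suc i) Fin.zero    e = ⊥-elim (isolated (i , sm e))
    complete′ (Fin.suc i) (Fin.suc j) e = cong Fin.suc (complete e)

  iterate-+ : ∀ {a} {A : Set a} (σ : A → A) i j x → iterate σ (i + j) x ≡ iterate σ i (iterate σ j x)
  iterate-+ σ zero    j x = refl
  iterate-+ σ (suc i) j x = cong σ (iterate-+ σ i j x)

  iterate-comm : ∀ {a} {A : Set a} (σ : A → A) j x → iterate σ j (σ x) ≡ σ (iterate σ j x)
  iterate-comm σ zero    x = refl
  iterate-comm σ (suc j) x = cong σ (iterate-comm σ j x)

  -- Burnside's lemma for a cyclic action

  module Burnside {n : ℕ} (σ : Fin n → Fin n) (T : ℕ) {{T≢0 : NonZero T}} (period : ∀ i → iterate σ T i ≡ i) where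
    iterate-multiple : ∀ b i → iterate σ (b * T) i ≡ i
    iterate-multiple zero    i = refl
    iterate-multiple (suc b) i = trans (iterate-+ σ T (b * T) i) (trans (period _) (iterate-multiple b i))

    iterate-% : ∀ j i → iterate σ j i ≡ iterate σ (j % T) i
    iterate-% j i = trans (cong (λ m → iterate σ m i) (m≡m%n+[m/n]*n j T))
      (trans (iterate-+ σ (j % T) (j / T * T) i) (cong (iterate σ (j % T)) (iterate-multiple (j / T) i)))

    -- Bounding the exponent by the period makes the relation decidable by search.
    _~_ : Fin n → Fin n → Set
    i ~ j = ∃ λ (t : Fin T) → iterate σ (toℕ t) i ≡ j

    iterate⇒~ : ∀ t {i j} → iterate σ t i ≡ j → i ~ j
    iterate⇒~ t {i} e = fromℕ< (m%n<n t T) ,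
      trans (cong (λ m → iterate σ m i) (Finₚ.toℕ-fromℕ< (m%n<n t T))) (trans (sym (iterate-% t i)) e)

    ~-sym : ∀ {i j} → i ~ j → j ~ i
    ~-sym {i} (t , refl) = iterate⇒~ (T ∸ toℕ t) (trans (sym (iterate-+ σ (T ∸ toℕ t) (toℕ t) i))
      (trans (cong (λ m → iterate σ m i) (m∸n+n≡m (<⇒≤ (Finₚ.toℕ<n t)))) (period i)))

    ~-trans : ∀ {i j k} → i ~ j → j ~ k → i ~ k
    ~-trans {i} (t , refl) (t′ , refl) = iterate⇒~ (toℕ t′ + toℕ t) (iterate-+ σ (toℕ t′) (toℕ t) i)

    orbitClasses : Classes _~_
    orbitClasses = classes _~_ (λ i j → Finₚ.any? λ t → iterate σ (toℕ t) i Fin.≟ j) (λ i → iterate⇒~ 0 refl) ~-sym ~-trans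

    open Classes orbitClasses

    orbitSpace : OrbitSpace σ count
    orbitSpace = record
      { cls     = cls
      ; rep     = rep
      ; cls-rep = cls-rep
      ; cls-σ   = λ i → sym (complete (iterate⇒~ 1 refl))
      ; reach   = λ i → toℕ (proj₁ (sound i)) , proj₂ (sound i)
      }

    fixedPoints : ℕ → ℕ
    fixedPoints j = S.sum (λ i → 𝟙 (iterate σ j i Fin.≟ i))

    -- The pairs (j, i) with σ^j i = i are counted. For fixed i, shifting j by the exponent that
    -- leads from the representative of i to i turns the condition into σ^j(rep) = i. For fixed j,
    -- exactly one i in each orbit satisfies that.
    burnside : ∑ T fixedPoints ≡ T * count
    burnside = begin
      ∑ T (λ j → S.sum (λ i → 𝟙 (iterate σ j i Fin.≟ i)))
        ≡⟨ S.∑-comm {T} {n} (λ j i → 𝟙 (iterate σ (toℕ j) i Fin.≟ i)) ⟩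
      S.sum {n} (λ i → ∑ T (λ j → 𝟙 (iterate σ j i Fin.≟ i)))
        ≡⟨ S.sum-cong-≋ {n} from-representative ⟩
      S.sum {n} (λ i → ∑ T (λ j → 𝟙 (iterate σ j (rep (cls i)) Fin.≟ i)))
        ≡⟨ S.∑-comm {T} {n} (λ j i → 𝟙 (iterate σ (toℕ j) (rep (cls i)) Fin.≟ i)) ⟨
      ∑ T (λ j → S.sum {n} (λ i → 𝟙 (iterate σ j (rep (cls i)) Fin.≟ i)))
        ≡⟨ ∑-cong {T} (λ j _ → all-representatives j) ⟩
      ∑ T (λ _ → count)
        ≡⟨ ∑-const T count ⟩
      T * count ∎
      where
      open ≡-Reasoning
      from-representative : ∀ i → ∑ T (λ j → 𝟙 (iterate σ j i Fin.≟ i)) ≡ ∑ T (λ j → 𝟙 (iterate σ j (rep (cls i)) Fin.≟ i))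
      from-representative i with sound i
      ... | t , e = trans (∑-cong {T} λ j _ → cong (λ x → 𝟙 (x Fin.≟ i))
                      (trans (cong (iterate σ j) (sym e)) (sym (iterate-+ σ j (toℕ t) _))))
                    (∑-shift T {λ j → 𝟙 (iterate σ j (rep (cls i)) Fin.≟ i)}
                      (λ j → cong (λ x → 𝟙 (x Fin.≟ i)) (trans (iterate-+ σ T j _) (period _))) (toℕ t))
      all-representatives : ∀ j → S.sum {n} (λ i → 𝟙 (iterate σ j (rep (cls i)) Fin.≟ i)) ≡ count
      all-representatives j = begin
        S.sum {n} (λ i → 𝟙 (iterate σ j (rep (cls i)) Fin.≟ i))
          ≡⟨ S.sum-cong-≋ {n} (λ i → sym (sum-single (λ κ → 𝟙 (iterate σ j (rep κ) Fin.≟ i)) (cls i) λ κ κ≢ →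
               𝟙-no (iterate σ j (rep κ) Fin.≟ i) λ e → κ≢ (trans (sym (cls-rep κ)) (complete (iterate⇒~ j e))))) ⟩
        S.sum {n} (λ i → S.sum {count} (λ κ → 𝟙 (iterate σ j (rep κ) Fin.≟ i)))
          ≡⟨ S.∑-comm {n} {count} (λ i κ → 𝟙 (iterate σ j (rep κ) Fin.≟ i)) ⟩
        S.sum {count} (λ κ → S.sum {n} (λ i → 𝟙 (iterate σ j (rep κ) Fin.≟ i)))
          ≡⟨ S.sum-cong-≋ {count} (λ κ → trans (sum-single (λ i → 𝟙 (iterate σ j (rep κ) Fin.≟ i)) (iterate σ j (rep κ))
               λ i i≢ → 𝟙-no (iterate σ j (rep κ) Fin.≟ i) (i≢ ∘ sym)) (𝟙-yes (iterate σ j (rep κ) Fin.≟ iterate σ j (rep κ)) refl)) ⟩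
        ∑ count (λ _ → 1)
          ≡⟨ trans (∑-const count 1) (*-identityʳ count) ⟩
        count ∎

  -- Multiplication by q on ℤ/n

  ∣m∸1⇒%≡ : ∀ n .{{_ : NonZero n}} {m} → 0 < m → n ∣ m ∸ 1 → ∀ i → (m * i) % n ≡ i % n
  ∣m∸1⇒%≡ n {suc m} _ (divides t eq) i = trans (cong (λ x → (i + x) % n) rearranged) ([m+kn]%n≡m%n i (t * i) n)
    where
    open import Algebra.Properties.CommutativeSemigroup *-commutativeSemigroup using (xy∙z≈xz∙y)
    rearranged : m * i ≡ t * i * n
    rearranged = trans (cong (_* i) eq) (xy∙z≈xz∙y t n i)

  %≡⇒∣ : ∀ n .{{_ : NonZero n}} {m i} → 0 < m → (m * i) % n ≡ i % n → n ∣ (m ∸ 1) * i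
  %≡⇒∣ n {suc m} {i} _ e = ∣m+n∣m⇒∣n {m = i / n * n} (divides ((i + m * i) / n) (+-cancelˡ-≡ (i % n) _ _ (begin
      i % n + (i / n * n + m * i)   ≡⟨ sym (+-assoc (i % n) _ _) ⟩
      i % n + i / n * n + m * i     ≡⟨ cong (_+ m * i) (sym (m≡m%n+[m/n]*n i n)) ⟩
      i + m * i                     ≡⟨ m≡m%n+[m/n]*n (i + m * i) n ⟩
      (i + m * i) % n + (i + m * i) / n * n  ≡⟨ cong (_+ (i + m * i) / n * n) e ⟩
      i % n + (i + m * i) / n * n   ∎))) (n∣m*n (i / n))
    where open ≡-Reasoning

  -- The interface between the two halves of the proof: the algebra identifies the number of
  -- irreducible factors with `count`, and the arithmetic evaluates `gcd-sum`.
  record OrbitData (n q T : ℕ) {{n≢0 : NonZero n}} : Set where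
    field
      π          : Permutation n n
      π-mod      : ∀ i → toℕ (π ⟨$⟩ʳ i) ≡ (q * toℕ i) % n
      {count}    : ℕ
      orbitSpace : OrbitSpace (π ⟨$⟩ʳ_) count
      period     : ∀ i → iterate (π ⟨$⟩ʳ_) T i ≡ i
      gcd-sum    : ∑ T (λ j → gcd n (q ^ j ∸ 1)) ≡ T * count

  module Multiplication (n q : ℕ) {{n≢0 : NonZero n}} (0<q : 0 < q) (T : ℕ) {{T≢0 : NonZero T}} (n∣q^T-1 : n ∣ q ^ T ∸ 1) where
    instance
      q≢0 : NonZero q
      q≢0 = >-nonZero 0<q

    σ : Fin n → Fin n
    σ i = fromℕ< (m%n<n (q * toℕ i) n)

    toℕ-σ : ∀ i → toℕ (σ i) ≡ (q * toℕ i) % n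
    toℕ-σ i = Finₚ.toℕ-fromℕ< _

    *-%ʳ : ∀ a b → (a * (b % n)) % n ≡ (a * b) % n
    *-%ʳ a b = trans (%-distribˡ-* a (b % n) n) (trans (cong (λ x → ((a % n) * x) % n) (m%n%n≡m%n b n)) (sym (%-distribˡ-* a b n)))

    toℕ-iterate : ∀ j i → toℕ (iterate σ j i) ≡ (q ^ j * toℕ i) % n
    toℕ-iterate zero    i = sym (trans (cong (_% n) (+-identityʳ (toℕ i))) (m<n⇒m%n≡m (Finₚ.toℕ<n i)))
    toℕ-iterate (suc j) i = trans (toℕ-σ (iterate σ j i)) (trans (cong (λ x → (q * x) % n) (toℕ-iterate j i))
      (trans (*-%ʳ q (q ^ j * toℕ i)) (cong (_% n) (sym (*-assoc q (q ^ j) (toℕ i))))))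

    iterate-fixed : ∀ j → n ∣ q ^ j ∸ 1 → ∀ i → iterate σ j i ≡ i
    iterate-fixed j d i = Finₚ.toℕ-injective (trans (toℕ-iterate j i)
      (trans (∣m∸1⇒%≡ n (>-nonZero⁻¹ (q ^ j) {{m^n≢0 q j}}) d (toℕ i)) (m<n⇒m%n≡m (Finₚ.toℕ<n i))))

    period : ∀ i → iterate σ T i ≡ i
    period = iterate-fixed T n∣q^T-1

    open Burnside σ T period public

    π : Permutation n n
    π = permutation σ (iterate σ (pred T))
      (λ i → trans (cong (λ m → iterate σ m i) (suc-pred T)) (period i))
      (λ i → trans (iterate-comm σ (pred T) i) (trans (cong (λ m → iterate σ m i) (suc-pred T)) (period i)))

    -- With G the gcd, i is fixed by σ^j exactly when n ∣ (q^j - 1)·i, that is, when d = n/G divides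
    -- i. Below n = G·d there are G such i.
    fixedPoints-gcd : ∀ j → fixedPoints j ≡ gcd n (q ^ j ∸ 1)
    fixedPoints-gcd j with gcd[m,n]∣m n (q ^ j ∸ 1)
    ... | divides zero    eq = ⊥-elim (≢-nonZero⁻¹ n eq)
    ... | divides d@(suc _) eq = begin
      S.sum (λ i → 𝟙 (iterate σ j i Fin.≟ i))
        ≡⟨ S.sum-cong-≋ {n} (λ i → 𝟙-cong (iterate σ j i Fin.≟ i) (d ∣? toℕ i) (to i) (from i)) ⟩
      ∑ n (λ i → 𝟙 (d ∣? i))
        ≡⟨ ∑-cong {n} (λ i _ → sym (*-identityʳ (𝟙 (d ∣? i)))) ⟩
      ∑ n (λ i → 𝟙 (d ∣? i) * 1)
        ≡⟨ cong (λ B → ∑ B (λ i → 𝟙 (d ∣? i) * 1)) (trans eq (*-comm d G)) ⟩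
      ∑ (G * d) (λ i → 𝟙 (d ∣? i) * 1)
        ≡⟨ trans (∑-multiples d G (λ _ → 1)) (trans (∑-const G 1) (*-identityʳ G)) ⟩
      G ∎
      where
      open ≡-Reasoning
      M = q ^ j ∸ 1
      G = gcd n M
      0<q^j : 0 < q ^ j
      0<q^j = >-nonZero⁻¹ (q ^ j) {{m^n≢0 q j}}
      instance
        G≢0 : NonZero G
        G≢0 = ≢-nonZero (gcd[m,n]≢0 n M (inj₁ (≢-nonZero⁻¹ n)))
      to : ∀ i → iterate σ j i ≡ i → d ∣ toℕ i
      to i e with gcd[m,n]∣n n M
      ... | divides t Meq = coprime-divisor d⊥t (*-cancelʳ-∣ G (subst₂ _∣_ eq reorder
              (%≡⇒∣ n 0<q^j (trans (sym (toℕ-iterate j i)) (trans (cong toℕ e) (sym (m<n⇒m%n≡m (Finₚ.toℕ<n i))))))))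
        where
        open import Algebra.Properties.CommutativeSemigroup *-commutativeSemigroup using (xy∙z≈xz∙y)
        reorder : M * toℕ i ≡ t * toℕ i * G
        reorder = trans (cong (_* toℕ i) Meq) (xy∙z≈xz∙y t G (toℕ i))
        d⊥t : Coprime d t
        d⊥t {x} (x∣d , x∣t) = ∣1⇒≡1 (*-cancelʳ-∣ G (subst (x * G ∣_) (sym (*-identityˡ G))
          (gcd-greatest (subst (x * G ∣_) (sym eq) (*-monoˡ-∣ G x∣d)) (subst (x * G ∣_) (sym Meq) (*-monoˡ-∣ G x∣t)))))
      from : ∀ i → d ∣ toℕ i → iterate σ j i ≡ i
      from i (divides t e) with gcd[m,n]∣n n M
      ... | divides t′ Meq = Finₚ.toℕ-injective (trans (toℕ-iterate j i) (trans (lemma 0<q^j) (m<n⇒m%n≡m (Finₚ.toℕ<n i))))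
        where
        lemma : 0 < q ^ j → (q ^ j * toℕ i) % n ≡ toℕ i % n
        lemma 0<m = trans (cong (_% n) (trans (cong (_* toℕ i) (sym (suc-pred (q ^ j) {{>-nonZero 0<m}})))
            (cong (toℕ i +_) divisible))) ([m+kn]%n≡m%n (toℕ i) (t * t′) n)
          where
          rearrange : ∀ a b c g → (a * g) * (b * c) ≡ b * a * (c * g)
          rearrange = solve-∀
          divisible : M * toℕ i ≡ t * t′ * n
          divisible = trans (cong₂ _*_ Meq e) (trans (rearrange t′ t d G) (cong (t * t′ *_) (sym eq)))

    orbit-count : ∑ T (λ j → gcd n (q ^ j ∸ 1)) ≡ T * Classes.count orbitClasses
    orbit-count = trans (∑-cong {T} (λ j _ → sym (fixedPoints-gcd j))) burnside

    orbitData : OrbitData n q T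
    orbitData = record
      { π = π ; π-mod = toℕ-σ ; orbitSpace = orbitSpace ; period = period ; gcd-sum = orbit-count }

  -- Valuations

  prime∤1 : ∀ {p} → Prime p → ¬ p ∣ 1
  prime∤1 pp p∣1 = <⇒≱ (nonTrivial⇒n>1 _ {{prime⇒nonTrivial pp}}) (∣⇒≤ p∣1)

  prime-divisor : ∀ {m} → 1 < m → ∃ λ p → Prime p × p ∣ m
  prime-divisor {m} 1<m with factorise m {{>-nonZero (<-trans z<s 1<m)}}
  ... | record { factors = [] ; isFactorisation = eq } = ⊥-elim (<⇒≢ 1<m (sym eq))
  ... | record { factors = p ∷ ps ; isFactorisation = eq ; factorsPrime = pp ∷ _ } = p , pp , subst (p ∣_) (sym eq) (m∣m*n (product ps))

  coprime-from-primes : ∀ {a b} .{{_ : NonZero a}} → (∀ {p} → Prime p → p ∣ a → ¬ p ∣ b) → Coprime a b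
  coprime-from-primes {a} h {d} (d∣a , d∣b) with <-cmp d 1
  ... | tri≈ _ d≡1 _ = d≡1
  ... | tri< (s≤s z≤n) _ _ = ⊥-elim (≢-nonZero⁻¹ a (0∣⇒≡0 d∣a))
  ... | tri> _ _ 1<d with prime-divisor 1<d
  ...   | p , pp , p∣d = ⊥-elim (h pp (∣-trans p∣d d∣a) (∣-trans p∣d d∣b))

  coprime⇒prime∤ : ∀ {a b p} → Coprime a b → Prime p → p ∣ a → ¬ p ∣ b
  coprime⇒prime∤ c pp p∣a p∣b = prime∤1 pp (∣-reflexive (c (p∣a , p∣b)))

  -- Exact divisibility by p^a, kept with its cofactor as a relation; `ν-val` connects it with the
  -- function `ν`.
  record Val (p x a : ℕ) : Set where
    constructor val
    field
      {cofactor} : ℕ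
      equation   : x ≡ p ^ a * cofactor
      p∤cofactor : ¬ p ∣ cofactor

  valuation : ∀ {p} → Prime p → ∀ x → .{{NonZero x}} → ∃ (Val p x)
  valuation {p} pp x = <-rec (λ x → NonZero x → ∃ (Val p x)) step x (recompute-nonZero x)
    where
    instance _ = prime⇒nonTrivial pp
    recompute-nonZero : ∀ x → .{{NonZero x}} → NonZero x
    recompute-nonZero (suc x) = _
    step : ∀ x → (∀ {y} → y < x → NonZero y → ∃ (Val p y)) → NonZero x → ∃ (Val p x)
    step x rec x≢0 with p ∣? x
    ... | no p∤x = 0 , val (sym (+-identityʳ x)) p∤x
    ... | yes (divides zero    eq) = ⊥-elim (≢-nonZero⁻¹ x {{x≢0}} eq)
    ... | yes p∣x@(divides y@(suc _) eq) with rec (quotient-< p∣x {{it}} {{x≢0}}) _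
      where open import Function using (it)
    ...   | a , val {u} eq′ p∤u = suc a , val (trans eq (trans (*-comm y p) (trans (cong (p *_) eq′) (sym (*-assoc p (p ^ a) u))))) p∤u

  module Valuation {p : ℕ} (pp : Prime p) where
    private instance
      p≢0 : NonZero p
      p≢0 = prime⇒nonZero pp

    val-divides : ∀ {x a} → Val p x a → p ^ a ∣ x
    val-divides {a = a} (val {u} eq _) = divides u (trans eq (*-comm (p ^ a) u))

    ^-mono-∣ : ∀ {a b} → a ≤ b → p ^ a ∣ p ^ b
    ^-mono-∣ {a} a≤b with m≤n⇒∃[o]m+o≡n a≤b
    ... | o , refl = divides (p ^ o) (trans (^-distribˡ-+-* p a o) (*-comm (p ^ a) (p ^ o)))

    val-≤ : ∀ {x a b} → Val p x a → p ^ b ∣ x → b ≤ a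
    val-≤ {x} {a} {b} (val {u} eq p∤u) d with b ≤? a
    ... | yes b≤a = b≤a
    ... | no  b≰a = ⊥-elim (p∤u (*-cancelˡ-∣ (p ^ a) {{m^n≢0 p a}} (subst₂ _∣_ (*-comm p (p ^ a)) eq
                      (∣-trans (^-mono-∣ (≰⇒> b≰a)) d))))

    val-unique : ∀ {x a b} → Val p x a → Val p x b → a ≡ b
    val-unique V W = ≤-antisym (val-≤ W (val-divides V)) (val-≤ V (val-divides W))

    val-mono : ∀ {x y a b} → x ∣ y → Val p x a → Val p y b → a ≤ b
    val-mono x∣y V W = val-≤ W (∣-trans (val-divides V) x∣y)

    val-* : ∀ {x y a b} → Val p x a → Val p y b → Val p (x * y) (a + b)
    val-* {a = a} {b} (val {u} eq p∤u) (val {w} eq′ p∤w) = val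
      (trans (cong₂ _*_ eq eq′) (trans (rearrange (p ^ a) u (p ^ b) w) (cong (_* (u * w)) (sym (^-distribˡ-+-* p a b)))))
      λ p∣uw → [ p∤u , p∤w ]′ (euclidsLemma u w pp p∣uw)
      where
      rearrange : ∀ a u b w → a * u * (b * w) ≡ a * b * (u * w)
      rearrange = solve-∀

    val-0 : ∀ {x} → ¬ p ∣ x → Val p x 0
    val-0 {x} p∤x = val (sym (+-identityʳ x)) p∤x

    val-≥1 : ∀ {x a} → Val p x a → p ∣ x → 1 ≤ a
    val-≥1 V p∣x = val-≤ V (subst (_∣ _) (sym (*-identityʳ p)) p∣x)

    val-gcd : ∀ {x y a b c} → Val p x a → Val p y b → Val p (gcd x y) c → c ≡ a ⊓ b
    val-gcd {x} {y} {a} {b} V W Z = ≤-antisym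
      (⊓-glb (val-mono (gcd[m,n]∣m x y) Z V) (val-mono (gcd[m,n]∣n x y) Z W))
      (val-≤ Z (gcd-greatest (∣-trans (^-mono-∣ (m⊓n≤m a b)) (val-divides V)) (∣-trans (^-mono-∣ (m⊓n≤n a b)) (val-divides W))))

  -- Write x = x′·gcd(x, y). A prime divisor of x′ would make the valuation of the gcd smaller than
  -- that of x, but it is the minimum of the two valuations, which is that of x.
  divides-from-valuations : ∀ {x y} .{{_ : NonZero x}} .{{_ : NonZero y}} →
    (∀ {p a b} → Prime p → Val p x a → Val p y b → a ≤ b) → x ∣ y
  divides-from-valuations {x} {y} h with gcd[m,n]∣m x y
  ... | divides zero    eq = ⊥-elim (≢-nonZero⁻¹ x eq)
  ... | divides (suc zero) eq = subst (_∣ y) (trans (sym (+-identityʳ (gcd x y))) (sym eq)) (gcd[m,n]∣n x y)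
  ... | divides x′@(suc (suc _)) eq with prime-divisor {x′} (s≤s (s≤s z≤n))
  ...   | p , pp , p∣x′ with valuation pp x | valuation pp y | valuation pp (gcd x y) {{≢-nonZero (gcd[m,n]≢0 x y (inj₁ (≢-nonZero⁻¹ x)))}} | valuation pp x′
  ...     | a , V | b , W | c , Z | d , X = ⊥-elim (<-irrefl
            (trans (trans (val-gcd V W Z) (m≤n⇒m⊓n≡m (h pp V W))) (val-unique (subst (λ z → Val p z a) eq V) (val-* X Z)))
            (m<n+m c (val-≥1 X p∣x′)))
    where
    open Valuation pp

  -- Lifting the exponent

  -- The binomial coefficient C(i, 2), by a recursion that avoids division.
  triangle : ℕ → ℕ
  triangle zero    = 0
  triangle (suc i) = triangle i + i

  2*triangle : ∀ i → 2 * triangle (suc i) ≡ suc i * i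
  2*triangle zero    = refl
  2*triangle (suc i) = trans (*-distribˡ-+ 2 (triangle (suc i)) (suc i)) (trans (cong (_+ 2 * suc i) (2*triangle i)) (ring i))
    where
    ring : ∀ i → suc i * i + 2 * suc i ≡ suc (suc i) * suc i
    ring = solve-∀

  ∣2*triangle : ∀ i → i ∣ 2 * triangle i
  ∣2*triangle zero    = 0 ∣0
  ∣2*triangle (suc i) = divides i (trans (2*triangle i) (*-comm (suc i) i))

  -- The binomial expansion through the quadratic term in Horner form; τ gathers what remains from
  -- y³ on.
  [1+y]^-expansion : ∀ y i → ∃ λ τ → (1 + y) ^ i ≡ 1 + y * (i + y * (triangle i + y * τ))
  [1+y]^-expansion y zero    = 0 , ring y
    where
    ring : ∀ y → 1 ≡ 1 + y * (0 + y * (0 + y * 0))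
    ring = solve-∀
  [1+y]^-expansion y (suc i) with [1+y]^-expansion y i
  ... | τ , eq = triangle i + τ + y * τ , trans (cong ((1 + y) *_) eq) (ring y i (triangle i) τ)
    where
    ring : ∀ y i t τ → (1 + y) * (1 + y * (i + y * (t + y * τ))) ≡ 1 + y * (suc i + y * (t + i + y * (t + τ + y * τ)))
    ring = solve-∀

  -- p^b divides (1+y)^i − 1 exactly when it divides y·i, up to factors prime to p.
  Lifts : ℕ → ℕ → ℕ → Set
  Lifts p y i = ∃ λ Z → (1 + y) ^ i ≡ 1 + Z × ∃ λ w → ∃ λ w′ → ¬ p ∣ w × ¬ p ∣ w′ × Z * w′ ≡ y * i * w

  lift-coprime : ∀ {p y i} → p ∣ y → ¬ p ∣ i → Lifts p y i
  lift-coprime {p} {y} {i} p∣y p∤i with [1+y]^-expansion y i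
  -- Here (1 + y)^i - 1 = y·(i + y·t); since p ∣ y, both i + y·t and i are prime to p and serve as w
  -- and w′.
  ... | τ , eq = _ , eq , i + y * t , i , (λ d → p∤i (∣m+n∣n⇒∣m′ d)) , p∤i , ring y i (i + y * t)
    where
    t = triangle i + y * τ
    ∣m+n∣n⇒∣m′ : p ∣ i + y * t → p ∣ i
    ∣m+n∣n⇒∣m′ d = ∣m+n∣m⇒∣n {m = y * t} (subst (p ∣_) (+-comm i (y * t)) d) (∣m⇒∣m*n t p∣y)
    ring : ∀ y i w → y * w * i ≡ y * i * w
    ring = solve-∀

  p∤1+p* : ∀ {p} → Prime p → ∀ t → ¬ p ∣ 1 + p * t
  p∤1+p* {p} pp t d = prime∤1 pp (∣m+n∣m⇒∣n (subst (p ∣_) (+-comm 1 (p * t)) d) (m∣m*n t))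

  -- For odd p, both C(p, 2) and y are multiples of p, so the quadratic and higher terms are
  -- multiples of y·p². For p = 2, (1 + y)² = 1 + 2y·(1 + y/2), and y/2 is even because 4 ∣ y.
  lift-prime : ∀ {p y} → Prime p → p ∣ y → (p ≡ 2 → 4 ∣ y) → ∃ λ w → (1 + y) ^ p ≡ 1 + y * p * w × ¬ p ∣ w
  lift-prime {p} {y} pp p∣y 4∣y with p ≟ 2
  ... | yes refl with 4∣y refl
  ...   | divides y″ refl = 1 + 2 * y″ , ring y″ , p∤1+p* pp y″
    where
    ring : ∀ y → (1 + y * 4) * ((1 + y * 4) * 1) ≡ 1 + y * 4 * 2 * (1 + 2 * y)
    ring = solve-∀
  lift-prime {p} {y} pp (divides y′ refl) 4∣y | no p≢2 with [1+y]^-expansion y p | p∣triangle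
    where
    p∣triangle : p ∣ triangle p
    p∣triangle with euclidsLemma 2 (triangle p) pp (∣2*triangle p)
    ... | inj₂ d = d
    ... | inj₁ d = ⊥-elim (p≢2 (≤-antisym (∣⇒≤ d) (nonTrivial⇒n>1 p {{prime⇒nonTrivial pp}})))
  ... | τ , eq | divides t′ teq = 1 + p * (y′ * t′ + y′ * y′ * τ) ,
        trans eq (trans (cong (λ t → 1 + y′ * p * (p + y′ * p * (t + y′ * p * τ))) teq) (ring y′ p t′ τ)) , p∤1+p* pp _
    where
    ring : ∀ y p t τ → 1 + y * p * (p + y * p * (t * p + y * p * τ)) ≡ 1 + y * p * p * (1 + p * (y * t + y * y * τ))
    ring = solve-∀

  -- Factors p are removed from the exponent one at a time: (1 + y)^(jp) = (1 + y·p·w₁)^j, and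
  -- y·p·w₁ meets the hypotheses on y again. `lift-coprime` ends the descent.
  lifting-exponent : ∀ {p} → Prime p → ∀ i {y} → 0 < i → p ∣ y → (p ≡ 2 → 4 ∣ y) → Lifts p y i
  lifting-exponent {p} pp = <-rec _ step
    where
    instance _ = prime⇒nonTrivial pp
    step : ∀ i → (∀ {j} → j < i → ∀ {y} → 0 < j → p ∣ y → (p ≡ 2 → 4 ∣ y) → Lifts p y j) →
           ∀ {y} → 0 < i → p ∣ y → (p ≡ 2 → 4 ∣ y) → Lifts p y i
    step i rec {y} 0<i p∣y 4∣y with p ∣? i
    ... | no p∤i = lift-coprime p∣y p∤i
    ... | yes (divides zero eq) = ⊥-elim (<⇒≢ 0<i (sym eq))
    ... | yes p∣i@(divides j@(suc _) eq) with lift-prime pp p∣y 4∣y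
    ...   | w₁ , eq₁ , p∤w₁ with rec (quotient-< p∣i {{prime⇒nonTrivial pp}} {{>-nonZero 0<i}}) {y * p * w₁} (s≤s z≤n)
                                     (∣m⇒∣m*n w₁ (∣n⇒∣m*n y ∣-refl)) (λ e → ∣m⇒∣m*n w₁ (∣m⇒∣m*n p (4∣y e)))
    ...     | Z , eqZ , w , w′ , p∤w , p∤w′ , eq′ = Z ,
              trans (cong ((1 + y) ^_) (trans eq (*-comm j p))) (trans (sym (^-*-assoc (1 + y) p j)) (trans (cong (_^ j) eq₁) eqZ)) ,
              w₁ * w , w′ , (λ d → [ p∤w₁ , p∤w ]′ (euclidsLemma w₁ w pp d)) , p∤w′ ,
              trans eq′ (trans (ring y p w₁ j w) (cong (λ i → y * i * (w₁ * w)) (sym eq)))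
      where
      ring : ∀ y p w₁ j w → y * p * w₁ * j * w ≡ y * (j * p) * (w₁ * w)
      ring = solve-∀

  lifts⇒val : ∀ {p y i α β} (pp : Prime p) → Val p y α → Val p i β → (l : Lifts p y i) → Val p (proj₁ l) (α + β)
  lifts⇒val {p} {y} {i} {α} {β} pp V W (Z , _ , w , w′ , p∤w , p∤w′ , eq) = subst (Val p Z) exponent (proj₂ ζ)
    where
    open Valuation pp
    VW : Val p (Z * w′) (α + β + 0)
    VW = subst (λ x → Val p x (α + β + 0)) (sym eq) (val-* (val-* V W) (val-0 p∤w))
    Zw′≢0 : Z ≢ 0
    Zw′≢0 refl with VW
    ... | val {u} e p∤u = p∤u (subst (p ∣_) (sym ([ (λ z → ⊥-elim (≢-nonZero⁻¹ (p ^ (α + β + 0)) {{m^n≢0 p (α + β + 0) {{prime⇒nonZero pp}}}} z)) , (λ z → z) ]′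
              (m*n≡0⇒m≡0∨n≡0 (p ^ (α + β + 0)) (sym e)))) (p ∣0))
    ζ : ∃ (Val p Z)
    ζ = valuation pp Z {{≢-nonZero Zw′≢0}}
    exponent : proj₁ ζ ≡ α + β
    exponent = +-cancelʳ-≡ 0 _ _ (val-unique (val-* (proj₂ ζ) (val-0 p∤w′)) VW)

  *-div : ∀ t d .{{_ : NonZero d}} → (t * d) div d ≡ t
  *-div t (suc d) = m*n/n≡m t (suc d)

  prime∣^ : ∀ {p r} → Prime p → Prime r → ∀ a → r ∣ p ^ a → r ≡ p
  prime∣^ pp pr zero    d = ⊥-elim (prime∤1 pr d)
  prime∣^ {p} {r} pp pr (suc a) d with euclidsLemma p (p ^ a) pr d
  ... | inj₂ d′ = prime∣^ pp pr a d′
  ... | inj₁ r∣p with prime⇒irreducible pp r∣p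
  ...   | inj₁ refl = ⊥-elim (¬prime[1] pr)
  ...   | inj₂ r≡p  = r≡p

  -- Divisibility among the numbers q^j - 1

  module PowersMinusOne (q : ℕ) {{q≢0 : NonZero q}} where
    P : ℕ → ℕ
    P j = q ^ j ∸ 1

    q^≡1+P : ∀ j → q ^ j ≡ 1 + P j
    q^≡1+P j = sym (suc-pred (q ^ j) {{m^n≢0 q j}})

    P-+ : ∀ a b → P (a + b) ≡ P a * q ^ b + P b
    P-+ a b = suc-injective (begin
      suc (P (a + b))             ≡⟨ q^≡1+P (a + b) ⟨
      q ^ (a + b)                 ≡⟨ ^-distribˡ-+-* q a b ⟩
      q ^ a * q ^ b               ≡⟨ cong (_* q ^ b) (q^≡1+P a) ⟩
      q ^ b + P a * q ^ b         ≡⟨ cong (_+ P a * q ^ b) (q^≡1+P b) ⟩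
      suc (P b + P a * q ^ b)     ≡⟨ cong suc (+-comm (P b) _) ⟩
      suc (P a * q ^ b + P b)     ∎)
      where open ≡-Reasoning

    P-∣ : ∀ {a b} → a ∣ b → P a ∣ P b
    P-∣ {a} (divides t refl) = multiple t
      where
      multiple : ∀ t → P a ∣ P (t * a)
      multiple zero    = P a ∣0
      multiple (suc t) = subst (P a ∣_) (sym (P-+ a (t * a))) (∣m∣n⇒∣m+n (m∣m*n (q ^ (t * a))) (multiple t))

    -- A divisor of q^b - 1 is prime to q^b, which therefore cancels in P(a + b) = P(a)·q^b + P(b).
    P-cancel : ∀ {d} a b → d ∣ P b → d ∣ P (a + b) → d ∣ P a
    P-cancel {d} a b d∣b d∣ = coprime-divisor coprime
        (subst (d ∣_) (*-comm (P a) (q ^ b)) (∣m+n∣m⇒∣n (subst (d ∣_) (trans (P-+ a b) (+-comm _ (P b))) d∣) d∣b))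
      where
      coprime : Coprime d (q ^ b)
      coprime {c} (c∣d , c∣q^b) = ∣1⇒≡1 (∣m+n∣m⇒∣n (subst (c ∣_) (trans (q^≡1+P b) (+-comm 1 (P b))) c∣q^b) (∣-trans c∣d d∣b))

    -- Bézout in the exponents: gcd(a, b) is a difference of a multiple of a and a multiple of b in
    -- one order or the other, and `P-cancel` subtracts exponents.
    P-gcd : ∀ {d a b} → d ∣ P a → d ∣ P b → d ∣ P (gcd a b)
    P-gcd {d} {a} {b} d∣a d∣b with Bézout.identity (gcd-GCD a b)
    ... | Bézout.+- x y eq = P-cancel (gcd a b) (y * b) (∣-trans d∣b (P-∣ (n∣m*n y)))
            (subst (λ e → d ∣ P e) (sym eq) (∣-trans d∣a (P-∣ (n∣m*n x))))
    ... | Bézout.-+ x y eq = P-cancel (gcd a b) (x * a) (∣-trans d∣a (P-∣ (n∣m*n x)))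
            (subst (λ e → d ∣ P e) (sym eq) (∣-trans d∣b (P-∣ (n∣m*n y))))

  -- The p-parts of gcd(n, q^j - 1)

  module Key (n q s : ℕ) {{n≢0 : NonZero n}} {{s≢0 : NonZero s}} (1<q : 1 < q)
    (prime∣P : ∀ {p} → Prime p → p ∣ n → p ∣ q ^ s ∸ 1) (8∣n⇒4∣P : 8 ∣ n → 4 ∣ q ^ s ∸ 1) where

    instance
      q≢0 : NonZero q
      q≢0 = >-nonZero (<-trans z<s 1<q)
    open PowersMinusOne q

    G : ℕ → ℕ
    G j = gcd n (P j)

    G-nonZero : ∀ j → NonZero (G j)
    G-nonZero j = ≢-nonZero (gcd[m,n]≢0 n (P j) (inj₁ (≢-nonZero⁻¹ n)))

    P-nonZero : ∀ j .{{_ : NonZero j}} → NonZero (P j)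
    P-nonZero (suc j) = >-nonZero (m<n⇒0<n∸m (*-mono-≤ 1<q (>-nonZero⁻¹ (q ^ j) {{m^n≢0 q j}})))

    G-∣ : ∀ {a b} → a ∣ b → G a ∣ G b
    G-∣ {a} {b} a∣b = gcd-greatest (gcd[m,n]∣m n (P a)) (∣-trans (gcd[m,n]∣n n (P a)) (P-∣ a∣b))

    G-gcd : ∀ a b → G (gcd a b) ≡ gcd (G a) (G b)
    G-gcd a b = ∣-antisym
      (gcd-greatest (G-∣ (gcd[m,n]∣m a b)) (G-∣ (gcd[m,n]∣n a b)))
      (gcd-greatest (∣-trans (gcd[m,n]∣m (G a) (G b)) (gcd[m,n]∣m n (P a)))
        (P-gcd {a = a} {b} (∣-trans (gcd[m,n]∣m (G a) (G b)) (gcd[m,n]∣n n (P a)))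
               (∣-trans (gcd[m,n]∣n (G a) (G b)) (gcd[m,n]∣n n (P b)))))

    m : ℕ
    m = quotient (gcd[m,n]∣m n (P s))

    n≡m*G : n ≡ m * G s
    n≡m*G = _∣_.equality (gcd[m,n]∣m n (P s))

    m≢0 : NonZero m
    m≢0 = ≢-nonZero λ e → ≢-nonZero⁻¹ n (trans n≡m*G (cong (_* G s) e))

    m∣n : m ∣ n
    m∣n = divides (G s) (trans n≡m*G (*-comm m (G s)))

    -- M is the largest divisor of m prime to the cofactor D = G s / G v.
    record IsMax (v D M : ℕ) : Set where
      field
        cofactor : G s ≡ D * G v
        M∣m      : M ∣ m
        D⊥M      : Coprime D M
        maximal  : ∀ {t} → t ∣ m → Coprime D t → t ∣ M

      D≢0 : NonZero D
      D≢0 = ≢-nonZero λ e → ≢-nonZero⁻¹ (G s) {{G-nonZero s}} (trans cofactor (cong (_* G v) e))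

      M≢0 : NonZero M
      M≢0 = ≢-nonZero λ e → ≢-nonZero⁻¹ m {{m≢0}} (0∣⇒≡0 (subst (_∣ m) e M∣m))

    module AtPrime {p : ℕ} (pp : Prime p) where
      open Valuation pp

      -- α is the minimum of N and π, so α < N leaves only π.
      capped : ∀ {N α y π} → Val p n N → Val p (gcd n y) α → Val p y π → α < N → π ≡ α
      capped {N} {α} {y} {π} VN V W α<N with ≤-total N π
      ... | inj₁ N≤π = ⊥-elim (<-irrefl (trans (val-gcd VN W V) (m≤n⇒m⊓n≡m N≤π)) α<N)
      ... | inj₂ π≤N = sym (trans (val-gcd VN W V) (m≥n⇒m⊓n≡n π≤N))

      expansion : ∀ v i → ∃ λ c → P (i * v) ≡ P v * (i + P v * c)
      expansion v i with [1+y]^-expansion (P v) i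
      ... | τ , eq = triangle i + P v * τ , suc-injective (trans (sym (q^≡1+P (i * v)))
            (trans (cong (q ^_) (*-comm i v)) (trans (sym (^-*-assoc q v i)) (trans (cong (_^ i) (q^≡1+P v)) eq))))

      lifted : ∀ {v i α β} → Val p (P v) α → Val p i β → Lifts p (P v) i → Val p (P (i * v)) (α + β)
      lifted {v} {i} {α} {β} V W l@(Z , eq , _) = subst (λ x → Val p x (α + β)) (suc-injective (sym (trans (sym (q^≡1+P (i * v)))
            (trans (cong (q ^_) (*-comm i v)) (trans (sym (^-*-assoc q v i)) (trans (cong (_^ i) (q^≡1+P v)) eq)))))) (lifts⇒val pp V W l)

      module _ {v D M} (max : IsMax v D M) where
        open IsMax max

        equal⇒∤D : ∀ {α} → Val p (G s) α → Val p (G v) α → ¬ p ∣ D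
        equal⇒∤D {α} Vs Vv p∣D with valuation pp D {{D≢0}}
        ... | δ , VD = <-irrefl (val-unique Vs (subst (λ x → Val p x (δ + α)) (sym cofactor) (val-* VD Vv))) (m<n+m α (val-≥1 VD p∣D))

        ∤D⇒equal : ∀ {α} → ¬ p ∣ D → Val p (G s) α → Val p (G v) α
        ∤D⇒equal {α} p∤D Vs with valuation pp (G v) {{G-nonZero v}}
        ... | α′ , Vv = subst (Val p (G v)) (sym (val-unique Vs (subst (λ x → Val p x α′) (sym cofactor) (val-* (val-0 p∤D) Vv)))) Vv

        -- p^μ is itself a divisor of m prime to D, so it divides M.
        full-part : ∀ {μ ν} → ¬ p ∣ D → Val p m μ → Val p M ν → ν ≡ μ
        full-part {μ} p∤D Vm VM = ≤-antisym (val-mono M∣m VM Vm) (val-≤ VM (maximal (val-divides Vm)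
          (coprime-from-primes {{D≢0}} λ pr r∣D r∣p^ → p∤D (subst (_∣ D) (prime∣^ pp pr μ r∣p^) r∣D))))

        -- With j = i·v and v = gcd(j, s), the valuation of G v is the minimum of those of G j and G
        -- s. If it is below that of G s, it is that of G j, and p ∣ D keeps p out of M. Otherwise M
        -- contains the whole p-part of m; lifting gives P j the valuation αv + β, and the gcd with
        -- n caps it at N = αv + ν.
        key-valuation : ∀ {i N αs αv αj μ ν β} → v ≡ gcd (i * v) s →
          Val p n N → Val p (G s) αs → Val p (G v) αv → Val p (G (i * v)) αj → Val p m μ → Val p M ν → Val p i β →
          αj ≡ αv + (ν ⊓ β)
        key-valuation {i} {N} {αs} {αv} {αj} {μ} {ν} {β} v≡ VN Vs Vv Vj Vm VM Vi with p ∣? n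
        ... | no p∤n = trans (zero-val (gcd[m,n]∣m n _) Vj)
              (sym (cong₂ (λ a b → a + (b ⊓ β)) (zero-val (gcd[m,n]∣m n _) Vv) (zero-val (∣-trans M∣m m∣n) VM)))
          where
          zero-val : ∀ {x a} → x ∣ n → Val p x a → a ≡ 0
          zero-val x∣n V = n≤0⇒n≡0 (val-mono x∣n V (val-0 p∤n))
        ... | yes p∣n with αv <? αs
        ...   | yes αv<αs = trans αj≡αv (sym (trans (cong (λ b → αv + (b ⊓ β)) ν≡0) (+-identityʳ αv)))
          where
          αv≡ : αv ≡ αj ⊓ αs
          αv≡ = val-gcd Vj Vs (subst (λ x → Val p x αv) (trans (cong G v≡) (G-gcd (i * v) s)) Vv)
          αj≡αv : αj ≡ αv
          αj≡αv with ≤-total αj αs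
          ... | inj₁ le = sym (trans αv≡ (m≤n⇒m⊓n≡m le))
          ... | inj₂ ge = ⊥-elim (<-irrefl (trans αv≡ (m≥n⇒m⊓n≡n ge)) αv<αs)
          p∣D : p ∣ D
          p∣D with p ∣? D
          ... | yes d = d
          ... | no v∤ = ⊥-elim (<-irrefl (val-unique Vv (∤D⇒equal v∤ Vs)) αv<αs)
          ν≡0 : ν ≡ 0
          ν≡0 = val-unique VM (val-0 (coprime⇒prime∤ D⊥M pp p∣D))
        ...   | no αv≮αs = conclude (μ ≟ 0)
          where
          αv≡ : αv ≡ αj ⊓ αs
          αv≡ = val-gcd Vj Vs (subst (λ x → Val p x αv) (trans (cong G v≡) (G-gcd (i * v) s)) Vv)
          αv≡αs : αv ≡ αs
          αv≡αs = ≤-antisym (≤-trans (≤-reflexive αv≡) (m⊓n≤n αj αs)) (≮⇒≥ αv≮αs)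
          p∤D : ¬ p ∣ D
          p∤D = equal⇒∤D Vs (subst (Val p (G v)) αv≡αs Vv)
          ν≡μ : ν ≡ μ
          ν≡μ = full-part p∤D Vm VM
          N≡ : N ≡ μ + αs
          N≡ = val-unique VN (subst (λ x → Val p x (μ + αs)) (sym n≡m*G) (val-* Vm Vs))
          αv≤αj : αv ≤ αj
          αv≤αj = ≤-trans (≤-reflexive αv≡) (m⊓n≤m αj αs)
          αj≤N : αj ≤ N
          αj≤N = val-mono (gcd[m,n]∣m n _) Vj VN
          1≤αv : 1 ≤ αv
          1≤αv = subst (1 ≤_) (sym αv≡αs) (val-≥1 Vs (gcd-greatest p∣n (prime∣P pp p∣n)))
          conclude : Dec (μ ≡ 0) → αj ≡ αv + (ν ⊓ β)
          -- The p-part of n already divides G s, so N = αv and αj has no room to grow.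
          conclude (yes μ≡0) = trans (≤-antisym (subst (αj ≤_) (trans N≡ (trans (cong (_+ αs) μ≡0) (sym αv≡αs))) αj≤N) αv≤αj)
            (sym (trans (cong (λ b → αv + (b ⊓ β)) (trans ν≡μ μ≡0)) (+-identityʳ αv)))
          conclude (no μ≢0) = by-cases (p ∣? i) (p ≟ 2) (4 ∣? P v)
            where
            αs<N : αs < N
            αs<N = subst (αs <_) (sym N≡) (m<n+m αs (n≢0⇒n>0 μ≢0))
            αv<N : αv < N
            αv<N = subst (_< N) (sym αv≡αs) αs<N
            v≢0 : NonZero v
            v≢0 = ≢-nonZero λ e → ≢-nonZero⁻¹ s (gcd[m,n]≡0⇒n≡0 (i * v) (trans (sym v≡) e))
            VPv : Val p (P v) αv
            VPv with valuation pp (P v) {{P-nonZero v {{v≢0}}}}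
            ... | π , W = subst (Val p (P v)) (capped VN Vv W αv<N) W
            p∣Pv : p ∣ P v
            p∣Pv = ∣-trans (subst (_∣ p ^ αv) (*-identityʳ p) (^-mono-∣ 1≤αv)) (val-divides VPv)
            from-lift : Lifts p (P v) i → αj ≡ αv + (ν ⊓ β)
            from-lift l = begin
              αj                     ≡⟨ val-gcd VN (lifted VPv Vi l) Vj ⟩
              N ⊓ (αv + β)           ≡⟨ cong (_⊓ (αv + β)) (trans N≡ (trans (+-comm μ αs) (cong₂ _+_ (sym αv≡αs) (sym ν≡μ)))) ⟩
              (αv + ν) ⊓ (αv + β)    ≡⟨ +-distribˡ-⊓ αv ν β ⟨
              αv + (ν ⊓ β)           ∎
              where open ≡-Reasoning
            0<i : 0 < i
            0<i = n≢0⇒n>0 λ { refl → <⇒≱ (n<1+n β) (val-≤ Vi ((p ^ suc β) ∣0)) }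
            by-cases : Dec (p ∣ i) → Dec (p ≡ 2) → Dec (4 ∣ P v) → αj ≡ αv + (ν ⊓ β)
            by-cases (no p∤i) _ _ = from-lift (lift-coprime p∣Pv p∤i)
            by-cases (yes p∣i) (no p≢2) _ = from-lift (lifting-exponent pp i 0<i p∣Pv (λ e → ⊥-elim (p≢2 e)))
            by-cases (yes p∣i) (yes p≡2) (yes 4∣) = from-lift (lifting-exponent pp i 0<i p∣Pv (λ _ → 4∣))
            -- Here P v ≡ 2 mod 4, and lifting fails, but then n is not divisible by 8.
            by-cases (yes p∣i) (yes refl) (no 4∤) = trans (≤-antisym (subst (αj ≤_) N≡2 αj≤N) 2≤αj)
                (sym (cong₂ _+_ αv≡1 (trans (cong (_⊓ β) (trans ν≡μ μ≡1)) (m≤n⇒m⊓n≡m (val-≥1 Vi p∣i)))))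
              where
              αv≡1 : αv ≡ 1
              αv≡1 = ≤-antisym (≤-pred (≰⇒> λ 2≤αv → 4∤ (∣-trans (^-mono-∣ 2≤αv) (val-divides VPv)))) 1≤αv
              αs≡1 : αs ≡ 1
              αs≡1 = trans (sym αv≡αs) αv≡1
              N≤2 : N ≤ 2
              -- If 8 ∣ n, then 4 ∣ P s and hence 4 ∣ G s, against αs = 1.
              N≤2 = ≤-pred (≰⇒> λ 3≤N → <⇒≱ {αs} {2} (≤-reflexive (cong suc αs≡1)) (val-≤ Vs (gcd-greatest
                      (∣-trans (^-mono-∣ (≤-trans (n≤1+n 2) 3≤N)) (val-divides VN))
                      (8∣n⇒4∣P (∣-trans (^-mono-∣ 3≤N) (val-divides VN))))))
              μ≡1 : μ ≡ 1
              μ≡1 = ≤-antisym (+-cancelʳ-≤ 1 μ 1 (subst (_≤ 2) (trans N≡ (cong (μ +_) αs≡1)) N≤2)) (n≢0⇒n>0 μ≢0)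
              N≡2 : N ≡ 2
              N≡2 = trans N≡ (cong₂ _+_ μ≡1 αs≡1)
              2≤αj : 2 ≤ αj
              2≤αj with expansion v i
              -- P(i·v) = P(v)·(i + P(v)·c) is a product of two even numbers, hence divisible by 4 =
              -- 2^N.
              ... | c , eq = val-≤ Vj (gcd-greatest (subst (λ N → 2 ^ N ∣ n) N≡2 (val-divides VN))
                      (subst (4 ∣_) (sym eq) (*-pres-∣ p∣Pv (∣m∣n⇒∣m+n p∣i (∣m⇒∣m*n c p∣Pv)))))

        -- As p ∤ D, G v has the valuation αs of G s. If p ∣ i, then P s = P v·(i + P v·c) is
        -- divisible by p^(αs + 1); so is n because p ∣ m, and then G s is too, a contradiction.
        p∤M∩s/v : ∀ {i} → s ≡ i * v → p ∣ M → ¬ p ∣ i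
        p∤M∩s/v {i} s≡ p∣M p∣i with valuation pp n | valuation pp (G s) {{G-nonZero s}} | valuation pp m {{m≢0}}
        ... | N , VN | αs , Vs | μ , Vm = <⇒≱ (n<1+n αs) (val-≤ Vs (gcd-greatest
                (∣-trans (^-mono-∣ αs<N) (val-divides VN)) p^∣Ps))
          where
          p∤D : ¬ p ∣ D
          p∤D p∣D = coprime⇒prime∤ D⊥M pp p∣D p∣M
          p∣m : p ∣ m
          p∣m = ∣-trans p∣M M∣m
          p∣n : p ∣ n
          p∣n = ∣-trans p∣m m∣n
          αs<N : αs < N
          αs<N = subst (αs <_) (sym (val-unique VN (subst (λ x → Val p x (μ + αs)) (sym n≡m*G) (val-* Vm Vs)))) (m<n+m αs (val-≥1 Vm p∣m))
          Vv : Val p (G v) αs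
          Vv = ∤D⇒equal p∤D Vs
          p^∣Pv : p ^ αs ∣ P v
          p^∣Pv = ∣-trans (val-divides Vv) (gcd[m,n]∣n n (P v))
          p∣Pv : p ∣ P v
          p∣Pv = ∣-trans (subst (_∣ p ^ αs) (*-identityʳ p) (^-mono-∣ (val-≥1 Vs (gcd-greatest p∣n (prime∣P pp p∣n))))) p^∣Pv
          p^∣Ps : p ^ suc αs ∣ P s
          p^∣Ps with expansion v i
          ... | c , eq = subst₂ _∣_ (*-comm (p ^ αs) p) (sym (trans (cong P s≡) eq)) (*-pres-∣ p^∣Pv (∣m∣n⇒∣m+n p∣i (∣m⇒∣m*n c p∣Pv)))

    module _ {v D M} (max : IsMax v D M) where
      open IsMax max

      M⊥s/v : ∀ {i} → s ≡ i * v → Coprime M i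
      M⊥s/v s≡ = coprime-from-primes {{M≢0}} λ pp → AtPrime.p∤M∩s/v pp max s≡

      key : ∀ i → v ≡ gcd (i * v) s → G (i * v) ≡ G v * gcd M i
      -- j = 0 belongs to v = s. Here q^0 - 1 = 0 has no valuations, but G 0 = n = m·G s and M = m
      -- because D = 1.
      key zero v≡ = trans (gcd-identityʳ n) (trans n≡m*G (trans (*-comm m (G s)) (cong₂ _*_ (cong G s≡v)
          (trans (∣-antisym (maximal ∣-refl D⊥m) M∣m) (sym (gcd-identityʳ M))))))
        where
        s≡v : s ≡ v
        s≡v = sym (trans v≡ (gcd-identityˡ s))
        D⊥m : Coprime D m
        D⊥m {x} (x∣D , _) = ∣1⇒≡1 (subst (x ∣_) D≡1 x∣D)
          where
          D≡1 : D ≡ 1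
          D≡1 = *-cancelʳ-≡ D 1 (G v) {{G-nonZero v}} (trans (sym cofactor) (trans (cong G s≡v) (sym (+-identityʳ (G v)))))
      key i@(suc _) v≡ = ∣-antisym
          (divides-from-valuations {{Gj≢0}} {{R≢0}} λ pp V W → ≤-reflexive (agree pp V W))
          (divides-from-valuations {{R≢0}} {{Gj≢0}} λ pp W V → ≤-reflexive (sym (agree pp V W)))
        where
        Gj≢0 : NonZero (G (i * v))
        Gj≢0 = G-nonZero (i * v)
        gcd≢0 : NonZero (gcd M i)
        gcd≢0 = ≢-nonZero (gcd[m,n]≢0 M i (inj₂ λ ()))
        R≢0 : NonZero (G v * gcd M i)
        R≢0 = m*n≢0 (G v) (gcd M i) {{G-nonZero v}} {{gcd≢0}}
        agree : ∀ {p a b} → Prime p → Val p (G (i * v)) a → Val p (G v * gcd M i) b → a ≡ b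
        agree {p} {a} {b} pp V W with valuation pp n | valuation pp (G s) {{G-nonZero s}} | valuation pp (G v) {{G-nonZero v}}
             | valuation pp m {{m≢0}} | valuation pp M {{M≢0}} | valuation pp i | valuation pp (gcd M i) {{gcd≢0}}
        ... | _ , VN | _ , Vs | αv , Vv | _ , Vm | ν , VM | β , Vi | γ , Vg =
              trans (AtPrime.key-valuation pp max v≡ VN Vs Vv V Vm VM Vi)
                (trans (cong (αv +_) (sym (val-gcd VM Vi Vg))) (val-unique (val-* Vv Vg) W))
          where open Valuation pp

    -- Summation over the classes gcd(j, s) = v

    module _ (D M : ℕ → ℕ) (max : ∀ v → v ∣ s → IsMax v (D v) (M v)) where

      summand : ℕ → ℕ
      summand v = G v * φ (s div v) * ∑∣ (M v) (λ t → φ t * (m div t))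

      -- The j in question are i·v with i prime to a = s/v. Expanding gcd(M v, i) over t ∣ M v
      -- leaves the number of i < a·m that are divisible by t and prime to a. It is (m/t)·φ(a),
      -- because `M⊥s/v` makes t prime to a.
      class-sum : ∀ v a → s ≡ suc a * v → .{{_ : NonZero v}} →
        ∑ (s * m) (λ j → 𝟙 (gcd j s ≟ v) * G j) ≡ summand v
      class-sum v a′ s≡ = begin
        ∑ (s * m) (λ j → 𝟙 (gcd j s ≟ v) * G j)
          ≡⟨ ∑-cong {s * m} (λ j _ → only-multiples j) ⟩
        ∑ (s * m) (λ j → 𝟙 (v ∣? j) * (𝟙 (gcd j s ≟ v) * G j))
          ≡⟨ cong (λ B → ∑ B (λ j → 𝟙 (v ∣? j) * (𝟙 (gcd j s ≟ v) * G j))) (trans (cong (_* m) s≡) (rearrange a v m)) ⟩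
        ∑ (a * m * v) (λ j → 𝟙 (v ∣? j) * (𝟙 (gcd j s ≟ v) * G j))
          ≡⟨ ∑-multiples v (a * m) (λ j → 𝟙 (gcd j s ≟ v) * G j) ⟩
        ∑ (a * m) (λ i → 𝟙 (gcd (i * v) s ≟ v) * G (i * v))
          ≡⟨ ∑-cong {a * m} (λ i _ → term i) ⟩
        ∑ (a * m) (λ i → G v * ∑∣ (M v) (λ t → φ t * (𝟙 (t ∣? i) * 𝟙 (coprime? i a))))
          ≡⟨ ∑-*ˡ {a * m} (G v) (λ i → ∑∣ (M v) (λ t → φ t * (𝟙 (t ∣? i) * 𝟙 (coprime? i a)))) ⟩
        G v * ∑ (a * m) (λ i → ∑∣ (M v) (λ t → φ t * (𝟙 (t ∣? i) * 𝟙 (coprime? i a))))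
          ≡⟨ cong (G v *_) (∑-swap {a * m} {M v} (λ i t → 𝟙 (suc t ∣? M v) * (φ (suc t) * (𝟙 (suc t ∣? i) * 𝟙 (coprime? i a))))) ⟩
        G v * ∑ (M v) (λ t → ∑ (a * m) (λ i → 𝟙 (suc t ∣? M v) * (φ (suc t) * (𝟙 (suc t ∣? i) * 𝟙 (coprime? i a)))))
          ≡⟨ cong (G v *_) (∑-cong {M v} (λ t _ → pull t)) ⟩
        G v * ∑∣ (M v) (λ t → φ t * ∑ (a * m) (λ i → 𝟙 (t ∣? i) * 𝟙 (coprime? i a)))
          ≡⟨ cong (G v *_) (∑∣-cong {M v} (λ t t∣M → cong (φ t *_) (count t t∣M))) ⟩
        G v * ∑∣ (M v) (λ t → φ t * (m div t * φ a))
          ≡⟨ cong (G v *_) (trans (∑∣-cong {M v} (λ t _ → sym (*-assoc (φ t) (m div t) (φ a))))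
               (trans (∑-cong {M v} (λ t _ → sym (*-assoc (𝟙 (suc t ∣? M v)) (φ (suc t) * (m div suc t)) (φ a))))
                 (∑-*ʳ {M v} (φ a) (λ t → 𝟙 (suc t ∣? M v) * (φ (suc t) * (m div suc t)))))) ⟩
        G v * (∑∣ (M v) (λ t → φ t * (m div t)) * φ a)
          ≡⟨ trans (cong (G v *_) (*-comm _ (φ a))) (sym (*-assoc (G v) (φ a) _)) ⟩
        G v * φ a * ∑∣ (M v) (λ t → φ t * (m div t))
          ≡⟨ cong (λ x → G v * φ x * ∑∣ (M v) (λ t → φ t * (m div t))) (trans (sym (*-div a v)) (cong (_div v) (sym s≡))) ⟩
        summand v ∎
        where
        open ≡-Reasoning
        a = suc a′
        v∣s : v ∣ s
        v∣s = divides a s≡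
        open IsMax (max v v∣s)
        rearrange : ∀ a v m → a * v * m ≡ a * m * v
        rearrange = solve-∀
        only-multiples : ∀ j → 𝟙 (gcd j s ≟ v) * G j ≡ 𝟙 (v ∣? j) * (𝟙 (gcd j s ≟ v) * G j)
        only-multiples j with v ∣? j
        ... | yes _ = sym (*-identityˡ _)
        ... | no v∤ = cong (_* G j) (𝟙-no (gcd j s ≟ v) λ e → v∤ (subst (_∣ j) e (gcd[m,n]∣m j s)))
        gcd-v : ∀ i → gcd (i * v) s ≡ v * gcd i a
        gcd-v i = trans (cong₂ gcd (*-comm i v) (trans s≡ (*-comm a v))) (sym (c*gcd[m,n]≡gcd[cm,cn] v i a))
        term : ∀ i → 𝟙 (gcd (i * v) s ≟ v) * G (i * v) ≡ G v * ∑∣ (M v) (λ t → φ t * (𝟙 (t ∣? i) * 𝟙 (coprime? i a)))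
        term i with coprime? i a
        ... | no ¬c = trans (cong (_* G (i * v)) (𝟙-no (gcd (i * v) s ≟ v) λ e → ¬c (gcd≡1⇒coprime
                (*-cancelˡ-≡ (gcd i a) 1 v (trans (sym (gcd-v i)) (trans e (sym (*-identityʳ v))))))))
              (sym (trans (cong (G v *_) (∑-zero {M v} (λ t _ → trans (cong (λ x → 𝟙 (suc t ∣? M v) * (φ (suc t) * x)) (*-zeroʳ (𝟙 (suc t ∣? i))))
                (trans (cong (𝟙 (suc t ∣? M v) *_) (*-zeroʳ (φ (suc t)))) (*-zeroʳ (𝟙 (suc t ∣? M v))))))) (*-zeroʳ (G v))))
        ... | yes c = trans (cong (_* G (i * v)) (𝟙-yes (gcd (i * v) s ≟ v) gcd≡v)) (trans (*-identityˡ _)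
              (trans (key (max v v∣s) i (sym gcd≡v)) (cong (G v *_) (trans (gcd-∑ (M v) {{M≢0}} i)
                (∑∣-cong {M v} (λ t _ → trans (*-comm (𝟙 (t ∣? i)) (φ t)) (cong (φ t *_) (sym (*-identityʳ (𝟙 (t ∣? i)))))))))))
          where
          gcd≡v : gcd (i * v) s ≡ v
          gcd≡v = trans (gcd-v i) (trans (cong (v *_) (coprime⇒gcd≡1 c)) (*-identityʳ v))
        pull : ∀ t → ∑ (a * m) (λ i → 𝟙 (suc t ∣? M v) * (φ (suc t) * (𝟙 (suc t ∣? i) * 𝟙 (coprime? i a))))
             ≡ 𝟙 (suc t ∣? M v) * (φ (suc t) * ∑ (a * m) (λ i → 𝟙 (suc t ∣? i) * 𝟙 (coprime? i a)))
        pull t = trans (∑-*ˡ {a * m} (𝟙 (suc t ∣? M v)) (λ i → φ (suc t) * (𝟙 (suc t ∣? i) * 𝟙 (coprime? i a))))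
          (cong (𝟙 (suc t ∣? M v) *_) (∑-*ˡ {a * m} (φ (suc t)) (λ i → 𝟙 (suc t ∣? i) * 𝟙 (coprime? i a))))
        count : ∀ t → t ∣ M v → ∑ (a * m) (λ i → 𝟙 (t ∣? i) * 𝟙 (coprime? i a)) ≡ m div t * φ a
        count t t∣M with ∣-trans t∣M M∣m
        ... | divides m′ m≡ = begin
          ∑ (a * m) (λ i → 𝟙 (t ∣? i) * 𝟙 (coprime? i a))
            ≡⟨ cong (λ B → ∑ B (λ i → 𝟙 (t ∣? i) * 𝟙 (coprime? i a))) (trans (cong (a *_) m≡) (rearrange′ a m′ t)) ⟩
          ∑ (m′ * a * t) (λ i → 𝟙 (t ∣? i) * 𝟙 (coprime? i a))
            ≡⟨ ∑-multiples t {{t≢0}} (m′ * a) (λ i → 𝟙 (coprime? i a)) ⟩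
          ∑ (m′ * a) (λ i → 𝟙 (coprime? (i * t) a))
            ≡⟨ ∑-cong {m′ * a} (λ i _ → 𝟙-cong (coprime? (i * t) a) (coprime? i a)
                 (λ c {d} (d∣i , d∣a) → c (∣m⇒∣m*n t d∣i , d∣a))
                 (λ c {d} (d∣it , d∣a) → c (coprime-divisor (λ {x} (x∣d , x∣t) → t⊥a (x∣t , ∣-trans x∣d d∣a))
                   (subst (d ∣_) (*-comm i t) d∣it) , d∣a))) ⟩
          ∑ (m′ * a) (λ i → 𝟙 (coprime? i a))
            ≡⟨ ∑-periodic a m′ {λ i → 𝟙 (coprime? i a)} (λ i → 𝟙-cong (coprime? (a + i) a) (coprime? i a)
                 (λ c {d} (d∣i , d∣a) → c (∣m∣n⇒∣m+n d∣a d∣i , d∣a))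
                 (λ c {d} (d∣a+i , d∣a) → c (∣m+n∣m⇒∣n d∣a+i d∣a , d∣a))) ⟩
          m′ * ∑ a (λ i → 𝟙 (coprime? i a))
            ≡⟨ cong₂ _*_ (sym (trans (cong (_div t) m≡) (*-div m′ t {{t≢0}}))) (sym (φ-∑ a)) ⟩
          m div t * φ a ∎
          where
          t≢0 : NonZero t
          t≢0 = ≢-nonZero λ e → ≢-nonZero⁻¹ (M v) {{M≢0}} (0∣⇒≡0 (subst (_∣ M v) e t∣M))
          t⊥a : Coprime t a
          t⊥a {x} (x∣t , x∣a) = M⊥s/v (max v v∣s) s≡ (∣-trans x∣t t∣M , x∣a)
          rearrange′ : ∀ a m t → a * (m * t) ≡ m * a * t
          rearrange′ = solve-∀

      total-sum : ∑ (s * m) G ≡ ∑∣ s summand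
      total-sum = begin
        ∑ (s * m) G
          ≡⟨ ∑-cong {s * m} (λ j _ → sym (expand j)) ⟩
        ∑ (s * m) (λ j → ∑ s (λ v → 𝟙 (gcd j s ≟ suc v) * G j))
          ≡⟨ ∑-swap {s * m} {s} (λ j v → 𝟙 (gcd j s ≟ suc v) * G j) ⟩
        ∑ s (λ v → ∑ (s * m) (λ j → 𝟙 (gcd j s ≟ suc v) * G j))
          ≡⟨ ∑-cong {s} (λ v _ → at-divisor v) ⟩
        ∑∣ s summand ∎
        where
        open ≡-Reasoning
        expand : ∀ j → ∑ s (λ v → 𝟙 (gcd j s ≟ suc v) * G j) ≡ G j
        expand j with gcd j s in eq
        ... | zero  = ⊥-elim (≢-nonZero⁻¹ s (gcd[m,n]≡0⇒n≡0 j eq))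
        ... | suc v = trans (∑-single {s} v (subst (_≤ s) eq (gcd[m,n]≤n j s)) others)
                (trans (cong (_* G j) (𝟙-yes (suc v ≟ suc v) refl)) (*-identityˡ (G j)))
          where
          others : ∀ i → i < s → i ≢ v → 𝟙 (suc v ≟ suc i) * G j ≡ 0
          others i _ i≢v = cong (_* G j) (𝟙-no (suc v ≟ suc i) λ e → i≢v (suc-injective (sym e)))
        at-divisor : ∀ v → ∑ (s * m) (λ j → 𝟙 (gcd j s ≟ suc v) * G j) ≡ 𝟙 (suc v ∣? s) * summand (suc v)
        at-divisor v with suc v ∣? s
        ... | no v∤ = ∑-zero {s * m} λ j _ → cong (_* G j) (𝟙-no (gcd j s ≟ suc v) λ e → v∤ (subst (_∣ s) e (gcd[m,n]∣n j s)))
        ... | yes (divides zero    eq) = ⊥-elim (≢-nonZero⁻¹ s eq)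
        ... | yes (divides (suc a) eq) = trans (class-sum (suc v) a eq) (sym (*-identityˡ _))

  -- The arithmetic functions of the statement

  -- The definitions search by `head` or `last` of a filtered list; on an increasing list these are
  -- the least and the greatest hit.
  Sorted : List ℕ → Set
  Sorted = AllPairs _<_

  sorted-upTo : ∀ n → Sorted (upTo n)
  sorted-upTo n = AllPairsₚ.applyUpTo⁺₁ (λ i → i) n (λ i<j _ → i<j)

  sorted-oneTo : ∀ n → Sorted (oneTo n)
  sorted-oneTo n = AllPairsₚ.map⁺ (AllPairsₚ.applyUpTo⁺₁ (λ i → i) n (λ i<j _ → s≤s i<j))

  sorted-divisors : ∀ n → Sorted (divisors n)
  sorted-divisors n = AllPairsₚ.filter⁺ (_∣? n) (sorted-oneTo n)

  head-least : ∀ {xs y} d → Sorted xs → y ∈ xs → fromMaybe d (head xs) ∈ xs × (∀ {z} → z ∈ xs → fromMaybe d (head xs) ≤ z)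
  head-least {x ∷ xs} d (x< ∷ _) _ = here refl , λ { (here refl) → ≤-refl ; (there z∈) → <⇒≤ (All.lookup x< z∈) }

  last-greatest : ∀ {xs y} d → Sorted xs → y ∈ xs → fromMaybe d (last xs) ∈ xs × (∀ {z} → z ∈ xs → z ≤ fromMaybe d (last xs))
  last-greatest {x ∷ []} d _ _ = here refl , λ { (here refl) → ≤-refl }
  last-greatest {x ∷ xs@(x′ ∷ _)} d (x< ∷ sorted) _ with last-greatest {xs} {x′} d sorted (here refl)
  ... | w∈ , w≥ = there w∈ , λ { (here refl) → <⇒≤ (All.lookup x< w∈) ; (there z∈) → w≥ z∈ }

  ∈-oneTo⁺ : ∀ {d N} → .{{NonZero d}} → d ≤ N → d ∈ oneTo N
  ∈-oneTo⁺ {suc d} d≤N = ∈-map⁺ suc (∈-upTo⁺ d≤N)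

  ∈-oneTo⁻ : ∀ {d N} → d ∈ oneTo N → 0 < d × d ≤ N
  ∈-oneTo⁻ d∈ with ∈-map⁻ suc d∈
  ... | i , i∈ , refl = s≤s z≤n , ∈-upTo⁻ i∈

  divisor≢0 : ∀ {d N} .{{_ : NonZero N}} → d ∣ N → NonZero d
  divisor≢0 {d} {N} d∣N = ≢-nonZero λ { refl → ≢-nonZero⁻¹ N (0∣⇒≡0 d∣N) }

  ∈-divisors⁺ : ∀ {d N} .{{_ : NonZero N}} → d ∣ N → d ∈ divisors N
  ∈-divisors⁺ {d} {N} d∣N = ∈-filter⁺ (_∣? N) (∈-oneTo⁺ {{divisor≢0 d∣N}} (∣⇒≤ d∣N)) d∣N

  ∈-divisors⁻ : ∀ {d N} → d ∈ divisors N → d ∣ N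
  ∈-divisors⁻ {d} {N} d∈ = proj₂ (∈-filter⁻ (_∣? N) {xs = oneTo N} d∈)

  module _ {ℓ} {Q : ℕ → Set ℓ} (Q? : Decidable Q) (N : ℕ) {{N≢0 : NonZero N}} where
    largestDivisor : ℕ
    largestDivisor = fromMaybe 1 (last (filter Q? (divisors N)))

    largestDivisor-spec : Q 1 → largestDivisor ∣ N × Q largestDivisor × (∀ {t} → t ∣ N → Q t → t ≤ largestDivisor)
    largestDivisor-spec Q1 = ∈-divisors⁻ {N = N} (proj₁ M∈) , proj₂ M∈ , λ t∣N Qt → proj₂ greatest (∈-filter⁺ Q? (∈-divisors⁺ t∣N) Qt)
      where
      greatest : largestDivisor ∈ filter Q? (divisors N) × (∀ {z} → z ∈ filter Q? (divisors N) → z ≤ largestDivisor)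
      greatest = last-greatest 1 (AllPairsₚ.filter⁺ Q? (sorted-divisors N)) (∈-filter⁺ Q? (∈-divisors⁺ (1∣ N)) Q1)
      M∈ : largestDivisor ∈ divisors N × Q largestDivisor
      M∈ = ∈-filter⁻ Q? {xs = divisors N} (proj₁ greatest)

    smallestDivisor : ℕ
    smallestDivisor = fromMaybe N (head (filter Q? (divisors N)))

    smallestDivisor-spec : Q N → smallestDivisor ∣ N × Q smallestDivisor × (∀ {t} → t ∣ N → Q t → smallestDivisor ≤ t)
    smallestDivisor-spec QN = ∈-divisors⁻ {N = N} (proj₁ R∈) , proj₂ R∈ , λ t∣N Qt → proj₂ least (∈-filter⁺ Q? (∈-divisors⁺ t∣N) Qt)
      where
      least : smallestDivisor ∈ filter Q? (divisors N) × (∀ {z} → z ∈ filter Q? (divisors N) → smallestDivisor ≤ z)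
      least = head-least N (AllPairsₚ.filter⁺ Q? (sorted-divisors N)) (∈-filter⁺ Q? (∈-divisors⁺ ∣-refl) QN)
      R∈ : smallestDivisor ∈ divisors N × Q smallestDivisor
      R∈ = ∈-filter⁻ Q? {xs = divisors N} (proj₁ least)

  primeDivisor? : ∀ N p → Dec (Prime p × p ∣ N)
  primeDivisor? N p = prime? p ×-dec p ∣? N

  ∈-primeDivisors⁺ : ∀ {p N} .{{_ : NonZero N}} → Prime p → p ∣ N → p ∈ primeDivisors N
  ∈-primeDivisors⁺ {p} {N} pp p∣N = ∈-filter⁺ (primeDivisor? N) (∈-oneTo⁺ {{prime⇒nonZero pp}} (∣⇒≤ p∣N)) (pp , p∣N)

  ∈-primeDivisors⁻ : ∀ {p N} → p ∈ primeDivisors N → Prime p × p ∣ N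
  ∈-primeDivisors⁻ {p} {N} p∈ = proj₂ (∈-filter⁻ (primeDivisor? N) {xs = oneTo N} p∈)

  sorted-primeDivisors : ∀ N → Sorted (primeDivisors N)
  sorted-primeDivisors N = AllPairsₚ.filter⁺ (primeDivisor? N) (sorted-oneTo N)

  n<p^n : ∀ {p} → 1 < p → ∀ n → n < p ^ n
  n<p^n {p} 1<p zero    = s≤s z≤n
  n<p^n {p} 1<p (suc n) = ≤-trans (+-mono-≤ (>-nonZero⁻¹ (p ^ n) {{m^n≢0 p n {{>-nonZero (<-trans z<s 1<p)}}}}) (n<p^n 1<p n))
    (≤-trans (≤-reflexive (cong (p ^ n +_) (sym (+-identityʳ (p ^ n))))) (*-monoˡ-≤ (p ^ n) 1<p))

  ν-val : ∀ {p m} .{{_ : NonZero m}} → Prime p → Val p m (ν p m)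
  ν-val {p} {m} pp with valuation pp m
  ... | a , V = subst (Val p m) (≤-antisym (proj₂ greatest a∈) (val-≤ V (proj₂ (∈-filter⁻ (λ a → p ^ a ∣? m) {xs = upTo (suc m)} (proj₁ greatest))))) V
    where
    open Valuation pp
    a∈ : a ∈ filter (λ a → p ^ a ∣? m) (upTo (suc m))
    -- The valuation a lies in the search range, since a < p^a ≤ m.
    a∈ = ∈-filter⁺ (λ a → p ^ a ∣? m) (∈-upTo⁺ (s≤s (<⇒≤ (≤-trans (n<p^n (nonTrivial⇒n>1 p {{prime⇒nonTrivial pp}}) a)
           (∣⇒≤ (val-divides V)))))) (val-divides V)
    greatest = last-greatest 0 (AllPairsₚ.filter⁺ (λ a → p ^ a ∣? m) (sorted-upTo (suc m))) a∈

  prime∣product : ∀ {r} → Prime r → ∀ {ps} → All Prime ps → r ∣ product ps → r ∈ ps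
  prime∣product pr [] d = ⊥-elim (prime∤1 pr d)
  prime∣product {r} pr {p ∷ ps} (pp ∷ pps) d with euclidsLemma p (product ps) pr d
  ... | inj₂ d′ = there (prime∣product pr pps d′)
  ... | inj₁ r∣p = here (prime∣^ pp pr 1 (subst (r ∣_) (sym (*-identityʳ p)) r∣p))

  if-∧-cases : ∀ {P Q : Set} (P? : Dec P) (Q? : Dec Q) (a b : ℕ) →
    ((P × Q) × (if does P? ∧ does Q? then a else b) ≡ a) ⊎ (¬ (P × Q) × (if does P? ∧ does Q? then a else b) ≡ b)
  if-∧-cases (yes p) (yes q) a b = inj₁ ((p , q) , refl)
  if-∧-cases (yes p) (no ¬q) a b = inj₂ ((λ pq → ¬q (proj₂ pq)) , refl)
  if-∧-cases (no ¬p) _       a b = inj₂ ((λ pq → ¬p (proj₁ pq)) , refl)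

  -- The numbers S_n and s_n

  module Order (n q : ℕ) {{n≢0 : NonZero n}} {{q≢0 : NonZero q}} (n⊥q : Coprime n q) where
    open PowersMinusOne q

    primeDivisors-prime : All Prime (primeDivisors n)
    primeDivisors-prime = All.tabulate λ p∈ → proj₁ (∈-primeDivisors⁻ {N = n} p∈)

    rad≢0 : NonZero (rad n)
    rad≢0 = product≢0 (All.map prime⇒nonZero primeDivisors-prime)

    prime∣rad : ∀ {p} → Prime p → p ∣ n → p ∣ rad n
    prime∣rad pp p∣n = ∈⇒∣product (∈-primeDivisors⁺ pp p∣n)

    rad⊥q^ : ∀ i → Coprime (rad n) (q ^ i)
    rad⊥q^ i = coprime-from-primes {{rad≢0}} λ pp p∣rad p∣q^ → coprime⇒prime∤ n⊥q pp
      (proj₂ (∈-primeDivisors⁻ {N = n} (prime∣product pp primeDivisors-prime p∣rad))) (prime∣^⇒∣ pp i p∣q^)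
      where
      prime∣^⇒∣ : ∀ {p} → Prime p → ∀ i → p ∣ q ^ i → p ∣ q
      prime∣^⇒∣ pp zero    d = ⊥-elim (prime∤1 pp d)
      prime∣^⇒∣ pp (suc i) d with euclidsLemma q (q ^ i) pp d
      ... | inj₁ d₀ = d₀
      ... | inj₂ d′ = prime∣^⇒∣ pp i d′

    mod-nonZero : ∀ a r .{{_ : NonZero r}} → a mod r ≡ a % r
    mod-nonZero a (suc r) = refl

    -- Two of the r + 1 powers q^0, ..., q^r agree modulo r. As r is prime to q, the smaller one
    -- cancels, and the difference of the exponents lies between 1 and r, within the range that
    -- `ord` searches.
    exponent-exists : ∀ r .{{_ : NonZero r}} → (∀ i → Coprime r (q ^ i)) → ∃ λ e → NonZero e × e ≤ r × (q ^ e) mod r ≡ 1 mod r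
    exponent-exists r r⊥q^ with Finₚ.pigeonhole (n<1+n r) (λ i → fromℕ< (m%n<n (q ^ toℕ i) r))
    ... | i , j , i<j , eq = e , >-nonZero (m<n⇒0<n∸m i<j) , ≤-trans (m∸n≤m (toℕ j) (toℕ i)) (≤-pred (Finₚ.toℕ<n j)) ,
          trans (mod-nonZero (q ^ e) r) (trans (trans (cong (_% r) (sym (*-identityʳ (q ^ e)))) (∣m∸1⇒%≡ r 0<q^e r∣P 1)) (sym (mod-nonZero 1 r)))
      where
      e = toℕ j ∸ toℕ i
      0<q^e : 0 < q ^ e
      0<q^e = >-nonZero⁻¹ (q ^ e) {{m^n≢0 q e}}
      congruent : (q ^ e * q ^ toℕ i) % r ≡ q ^ toℕ i % r
      congruent = trans (cong (_% r) (trans (sym (^-distribˡ-+-* q e (toℕ i))) (cong (q ^_) (m∸n+n≡m (<⇒≤ i<j)))))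
        (trans (sym (Finₚ.toℕ-fromℕ< (m%n<n (q ^ toℕ j) r))) (trans (cong toℕ (sym eq)) (Finₚ.toℕ-fromℕ< (m%n<n (q ^ toℕ i) r))))
      r∣P : r ∣ P e
      r∣P = coprime-divisor (r⊥q^ (toℕ i)) (subst (r ∣_) (*-comm (P e) (q ^ toℕ i)) (%≡⇒∣ r 0<q^e congruent))

    S-spec : NonZero (S n q) × rad n ∣ P (S n q)
    S-spec with exponent-exists (rad n) {{rad≢0}} rad⊥q^
    ... | e , e≢0 , e≤ , eq = >-nonZero (proj₁ (∈-oneTo⁻ {N = rad n} (proj₁ S∈))) ,
          subst (rad n ∣_) (*-identityʳ (P (S n q))) (%≡⇒∣ (rad n) {{rad≢0}} 0<q^S
            (trans (cong (λ x → _%_ x (rad n) {{rad≢0}}) (*-identityʳ (q ^ S n q)))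
              (trans (sym (mod-nonZero (q ^ S n q) (rad n) {{rad≢0}})) (trans (proj₂ S∈) (mod-nonZero 1 (rad n) {{rad≢0}})))))
      where
      good? : ∀ e → Dec ((q ^ e) mod (rad n) ≡ 1 mod (rad n))
      good? e = (q ^ e) mod (rad n) ≟ 1 mod (rad n)
      S∈ : S n q ∈ oneTo (rad n) × (q ^ S n q) mod (rad n) ≡ 1 mod (rad n)
      S∈ = ∈-filter⁻ good? {xs = oneTo (rad n)} (proj₁ (head-least 0 (AllPairsₚ.filter⁺ good? (sorted-oneTo (rad n)))
             (∈-filter⁺ good? (∈-oneTo⁺ {{e≢0}} e≤) eq)))
      0<q^S : 0 < q ^ S n q
      0<q^S = >-nonZero⁻¹ (q ^ S n q) {{m^n≢0 q (S n q)}}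

    s-cases : (((q ^ S n q) mod 4 ≡ 3 × 8 ∣ n) × s n q ≡ 2 * S n q) ⊎ (¬ ((q ^ S n q) mod 4 ≡ 3 × 8 ∣ n) × s n q ≡ S n q)
    s-cases = if-∧-cases ((q ^ S n q) mod 4 ≟ 3) (8 ∣? n) (2 * S n q) (S n q)

    S∣s : S n q ∣ s n q
    S∣s with s-cases
    ... | inj₁ (_ , eq) = subst (S n q ∣_) (sym eq) (n∣m*n 2)
    ... | inj₂ (_ , eq) = ∣-reflexive (sym eq)

    s≢0 : NonZero (s n q)
    s≢0 with s-cases
    ... | inj₁ (_ , eq) = subst NonZero (sym eq) (m*n≢0 2 (S n q) {{_}} {{proj₁ S-spec}})
    ... | inj₂ (_ , eq) = subst NonZero (sym eq) (proj₁ S-spec)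

    prime∣P-s : ∀ {p} → Prime p → p ∣ n → p ∣ q ^ s n q ∸ 1
    prime∣P-s pp p∣n = ∣-trans (prime∣rad pp p∣n) (∣-trans (proj₂ S-spec) (P-∣ S∣s))

    odd-square : ∀ y → 2 ∣ y → 4 ∣ (y + 1 + 1) * y
    odd-square y (divides k refl) = *-pres-∣ {o = 2} {p = 2} (divides (k + 1) (ring k)) (n∣m*n k)
      where
      ring : ∀ k → k * 2 + 1 + 1 ≡ (k + 1) * 2
      ring = solve-∀

    2∣P : 8 ∣ n → 2 ∣ P (S n q)
    2∣P 8∣n = ∣-trans (prime∣rad prime[2] (∣-trans (divides 4 refl) 8∣n)) (proj₂ S-spec)

    -- q^S is odd because 2 ∣ n. If it is 3 modulo 4, the exponent is doubled, and an odd square is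
    -- 1 modulo 4; otherwise it is 1 modulo 4 already.
    8∣n⇒4∣P : 8 ∣ n → 4 ∣ q ^ s n q ∸ 1
    8∣n⇒4∣P 8∣n with s-cases
    ... | inj₁ (_ , eq) = subst (λ e → 4 ∣ P e) (sym eq) (subst (4 ∣_) square (odd-square (P (S n q)) (2∣P 8∣n)))
      where
      square : (P (S n q) + 1 + 1) * P (S n q) ≡ P (2 * S n q)
      square = sym (trans (cong P (cong (S n q +_) (+-identityʳ (S n q)))) (trans (P-+ (S n q) (S n q))
        (trans (cong (λ x → P (S n q) * x + P (S n q)) (q^≡1+P (S n q))) (ring (P (S n q))))))
        where
        ring : ∀ y → y * (1 + y) + y ≡ (y + 1 + 1) * y
        ring = solve-∀
    ... | inj₂ (≢3 , eq) = subst (λ e → 4 ∣ P e) (sym eq) (from-residue (P (S n q)) (q^≡1+P (S n q)) (2∣P 8∣n))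
      where
      from-residue : ∀ y → q ^ S n q ≡ 1 + y → 2 ∣ y → 4 ∣ y
      from-residue y eq (divides k refl) with 2 ∣? k
      ... | yes (divides j refl) = divides j (*-assoc j 2 2)
      ... | no 2∤k = ⊥-elim (≢3 (trans (cong (_% 4) (trans eq (cong (λ k → 1 + k * 2) odd))) (residue-3 (k / 2)) , 8∣n))
        where
        open import Data.Nat.DivMod using ([m+kn]%n≡m%n)
        k%2≡1 : k % 2 ≡ 1
        k%2≡1 = ≤-antisym (≤-pred (m%n<n k 2)) (n≢0⇒n>0 λ e → 2∤k (m%n≡0⇒n∣m k 2 e))
        odd : k ≡ 1 + k / 2 * 2
        odd = trans (m≡m%n+[m/n]*n k 2) (cong (_+ k / 2 * 2) k%2≡1)
        residue-3 : ∀ j → (1 + (1 + j * 2) * 2) % 4 ≡ 3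
        residue-3 j = trans (cong (_% 4) (ring j)) ([m+kn]%n≡m%n 3 j 4)
          where
          ring : ∀ j → 1 + (1 + j * 2) * 2 ≡ 3 + j * 4
          ring = solve-∀

  -- Extremal divisors: m_v and r_(n,t)

  module Cofactors (n q s : ℕ) {{n≢0 : NonZero n}} {{s≢0 : NonZero s}} (1<q : 1 < q)
    (prime∣P : ∀ {p} → Prime p → p ∣ n → p ∣ q ^ s ∸ 1) (8∣n⇒4∣P : 8 ∣ n → 4 ∣ q ^ s ∸ 1) where
    open Key n q s 1<q prime∣P 8∣n⇒4∣P public

    private instance
      m≢0′ : NonZero m
      m≢0′ = m≢0

    D : ℕ → ℕ
    D v = G s div G v

    D-cofactor : ∀ {v} → v ∣ s → G s ≡ D v * G v
    D-cofactor {v} v∣s with G-∣ v∣s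
    ... | divides t eq = trans eq (cong (_* G v) (sym (trans (cong (_div G v) eq) (*-div t (G v) {{G-nonZero v}}))))

    -- The lcm of two divisors of m prime to D v is again such a divisor, so the largest one in size
    -- is a multiple of all others.
    largest⇒isMax : ∀ {v M} → v ∣ s → M ∣ m → Coprime (D v) M →
      (∀ {t} → t ∣ m → Coprime (D v) t → t ≤ M) → IsMax v (D v) M
    largest⇒isMax {v} {M} v∣s M∣m D⊥M largest = record
      { cofactor = D-cofactor v∣s
      ; M∣m      = M∣m
      ; D⊥M      = D⊥M
      ; maximal  = maximal
      }
      where
      maximal : ∀ {t} → t ∣ m → Coprime (D v) t → t ∣ M
      maximal {t} t∣m D⊥t = subst (t ∣_) lcm≡M (m∣lcm[m,n] t M)
        where
        D⊥lcm : Coprime (D v) (lcm t M)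
        D⊥lcm {x} (x∣D , x∣lcm) = D⊥M (x∣D , coprime-divisor (λ {y} (y∣x , y∣t) → D⊥t (∣-trans y∣x x∣D , y∣t))
          (∣-trans x∣lcm (lcm-least {t} {M} (m∣m*n M) (n∣m*n t))))
        lcm∣m : lcm t M ∣ m
        lcm∣m = lcm-least {t} {M} t∣m M∣m
        lcm≡M : lcm t M ≡ M
        lcm≡M = ≤-antisym (largest lcm∣m D⊥lcm) (∣⇒≤ {{divisor≢0 {N = m} lcm∣m}} (n∣lcm[m,n] t M))

    D-antitone : ∀ {ρ v} → ρ ∣ v → v ∣ s → D v ∣ D ρ
    D-antitone {ρ} {v} ρ∣v v∣s with G-∣ ρ∣v
    ... | divides t eq = divides t (trans (*-cancelʳ-≡ (D ρ) (D v * t) (G ρ) {{G-nonZero ρ}}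
            (trans (sym (D-cofactor (∣-trans ρ∣v v∣s))) (trans (D-cofactor v∣s) (trans (cong (D v *_) eq) (sym (*-assoc (D v) t (G ρ)))))))
            (*-comm (D v) t))

    -- G(gcd(ρ, v)) = gcd(G ρ, G v). At a prime divisor of t, both G ρ and G v have the full
    -- valuation of G s, and so has their gcd.
    D-gcd : ∀ {ρ v t} .{{_ : NonZero t}} → ρ ∣ s → v ∣ s → Coprime (D ρ) t → Coprime (D v) t → Coprime (D (gcd ρ v)) t
    D-gcd {ρ} {v} {t} ρ∣s v∣s cρ cv = coprime-from-primes {{D≢0}} λ {p} pp p∣D p∣t →
        at-prime pp p∣D (λ d → coprime⇒prime∤ cρ pp d p∣t) (λ d → coprime⇒prime∤ cv pp d p∣t)
      where
      γ∣s : gcd ρ v ∣ s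
      γ∣s = ∣-trans (gcd[m,n]∣m ρ v) ρ∣s
      D≢0 : NonZero (D (gcd ρ v))
      D≢0 = ≢-nonZero λ e → ≢-nonZero⁻¹ (G s) {{G-nonZero s}} (trans (D-cofactor γ∣s) (cong (_* G (gcd ρ v)) e))
      at-prime : ∀ {p} → Prime p → p ∣ D (gcd ρ v) → ¬ p ∣ D ρ → ¬ p ∣ D v → ⊥
      at-prime {p} pp p∣D p∤ρ p∤v with valuation pp (G s) {{G-nonZero s}} | valuation pp (D (gcd ρ v)) {{D≢0}} | valuation pp (G (gcd ρ v)) {{G-nonZero (gcd ρ v)}}
      ... | α , V | δ , VD | γ , W = <-irrefl (trans (trans (trans (val-gcd (full ρ∣s p∤ρ) (full v∣s p∤v) (subst (λ x → Val p x γ) (G-gcd ρ v) W))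
                  (⊓-idem α)) (val-unique V (subst (λ x → Val p x (δ + γ)) (sym (D-cofactor γ∣s)) (val-* VD W)))) refl) (m<n+m γ (val-≥1 VD p∣D))
        where
        open Valuation pp
        full : ∀ {x} → x ∣ s → ¬ p ∣ D x → Val p (G x) α
        full {x} x∣s p∤D with valuation pp (G x) {{G-nonZero x}}
        ... | α′ , V′ = subst (Val p (G x)) (sym (val-unique V (subst (λ y → Val p y α′) (sym (D-cofactor x∣s)) (val-* (val-0 p∤D) V′)))) V′

    D-s≡1 : D s ≡ 1
    D-s≡1 = *-cancelʳ-≡ (D s) 1 (G s) {{G-nonZero s}} (trans (sym (D-cofactor ∣-refl)) (sym (+-identityʳ (G s))))

    -- The key formula at v = s and i = m, where M = m, gives G(m·s) = G s·gcd(m, m) = n. It shows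
    -- that s·m is a period of multiplication by q.
    n∣P-ms : n ∣ q ^ (m * s) ∸ 1
    n∣P-ms = subst (_∣ q ^ (m * s) ∸ 1) G-ms≡n (gcd[m,n]∣n n (q ^ (m * s) ∸ 1))
      where
      m-isMax : IsMax s (D s) m
      m-isMax = record
        { cofactor = D-cofactor ∣-refl
        ; M∣m      = ∣-refl
        ; D⊥M      = λ {x} (x∣D , _) → ∣1⇒≡1 (subst (x ∣_) D-s≡1 x∣D)
        ; maximal  = λ t∣m _ → t∣m
        }
      G-ms≡n : G (m * s) ≡ n
      G-ms≡n = trans (key m-isMax m (∣-antisym (gcd-greatest (n∣m*n m) ∣-refl) (gcd[m,n]∣n (m * s) s)))
        (trans (cong (G s *_) (∣-antisym (gcd[m,n]∣m m m) (gcd-greatest ∣-refl ∣-refl))) (trans (*-comm (G s) m) (sym n≡m*G)))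

    -- By `D-gcd`, gcd(R, v) is admissible whenever v is, so leastness forces R ∣ v. Conversely,
    -- passing to a multiple only shrinks D to a divisor.
    least⇒divides : ∀ {t v R} → t ∣ m → v ∣ s → R ∣ s → Coprime (D R) t →
      (∀ {ρ} → ρ ∣ s → Coprime (D ρ) t → R ≤ ρ) → (R ∣ v → Coprime (D v) t) × (Coprime (D v) t → R ∣ v)
    least⇒divides {t} {v} {R} t∣m v∣s R∣s R-coprime least =
        (λ R∣v {x} (x∣Dv , x∣t) → R-coprime (∣-trans x∣Dv (D-antitone R∣v v∣s) , x∣t)) ,
        λ c → subst (_∣ v) (gcd≡R c) (gcd[m,n]∣n R v)
      where
      gcd≡R : Coprime (D v) t → gcd R v ≡ R
      gcd≡R c = ≤-antisym (∣⇒≤ {{divisor≢0 {N = s} R∣s}} (gcd[m,n]∣m R v))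
        (least (∣-trans (gcd[m,n]∣n R v) v∣s) (D-gcd {{divisor≢0 t∣m}} R∣s v∣s R-coprime c))

  D′ : ℕ → ℕ → ℕ → ℕ
  D′ n q v = g n q (s n q) div g n q v

  mᵥ-spec : ∀ n q v {{_ : NonZero (mm n q)}} → mᵥ n q v ∣ mm n q × Coprime (D′ n q v) (mᵥ n q v) ×
    (∀ {t} → t ∣ mm n q → Coprime (D′ n q v) t → t ≤ mᵥ n q v)
  mᵥ-spec n q v = largestDivisor-spec (λ t → coprime? (D′ n q v) t) (mm n q) (λ {x} (_ , x∣1) → ∣1⇒≡1 x∣1)

  r-least : ∀ n q t {{_ : NonZero (s n q)}} → Coprime (D′ n q (s n q)) t → r n q t ∣ s n q × Coprime (D′ n q (r n q t)) t ×
    (∀ {ρ} → ρ ∣ s n q → Coprime (D′ n q ρ) t → r n q t ≤ ρ)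
  r-least n q t = smallestDivisor-spec (λ ρ → coprime? (D′ n q ρ) t) (s n q)

  module Interface (n q σ : ℕ) {{n≢0 : NonZero n}} {{σ≢0 : NonZero σ}} (σ≡s : σ ≡ s n q) (1<q : 1 < q)
    (prime∣P : ∀ {p} → Prime p → p ∣ n → p ∣ q ^ σ ∸ 1) (8∣n⇒4∣P : 8 ∣ n → 4 ∣ q ^ σ ∸ 1) where
    open Cofactors n q σ 1<q prime∣P 8∣n⇒4∣P public

    mm≡m : mm n q ≡ m
    mm≡m = trans (cong (λ σ → n div g n q σ) (sym σ≡s)) (trans (cong (_div G σ) n≡m*G) (*-div m (G σ) {{G-nonZero σ}}))

    D′≡D : ∀ v → D′ n q v ≡ D v
    D′≡D v = cong (λ σ → g n q σ div g n q v) (sym σ≡s)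

    mᵥ-isMax : ∀ {v} → v ∣ σ → IsMax v (D v) (mᵥ n q v)
    mᵥ-isMax {v} v∣σ = convert (mᵥ n q v) (mᵥ-spec n q v {{subst NonZero (sym mm≡m) m≢0}})
      where
      convert : ∀ M → M ∣ mm n q × Coprime (D′ n q v) M × (∀ {t} → t ∣ mm n q → Coprime (D′ n q v) t → t ≤ M) → IsMax v (D v) M
      convert M (M∣mm , D⊥M , largest) = largest⇒isMax v∣σ (subst (M ∣_) mm≡m M∣mm)
        (subst (λ d → Coprime d M) (D′≡D v) D⊥M)
        (λ {t} t∣m D⊥t → largest (subst (t ∣_) (sym mm≡m) t∣m) (subst (λ d → Coprime d t) (sym (D′≡D v)) D⊥t))

    r-spec : ∀ {t v} → t ∣ m → v ∣ σ → (r n q t ∣ v → Coprime (D v) t) × (Coprime (D v) t → r n q t ∣ v)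
    r-spec {t} {v} t∣m v∣σ = convert (r n q t) (r-least n q t {{subst NonZero σ≡s σ≢0}}
        λ {x} (x∣D , _) → ∣1⇒≡1 (subst (x ∣_) (trans (D′≡D (s n q)) (trans (cong D (sym σ≡s)) D-s≡1)) x∣D))
      where
      convert : ∀ R → R ∣ s n q × Coprime (D′ n q R) t × (∀ {ρ} → ρ ∣ s n q → Coprime (D′ n q ρ) t → R ≤ ρ) →
        (R ∣ v → Coprime (D v) t) × (Coprime (D v) t → R ∣ v)
      convert R (R∣s , coprime , least) = least⇒divides t∣m v∣σ (subst (R ∣_) (sym σ≡s) R∣s) (subst (λ d → Coprime d t) (D′≡D R) coprime)
        (λ {ρ} ρ∣σ D⊥t → least (subst (ρ ∣_) σ≡s ρ∣σ) (subst (λ d → Coprime d t) (sym (D′≡D ρ)) D⊥t))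

  -- The gcd-sum function
  module _ {p : ℕ} (pp : Prime p) where
    private instance
      p≢0 : NonZero p
      p≢0 = prime⇒nonZero pp
    open Valuation pp

    coprime-*ˡ : ∀ {a N} → ¬ p ∣ N → ∀ i → Coprime i (p ^ suc a * N) → Coprime i N
    coprime-*ˡ {a} {N} _ i c {x} (x∣i , x∣N) = c (x∣i , ∣n⇒∣m*n (p ^ suc a) x∣N)

    -- Among the p^(a+1)·φ(N) indices below p^(a+1)·N that are prime to N, the multiples of p
    -- correspond to the p^a·φ(N) such indices below p^a·N. The others are those prime to p^(a+1)·N.
    φ-prime-power* : ∀ a {N} → .{{_ : NonZero N}} → ¬ p ∣ N → φ (p ^ suc a * N) ≡ p ^ a * (p ∸ 1) * φ N
    φ-prime-power* a {N} p∤N = +-cancelʳ-≡ (p ^ a * φ N) _ _ (begin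
      φ (p ^ suc a * N) + p ^ a * φ N
        ≡⟨ cong₂ _+_ (φ-∑ (p ^ suc a * N)) (cong (p ^ a *_) (φ-∑ N)) ⟩
      ∑ B (λ i → 𝟙 (coprime? i B)) + p ^ a * ∑ N (λ i → 𝟙 (coprime? i N))
        ≡⟨ cong (∑ B (λ i → 𝟙 (coprime? i B)) +_) (sym multiples) ⟩
      ∑ B (λ i → 𝟙 (coprime? i B)) + ∑ B (λ i → 𝟙 (p ∣? i) * 𝟙 (coprime? i N))
        ≡⟨ ∑-+ {B} (λ i → 𝟙 (coprime? i B)) (λ i → 𝟙 (p ∣? i) * 𝟙 (coprime? i N)) ⟨
      ∑ B (λ i → 𝟙 (coprime? i B) + 𝟙 (p ∣? i) * 𝟙 (coprime? i N))
        ≡⟨ ∑-cong {B} (λ i _ → split i) ⟩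
      ∑ B (λ i → 𝟙 (coprime? i N))
        ≡⟨ ∑-periodic N (p ^ suc a) {λ i → 𝟙 (coprime? i N)} shift-invariant ⟩
      p ^ suc a * ∑ N (λ i → 𝟙 (coprime? i N))
        ≡⟨ cong (p ^ suc a *_) (sym (φ-∑ N)) ⟩
      p * p ^ a * φ N
        ≡⟨ cong (λ x → x * p ^ a * φ N) (sym (suc-pred p)) ⟩
      suc (p ∸ 1) * p ^ a * φ N
        ≡⟨ ring (p ∸ 1) (p ^ a) (φ N) ⟩
      p ^ a * (p ∸ 1) * φ N + p ^ a * φ N ∎)
      where
      open ≡-Reasoning
      B = p ^ suc a * N
      ring : ∀ x y z → suc x * y * z ≡ y * x * z + y * z
      ring = solve-∀
      shift-invariant : ∀ i → 𝟙 (coprime? (N + i) N) ≡ 𝟙 (coprime? i N)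
      shift-invariant i = 𝟙-cong (coprime? (N + i) N) (coprime? i N)
        (λ c {d} (d∣i , d∣N) → c (∣m∣n⇒∣m+n d∣N d∣i , d∣N)) (λ c {d} (d∣N+i , d∣N) → c (∣m+n∣m⇒∣n d∣N+i d∣N , d∣N))
      p-cancel : ∀ {d i} → d ∣ N → d ∣ i * p → d ∣ i
      p-cancel {d} {i} d∣N d∣ip = coprime-divisor (λ {x} (x∣d , x∣p) → p⊥N (x∣p , ∣-trans x∣d d∣N)) (subst (d ∣_) (*-comm i p) d∣ip)
        where
        p⊥N : Coprime p N
        p⊥N = coprime-from-primes λ {r} pr r∣p r∣N → p∤N (subst (_∣ N) (prime∣^ pp pr 1 (subst (r ∣_) (sym (*-identityʳ p)) r∣p)) r∣N)
      multiples : ∑ B (λ i → 𝟙 (p ∣? i) * 𝟙 (coprime? i N)) ≡ p ^ a * ∑ N (λ i → 𝟙 (coprime? i N))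
      multiples = trans (cong (λ b → ∑ b (λ i → 𝟙 (p ∣? i) * 𝟙 (coprime? i N))) (ring′ p (p ^ a) N))
        (trans (∑-multiples p (p ^ a * N) (λ i → 𝟙 (coprime? i N)))
          (trans (∑-cong {p ^ a * N} (λ i _ → 𝟙-cong (coprime? (i * p) N) (coprime? i N)
                    (λ c {d} (d∣i , d∣N) → c (∣m⇒∣m*n p d∣i , d∣N)) (λ c {d} (d∣ip , d∣N) → c (p-cancel d∣N d∣ip , d∣N))))
            (∑-periodic N (p ^ a) {λ i → 𝟙 (coprime? i N)} shift-invariant)))
        where
        ring′ : ∀ p x N → p * x * N ≡ x * N * p
        ring′ = solve-∀
      split : ∀ i → 𝟙 (coprime? i B) + 𝟙 (p ∣? i) * 𝟙 (coprime? i N) ≡ 𝟙 (coprime? i N)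
      split i with p ∣? i
      ... | yes p∣i = cong₂ _+_ (𝟙-no (coprime? i B) λ c → prime∤1 pp (∣-reflexive (c (p∣i , ∣m⇒∣m*n N (m∣m*n (p ^ a))))))
                        (+-identityʳ (𝟙 (coprime? i N)))
      ... | no p∤i = trans (+-identityʳ _) (𝟙-cong (coprime? i B) (coprime? i N) (coprime-*ˡ {a} p∤N i) coprime-B)
        where
        coprime-B : Coprime i N → Coprime i B
        coprime-B c {x} (x∣i , x∣B) = c (x∣i , coprime-divisor (λ {y} (y∣x , y∣p^) → coprime-p^ (y∣p^ , ∣-trans y∣x x∣i)) x∣B)
          where
          coprime-p^ : Coprime (p ^ suc a) i
          coprime-p^ = coprime-from-primes {{m^n≢0 p (suc a)}} λ pr r∣p^ r∣i → p∤i (subst (_∣ i) (prime∣^ pp pr (suc a) r∣p^) r∣i)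

    -- A divisor of p^(a+1)·N divides p^a·N or is a multiple of p^(a+1).
    ∑∣-prime-power : ∀ a {N} {{N≢0 : NonZero N}} → ¬ p ∣ N → ∀ (F : ℕ → ℕ) →
      ∑∣ (p ^ suc a * N) F ≡ ∑∣ (p ^ a * N) F + ∑∣ N (λ t → F (t * p ^ suc a))
    ∑∣-prime-power a {N} {{N≢0}} p∤N F = begin
      ∑ B (λ i → 𝟙 (suc i ∣? B) * F (suc i))
        ≡⟨ ∑-cong {B} (λ i _ → split (suc i)) ⟩
      ∑ B (λ i → 𝟙 (suc i ∣? p ^ a * N) * F (suc i) + K (suc i))
        ≡⟨ ∑-+ {B} (λ i → 𝟙 (suc i ∣? p ^ a * N) * F (suc i)) (λ i → K (suc i)) ⟩
      ∑ B (λ i → 𝟙 (suc i ∣? p ^ a * N) * F (suc i)) + ∑ B (λ i → K (suc i))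
        ≡⟨ cong₂ _+_ (∑∣-extend {p ^ a * N} {{smaller≢0}} F (*-monoˡ-≤ N (m≤n*m (p ^ a) p))) multiples ⟩
      ∑∣ (p ^ a * N) F + ∑∣ N (λ t → F (t * b)) ∎
      where
      open ≡-Reasoning
      b = p ^ suc a
      B = b * N
      instance
        b≢0 : NonZero b
        b≢0 = m^n≢0 p (suc a)
        smaller≢0 : NonZero (p ^ a * N)
        smaller≢0 = m*n≢0 (p ^ a) N {{m^n≢0 p a}}
      H K : ℕ → ℕ
      H j = 𝟙 (j ∣? B) * F j
      K j = 𝟙 (b ∣? j) * H j
      val-smaller : Val p (p ^ a * N) a
      val-smaller = val refl p∤N
      b∤smaller : ¬ b ∣ p ^ a * N
      b∤smaller d = <⇒≱ (n<1+n a) (val-≤ val-smaller d)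
      smaller∣B : p ^ a * N ∣ B
      smaller∣B = divides p (*-assoc p (p ^ a) N)
      divides-smaller : ∀ t .{{_ : NonZero t}} → t ∣ B → ¬ b ∣ t → t ∣ p ^ a * N
      divides-smaller t t∣B b∤t = divides-from-valuations λ {r} {x} {y} pr V W → at-prime pr V W
        where
        at-prime : ∀ {r x y} → Prime r → Val r t x → Val r (p ^ a * N) y → x ≤ y
        at-prime {r} {x} {y} pr V W with r ≟ p
        ... | yes refl = subst (x ≤_) (val-unique val-smaller W) (≤-pred (≰⇒> λ 1+a≤x → b∤t (∣-trans (^-mono-∣ 1+a≤x) (val-divides V))))
        ... | no r≢p = Vr.val-mono t∣B V (subst (λ z → Val r z y) (sym (*-assoc p (p ^ a) N)) (Vr.val-* (Vr.val-0 r∤p) W))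
          where
          module Vr = Valuation pr
          r∤p : ¬ r ∣ p
          r∤p d = r≢p (prime∣^ pp pr 1 (subst (r ∣_) (sym (*-identityʳ p)) d))
      split : ∀ j .{{_ : NonZero j}} → 𝟙 (j ∣? B) * F j ≡ 𝟙 (j ∣? p ^ a * N) * F j + K j
      split j with j ∣? B
      ... | no ¬d = sym (cong₂ _+_ (cong (_* F j) (𝟙-no (j ∣? p ^ a * N) λ d → ¬d (∣-trans d smaller∣B))) (*-zeroʳ (𝟙 (b ∣? j))))
      ... | yes d with b ∣? j
      ...   | yes b∣j = sym (cong₂ _+_ (cong (_* F j) (𝟙-no (j ∣? p ^ a * N) λ d′ → b∤smaller (∣-trans b∣j d′))) (+-identityʳ (1 * F j)))
      ...   | no b∤j = sym (trans (cong (_+ 0) (cong (_* F j) (𝟙-yes (j ∣? p ^ a * N) (divides-smaller j d b∤j)))) (+-identityʳ (1 * F j)))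
      multiples : ∑ B (λ i → K (suc i)) ≡ ∑∣ N (λ t → F (t * b))
      multiples = begin
        ∑ B (λ i → K (suc i))
          ≡⟨ ends ⟩
        ∑ N (λ i → H (suc i * b))
          ≡⟨ ∑-cong {N} (λ i _ → cong (_* F (suc i * b)) (𝟙-cong (suc i * b ∣? B) (suc i ∣? N)
               (λ d → *-cancelʳ-∣ b (subst (suc i * b ∣_) (*-comm b N) d)) (λ d → subst (suc i * b ∣_) (*-comm N b) (*-monoˡ-∣ b d)))) ⟩
        ∑∣ N (λ t → F (t * b)) ∎
        where
        K-multiple : ∀ i → K (i * b) ≡ H (i * b)
        K-multiple i = trans (cong (_* H (i * b)) (𝟙-yes (b ∣? i * b) (n∣m*n i))) (*-identityˡ _)
        ends : ∑ B (λ i → K (suc i)) ≡ ∑ N (λ i → H (suc i * b))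
        ends = +-cancelˡ-≡ (K 0) _ _ (begin
          K 0 + ∑ B (λ i → K (suc i))         ≡⟨ ∑-last B K ⟩
          ∑ B K + K B                         ≡⟨ cong₂ _+_ (cong (λ n → ∑ n K) (*-comm b N)) (cong K (*-comm b N)) ⟩
          ∑ (N * b) K + K (N * b)             ≡⟨ cong₂ _+_ (∑-multiples b N H) (K-multiple N) ⟩
          ∑ N (λ i → H (i * b)) + H (N * b)   ≡⟨ ∑-last N (λ i → H (i * b)) ⟨
          H 0 + ∑ N (λ i → H (suc i * b))     ≡⟨ cong (_+ ∑ N (λ i → H (suc i * b))) (sym (K-multiple 0)) ⟩
          K 0 + ∑ N (λ i → H (suc i * b))     ∎)

  -- Pillai's function, the sum of gcd(M, i) over i modulo M, through its divisor sum.
  pillai : ℕ → ℕ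
  pillai M = ∑∣ M (λ t → φ t * (M div t))

  div-scale : ∀ {t M} c → .{{_ : NonZero t}} → t ∣ M → (c * M) div t ≡ c * (M div t)
  div-scale {t} {M} c (divides k refl) = trans (cong (_div t) (sym (*-assoc c k t))) (trans (*-div (c * k) t) (cong (c *_) (sym (*-div k t))))

  pillai-scale : ∀ {M} c → .{{_ : NonZero M}} → ∑∣ M (λ t → φ t * ((c * M) div t)) ≡ c * pillai M
  pillai-scale {M} c = trans (∑∣-cong {M} λ t t∣M → trans (cong (φ t *_) (div-scale c {{divisor≢0 t∣M}} t∣M)) (ring (φ t) c (M div t)))
      (trans (∑-cong {M} λ i _ → ring (𝟙 (suc i ∣? M)) c (φ (suc i) * (M div suc i))) (∑-*ˡ {M} c (λ i → 𝟙 (suc i ∣? M) * (φ (suc i) * (M div suc i)))))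
    where
    ring : ∀ x c y → x * (c * y) ≡ c * (x * y)
    ring = solve-∀

  -- Divisors of p^a·N keep their totient, and their quotient gains a factor p. The new divisors
  -- t·p^(a+1) keep the quotient N/t, and their totient is p^a·(p - 1)·φ(t).
  pillai-step : ∀ {p} (pp : Prime p) a {N} {{N≢0 : NonZero N}} → ¬ p ∣ N →
    pillai (p ^ suc a * N) ≡ p * pillai (p ^ a * N) + p ^ a * (p ∸ 1) * pillai N
  pillai-step {p} pp a {N} {{N≢0}} p∤N = begin
    ∑∣ B (λ t → φ t * (B div t))
      ≡⟨ ∑∣-prime-power pp a p∤N (λ t → φ t * (B div t)) ⟩
    ∑∣ A (λ t → φ t * (B div t)) + ∑∣ N (λ t → φ (t * p ^ suc a) * (B div (t * p ^ suc a)))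
      ≡⟨ cong₂ _+_ (trans (∑∣-cong {A} (λ t _ → cong (λ x → φ t * (x div t)) (*-assoc p (p ^ a) N))) (pillai-scale {A} p))
           (∑∣-cong {N} new) ⟩
    p * pillai A + ∑∣ N (λ t → p ^ a * (p ∸ 1) * (φ t * (N div t)))
      ≡⟨ cong (p * pillai A +_) (trans (∑-cong {N} (λ i _ → ring (𝟙 (suc i ∣? N)) (p ^ a * (p ∸ 1)) (φ (suc i) * (N div suc i))))
           (∑-*ˡ {N} (p ^ a * (p ∸ 1)) (λ i → 𝟙 (suc i ∣? N) * (φ (suc i) * (N div suc i))))) ⟩
    p * pillai A + p ^ a * (p ∸ 1) * pillai N ∎
    where
    open ≡-Reasoning
    A = p ^ a * N
    B = p ^ suc a * N
    instance
      p≢0 : NonZero p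
      p≢0 = prime⇒nonZero pp
      A≢0 : NonZero A
      A≢0 = m*n≢0 (p ^ a) N {{m^n≢0 p a}}
      b≢0 : NonZero (p ^ suc a)
      b≢0 = m^n≢0 p (suc a)
    ring : ∀ x c y → x * (c * y) ≡ c * (x * y)
    ring = solve-∀
    new : ∀ t → t ∣ N → φ (t * p ^ suc a) * (B div (t * p ^ suc a)) ≡ p ^ a * (p ∸ 1) * (φ t * (N div t))
    new t t∣N@(divides k eq) = trans (cong₂ _*_ (trans (cong φ (*-comm t (p ^ suc a))) (φ-prime-power* pp a {t} {{t≢0}} (λ d → p∤N (∣-trans d t∣N)))) quotients)
        (*-assoc (p ^ a * (p ∸ 1)) (φ t) (N div t))
      where
      t≢0 : NonZero t
      t≢0 = divisor≢0 t∣N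
      quotients : B div (t * p ^ suc a) ≡ N div t
      quotients = trans (cong (_div (t * p ^ suc a)) (trans (cong (p ^ suc a *_) eq) (ring′ (p ^ suc a) k t)))
        (trans (*-div k (t * p ^ suc a) {{m*n≢0 t (p ^ suc a) {{t≢0}}}}) (sym (trans (cong (_div t) eq) (*-div k t {{t≢0}}))))
        where
        ring′ : ∀ b k t → b * (k * t) ≡ k * (t * b)
        ring′ = solve-∀

  -- Rational arithmetic
  opaque
    ι : ℕ → ℚ
    ι a = a ÷ 1

    ι-def : ∀ a → a ÷ 1 ≡ ι a
    ι-def a = refl

    ι-toℚᵘ : ∀ a → ℚ.toℚᵘ (ι a) ℚᵘ.≃ (ℤ.+ a) ℚᵘ./ 1
    ι-toℚᵘ a = ℚₚ.toℚᵘ-fromℚᵘ (ℚᵘ.mkℚᵘ (ℤ.+ a) 0)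

    ι-1 : ι 1 ≡ 1ℚ
    ι-1 = refl

    ι-0 : ι 0 ≡ 0ℚ
    ι-0 = refl

  ι-+ : ∀ a b → ι (a + b) ≡ ι a ℚ.+ ι b
  ι-+ a b = ℚₚ.toℚᵘ-injective (ℚᵘₚ.≃-trans (ι-toℚᵘ (a + b)) (ℚᵘₚ.≃-trans step (ℚᵘₚ.≃-sym
      (ℚᵘₚ.≃-trans (ℚₚ.toℚᵘ-homo-+ (ι a) (ι b)) (ℚᵘₚ.+-cong (ι-toℚᵘ a) (ι-toℚᵘ b))))))
    where
    step : (ℤ.+ (a + b)) ℚᵘ./ 1 ℚᵘ.≃ ((ℤ.+ a) ℚᵘ./ 1) ℚᵘ.+ ((ℤ.+ b) ℚᵘ./ 1)
    step = ℚᵘ.*≡* (cong (ℤ._* ℤ.+ 1) (trans (ℤₚ.pos-+ a b) (sym (cong₂ ℤ._+_ (ℤₚ.*-identityʳ (ℤ.+ a)) (ℤₚ.*-identityʳ (ℤ.+ b))))))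

  ι-* : ∀ a b → ι (a * b) ≡ ι a ℚ.* ι b
  ι-* a b = ℚₚ.toℚᵘ-injective (ℚᵘₚ.≃-trans (ι-toℚᵘ (a * b)) (ℚᵘₚ.≃-trans step (ℚᵘₚ.≃-sym
      (ℚᵘₚ.≃-trans (ℚₚ.toℚᵘ-homo-* (ι a) (ι b)) (ℚᵘₚ.*-cong (ι-toℚᵘ a) (ι-toℚᵘ b))))))
    where
    step : (ℤ.+ (a * b)) ℚᵘ./ 1 ℚᵘ.≃ ((ℤ.+ a) ℚᵘ./ 1) ℚᵘ.* ((ℤ.+ b) ℚᵘ./ 1)
    step = ℚᵘ.*≡* (cong (ℤ._* ℤ.+ 1) (ℤₚ.pos-* a b))

  ι-÷ : ∀ a b .{{_ : NonZero b}} → ι b ℚ.* (a ÷ b) ≡ ι a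
  ι-÷ a (suc b) = ℚₚ.toℚᵘ-injective (ℚᵘₚ.≃-trans (ℚₚ.toℚᵘ-homo-* (ι (suc b)) (a ÷ suc b))
      (ℚᵘₚ.≃-trans (ℚᵘₚ.*-cong (ι-toℚᵘ (suc b)) (ℚₚ.toℚᵘ-fromℚᵘ (ℚᵘ.mkℚᵘ (ℤ.+ a) b))) (ℚᵘₚ.≃-trans step (ℚᵘₚ.≃-sym (ι-toℚᵘ a)))))
    where
    step : ((ℤ.+ suc b) ℚᵘ./ 1) ℚᵘ.* (ℚᵘ.mkℚᵘ (ℤ.+ a) b) ℚᵘ.≃ (ℤ.+ a) ℚᵘ./ 1
    step = ℚᵘ.*≡* (trans (ℤₚ.*-identityʳ _) (trans (ℤₚ.*-comm (ℤ.+ suc b) (ℤ.+ a))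
      (cong (λ x → ℤ.+ a ℤ.* ℤ.+ suc x) (sym (+-identityʳ b)))))

  1÷-inverse : ∀ b .{{_ : NonZero b}} x → (1 ÷ b) ℚ.* (ι b ℚ.* x) ≡ x
  1÷-inverse b x = trans (sym (ℚₚ.*-assoc (1 ÷ b) (ι b) x))
    (trans (cong (ℚ._* x) (trans (ℚₚ.*-comm (1 ÷ b) (ι b)) (trans (ι-÷ 1 b) ι-1))) (ℚₚ.*-identityˡ x))

  sumℚ-ι : ∀ {A : Set} c (f : A → ℚ) (h : A → ℕ) xs → (∀ {x} → x ∈ xs → c ℚ.* f x ≡ ι (h x)) →
    c ℚ.* sumℚ (map f xs) ≡ ι (sum (map h xs))
  sumℚ-ι c f h []       e = trans (ℚₚ.*-zeroʳ c) (sym ι-0)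
  sumℚ-ι c f h (x ∷ xs) e = trans (ℚₚ.*-distribˡ-+ c (f x) (sumℚ (map f xs)))
    (trans (cong₂ ℚ._+_ (e (here refl)) (sumℚ-ι c f h xs (λ x∈ → e (there x∈)))) (sym (ι-+ (h x) (sum (map h xs)))))

  eulerFactor : ℕ → ℕ → ℚ
  eulerFactor U p = 1ℚ ℚ.+ ι (ν p U) ℚ.* ((p ∸ 1) ÷ p)

  module _ where
    open import Data.Rational.Solver
    open +-*-Solver

    ℚ-step : ∀ x y u a c z → x ℚ.* (y ℚ.* (u ℚ.+ a ℚ.* c) ℚ.* z) ℚ.+ y ℚ.* (x ℚ.* c) ℚ.* z ≡ x ℚ.* y ℚ.* (u ℚ.+ (a ℚ.* c ℚ.+ c)) ℚ.* z
    ℚ-step = solve 6 (λ x y u a c z → x :* (y :* (u :+ a :* c) :* z) :+ y :* (x :* c) :* z := x :* y :* (u :+ (a :* c :+ c)) :* z) refl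

    ℚ-rearrange : ∀ x e n y → x ℚ.* e ℚ.* (n ℚ.* y) ≡ x ℚ.* n ℚ.* (e ℚ.* y)
    ℚ-rearrange = solve 4 (λ x e n y → x :* e :* (n :* y) := x :* n :* (e :* y)) refl

  -- After division by p^a the recursion of `pillai-step` adds (p - 1)/p times `pillai N` at every
  -- step, so the value is linear in a. This is the source of the factor 1 + ν·(p - 1)/p.
  pillai-prime-power : ∀ {p} (pp : Prime p) a {N} {{N≢0 : NonZero N}} → ¬ p ∣ N →
    ι (pillai (p ^ a * N)) ≡ ι (p ^ a) ℚ.* (1ℚ ℚ.+ ι a ℚ.* ((p ∸ 1) ÷ p)) ℚ.* ι (pillai N)
  pillai-prime-power {p} pp zero {N} p∤N = trans (cong (λ x → ι (pillai x)) (+-identityʳ N))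
    (trans (sym (ℚₚ.*-identityˡ (ι (pillai N)))) (cong (ℚ._* ι (pillai N)) (sym (begin
      ι 1 ℚ.* (1ℚ ℚ.+ ι 0 ℚ.* c)   ≡⟨ cong₂ (λ x y → x ℚ.* (1ℚ ℚ.+ y ℚ.* c)) ι-1 ι-0 ⟩
      1ℚ ℚ.* (1ℚ ℚ.+ 0ℚ ℚ.* c)     ≡⟨ ℚₚ.*-identityˡ _ ⟩
      1ℚ ℚ.+ 0ℚ ℚ.* c              ≡⟨ cong (1ℚ ℚ.+_) (ℚₚ.*-zeroˡ c) ⟩
      1ℚ ℚ.+ 0ℚ                    ≡⟨ ℚₚ.+-identityʳ 1ℚ ⟩
      1ℚ                           ∎))))
    where
    open ≡-Reasoning
    c = (p ∸ 1) ÷ p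
  pillai-prime-power {p} pp (suc a) {N} p∤N = begin
    ι (pillai (p ^ suc a * N))
      ≡⟨ cong ι (pillai-step pp a p∤N) ⟩
    ι (p * pillai (p ^ a * N) + p ^ a * (p ∸ 1) * pillai N)
      ≡⟨ ι-+ (p * pillai (p ^ a * N)) _ ⟩
    ι (p * pillai (p ^ a * N)) ℚ.+ ι (p ^ a * (p ∸ 1) * pillai N)
      ≡⟨ cong₂ ℚ._+_ (trans (ι-* p _) (cong (ι p ℚ.*_) (pillai-prime-power pp a p∤N)))
           (trans (ι-* (p ^ a * (p ∸ 1)) _) (cong (ℚ._* ι (pillai N)) (trans (ι-* (p ^ a) (p ∸ 1))
             (cong (ι (p ^ a) ℚ.*_) (sym (ι-÷ (p ∸ 1) p {{prime⇒nonZero pp}})))))) ⟩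
    ι p ℚ.* (ι (p ^ a) ℚ.* (1ℚ ℚ.+ ι a ℚ.* c) ℚ.* ι (pillai N)) ℚ.+ ι (p ^ a) ℚ.* (ι p ℚ.* c) ℚ.* ι (pillai N)
      ≡⟨ ℚ-step (ι p) (ι (p ^ a)) 1ℚ (ι a) c (ι (pillai N)) ⟩
    ι p ℚ.* ι (p ^ a) ℚ.* (1ℚ ℚ.+ (ι a ℚ.* c ℚ.+ c)) ℚ.* ι (pillai N)
      ≡⟨ cong₂ (λ x y → x ℚ.* (1ℚ ℚ.+ y) ℚ.* ι (pillai N)) (sym (ι-* p (p ^ a))) exponent ⟩
    ι (p ^ suc a) ℚ.* (1ℚ ℚ.+ ι (suc a) ℚ.* c) ℚ.* ι (pillai N) ∎
    where
    open ≡-Reasoning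
    c = (p ∸ 1) ÷ p
    exponent : ι a ℚ.* c ℚ.+ c ≡ ι (suc a) ℚ.* c
    exponent = trans (ℚₚ.+-comm (ι a ℚ.* c) c) (trans (cong (ℚ._+ ι a ℚ.* c) (sym (ℚₚ.*-identityˡ c)))
      (trans (sym (ℚₚ.*-distribʳ-+ c 1ℚ (ι a))) (cong (ℚ._* c) (trans (cong (ℚ._+ ι a) (sym ι-1)) (sym (ι-+ 1 a))))))

  -- The primes are split off one by one. The list is increasing, so the later primes differ from p
  -- and keep their valuations when the p-part of U is removed.
  pillai-product : ∀ ps → Sorted ps → All Prime ps → ∀ U → {{_ : NonZero U}} → (∀ {r} → Prime r → r ∣ U → r ∈ ps) →
    ι (pillai U) ≡ ι U ℚ.* prodℚ (map (eulerFactor U) ps)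
  pillai-product [] _ _ U {{U≢0}} covers = trans (cong (λ x → ι (pillai x)) U≡1) (trans pillai-1 (cong (λ x → ι x ℚ.* 1ℚ) (sym U≡1)))
    where
    U≡1 : U ≡ 1
    U≡1 with U ≟ 1
    ... | yes e = e
    ... | no U≢1 with prime-divisor (≤∧≢⇒< (>-nonZero⁻¹ U) (λ e → U≢1 (sym e)))
    ...   | r , pr , r∣U with covers pr r∣U
    ...     | ()
    pillai-1 : ι (pillai 1) ≡ ι 1 ℚ.* 1ℚ
    pillai-1 = sym (ℚₚ.*-identityʳ (ι 1))
  pillai-product (p ∷ ps) (p<ps ∷ sorted) (pp ∷ primes) U {{U≢0}} covers with valuation pp U
  ... | a , V@(val {N} eq p∤N) = begin
    ι (pillai U)
      ≡⟨ cong (λ x → ι (pillai x)) eq ⟩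
    ι (pillai (p ^ a * N))
      ≡⟨ pillai-prime-power pp a p∤N ⟩
    ι (p ^ a) ℚ.* (1ℚ ℚ.+ ι a ℚ.* ((p ∸ 1) ÷ p)) ℚ.* ι (pillai N)
      ≡⟨ cong₂ (λ x y → ι (p ^ a) ℚ.* (1ℚ ℚ.+ ι x ℚ.* ((p ∸ 1) ÷ p)) ℚ.* y) (sym ν≡a) (pillai-product ps sorted primes N covers′) ⟩
    ι (p ^ a) ℚ.* eulerFactor U p ℚ.* (ι N ℚ.* prodℚ (map (eulerFactor N) ps))
      ≡⟨ ℚ-rearrange (ι (p ^ a)) (eulerFactor U p) (ι N) (prodℚ (map (eulerFactor N) ps)) ⟩
    ι (p ^ a) ℚ.* ι N ℚ.* (eulerFactor U p ℚ.* prodℚ (map (eulerFactor N) ps))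
      ≡⟨ cong₂ (λ x y → x ℚ.* (eulerFactor U p ℚ.* y)) (trans (sym (ι-* (p ^ a) N)) (cong ι (sym eq))) (same ps p<ps primes) ⟩
    ι U ℚ.* (eulerFactor U p ℚ.* prodℚ (map (eulerFactor U) ps)) ∎
    where
    open ≡-Reasoning
    N∣U : N ∣ U
    N∣U = divides (p ^ a) eq
    instance
      N≢0 : NonZero N
      N≢0 = divisor≢0 N∣U
    ν≡a : ν p U ≡ a
    ν≡a = Valuation.val-unique pp (ν-val pp) V
    covers′ : ∀ {r} → Prime r → r ∣ N → r ∈ ps
    covers′ pr r∣N with covers pr (∣-trans r∣N N∣U)
    ... | here refl = ⊥-elim (p∤N r∣N)
    ... | there r∈  = r∈
    ν-same : ∀ {r} → Prime r → p < r → ν r N ≡ ν r U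
    ν-same {r} pr p<r = Vr.val-unique (subst (λ x → Val r x (ν r N)) (sym eq) (Vr.val-* (Vr.val-0 r∤p^a) (ν-val pr))) (ν-val pr)
      where
      module Vr = Valuation pr
      r∤p^a : ¬ r ∣ p ^ a
      r∤p^a d = <⇒≢ p<r (sym (prime∣^ pp pr a d))
    same : ∀ rs → All (p <_) rs → All Prime rs → prodℚ (map (eulerFactor N) rs) ≡ prodℚ (map (eulerFactor U) rs)
    same [] _ _ = refl
    same (r ∷ rs) (p<r ∷ p<rs) (pr ∷ prs) =
      cong₂ (λ x y → (1ℚ ℚ.+ ι x ℚ.* ((r ∸ 1) ÷ r)) ℚ.* y) (ν-same pr p<r) (same rs p<rs prs)

  sumℚ-ι₁ : ∀ {A : Set} (f : A → ℚ) (h : A → ℕ) xs → (∀ x → f x ≡ ι (h x)) → sumℚ (map f xs) ≡ ι (sum (map h xs))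
  sumℚ-ι₁ f h xs e = trans (sym (ℚₚ.*-identityˡ _)) (sumℚ-ι 1ℚ f h xs λ {x} _ → trans (ℚₚ.*-identityˡ (f x)) (e x))

  module _ where
    open import Data.Rational.Solver
    open +-*-Solver

    ℚ-pull : ∀ a b x z → a ℚ.* b ℚ.* (x ℚ.* z) ≡ a ℚ.* (b ℚ.* x) ℚ.* z
    ℚ-pull = solve 4 (λ a b x z → a :* b :* (x :* z) := a :* (b :* x) :* z) refl

    ℚ-push : ∀ c b f x → c ℚ.* b ℚ.* (f ℚ.* x) ≡ f ℚ.* (c ℚ.* (b ℚ.* x))
    ℚ-push = solve 4 (λ c b f x → c :* b :* (f :* x) := f :* (c :* (b :* x))) refl

  -- Evaluation of the two formulas

  -- The two formulas sum over the same pairs (t, v) in opposite orders: R t ∣ v is the condition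
  -- read from t, and t ∣ M v the same condition read from v.
  exchange : ∀ m σ (H F R M : ℕ → ℕ) .{{_ : NonZero m}} → (∀ {v} → v ∣ σ → M v ∣ m) →
    (∀ {t v} → t ∣ m → v ∣ σ → 𝟙 (R t ∣? v) ≡ 𝟙 (t ∣? M v)) →
    ∑∣ m (λ t → H t * ∑∣ σ (λ v → 𝟙 (R t ∣? v) * F v)) ≡ ∑∣ σ (λ v → F v * ∑∣ (M v) H)
  exchange m σ H F R M M∣m R⇔M = begin
    ∑ m (λ i → 𝟙 (suc i ∣? m) * (H (suc i) * ∑ σ (λ j → V j * (B i j * F (suc j)))))
      ≡⟨ ∑-cong {m} (λ i _ → trans (sym (*-assoc (𝟙 (suc i ∣? m)) (H (suc i)) (∑ σ (λ j → V j * (B i j * F (suc j))))))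
           (sym (∑-*ˡ {σ} (𝟙 (suc i ∣? m) * H (suc i)) (λ j → V j * (B i j * F (suc j)))))) ⟩
    ∑ m (λ i → ∑ σ (λ j → 𝟙 (suc i ∣? m) * H (suc i) * (V j * (B i j * F (suc j)))))
      ≡⟨ ∑-swap {m} {σ} (λ i j → 𝟙 (suc i ∣? m) * H (suc i) * (V j * (B i j * F (suc j)))) ⟩
    ∑ σ (λ j → ∑ m (λ i → 𝟙 (suc i ∣? m) * H (suc i) * (V j * (B i j * F (suc j)))))
      ≡⟨ ∑-cong {σ} (λ j _ → column j) ⟩
    ∑ σ (λ j → V j * (F (suc j) * ∑∣ (M (suc j)) H)) ∎
    where
    open ≡-Reasoning
    V : ℕ → ℕ
    V j = 𝟙 (suc j ∣? σ)
    B : ℕ → ℕ → ℕ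
    B i j = 𝟙 (R (suc i) ∣? suc j)
    ring : ∀ a h b f → a * h * (1 * (b * f)) ≡ f * (a * b * h)
    ring = solve-∀
    column : ∀ j → ∑ m (λ i → 𝟙 (suc i ∣? m) * H (suc i) * (V j * (B i j * F (suc j)))) ≡ V j * (F (suc j) * ∑∣ (M (suc j)) H)
    column j with suc j ∣? σ
    ... | no _ = ∑-zero {m} (λ i _ → *-zeroʳ (𝟙 (suc i ∣? m) * H (suc i)))
    ... | yes v∣σ = begin
      ∑ m (λ i → 𝟙 (suc i ∣? m) * H (suc i) * (1 * (B i j * F (suc j))))
        ≡⟨ ∑-cong {m} (λ i _ → trans (ring (𝟙 (suc i ∣? m)) (H (suc i)) (B i j) (F (suc j))) (cong (λ x → F (suc j) * (x * H (suc i))) (indicator i))) ⟩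
      ∑ m (λ i → F (suc j) * (𝟙 (suc i ∣? M (suc j)) * H (suc i)))
        ≡⟨ ∑-*ˡ {m} (F (suc j)) (λ i → 𝟙 (suc i ∣? M (suc j)) * H (suc i)) ⟩
      F (suc j) * ∑ m (λ i → 𝟙 (suc i ∣? M (suc j)) * H (suc i))
        ≡⟨ cong (F (suc j) *_) (∑∣-extend {M (suc j)} {{divisor≢0 (M∣m v∣σ)}} H (∣⇒≤ (M∣m v∣σ))) ⟩
      F (suc j) * ∑∣ (M (suc j)) H
        ≡⟨ *-identityˡ _ ⟨
      1 * (F (suc j) * ∑∣ (M (suc j)) H) ∎
      where
      indicator : ∀ i → 𝟙 (suc i ∣? m) * B i j ≡ 𝟙 (suc i ∣? M (suc j))
      indicator i with suc i ∣? m
      ... | yes t∣m = trans (*-identityˡ _) (R⇔M t∣m v∣σ)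
      ... | no t∤m  = sym (𝟙-no (suc i ∣? M (suc j)) λ t∣M → t∤m (∣-trans t∣M (M∣m v∣σ)))

  module Totals (m σ : ℕ) {{m≢0 : NonZero m}} {{σ≢0 : NonZero σ}} (F R M : ℕ → ℕ)
    (M∣m : ∀ {v} → v ∣ σ → M v ∣ m)
    (R⇔M : ∀ {t v} → t ∣ m → v ∣ σ → 𝟙 (R t ∣? v) ≡ 𝟙 (t ∣? M v)) where

    H : ℕ → ℕ
    H t = φ t * (m div t)

    total : ℕ
    total = ∑∣ σ (λ v → F v * ∑∣ (M v) H)

    ι-div : ∀ {t} → t ∣ m → ι m ≡ ι (m div t) ℚ.* ι t
    ι-div {t} t∣m@(divides k eq) = trans (cong ι eq) (trans (ι-* k t)
      (cong (λ x → ι x ℚ.* ι t) (sym (trans (cong (_div t) eq) (*-div k t {{divisor≢0 t∣m}})))))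

    Z : ℕ → ℕ
    Z t = ∑∣ σ (λ v → 𝟙 (R t ∣? v) * F v)

    -- Since t ∣ m, multiplication by m clears the denominator of φ(t)/t, and the term becomes a
    -- natural number.
    scaled-term₁ : ∀ {t} → t ∣ m → ι m ℚ.* ((φ t ÷ t) ℚ.*
      sumℚ (map (λ v → F v ÷ 1) (filter (λ v → R t ∣? v) (divisors σ)))) ≡ ι (H t * Z t)
    scaled-term₁ {t} t∣m = begin
      ι m ℚ.* ((φ t ÷ t) ℚ.* sumℚ (map (λ v → F v ÷ 1) xs))
        ≡⟨ cong₂ (λ x y → x ℚ.* ((φ t ÷ t) ℚ.* y)) (ι-div t∣m) inner ⟩
      ι (m div t) ℚ.* ι t ℚ.* ((φ t ÷ t) ℚ.* ι (Z t))
        ≡⟨ ℚ-pull (ι (m div t)) (ι t) (φ t ÷ t) (ι (Z t)) ⟩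
      ι (m div t) ℚ.* (ι t ℚ.* (φ t ÷ t)) ℚ.* ι (Z t)
        ≡⟨ cong (λ x → ι (m div t) ℚ.* x ℚ.* ι (Z t)) (ι-÷ (φ t) t {{divisor≢0 t∣m}}) ⟩
      ι (m div t) ℚ.* ι (φ t) ℚ.* ι (Z t)
        ≡⟨ cong (ℚ._* ι (Z t)) (trans (sym (ι-* (m div t) (φ t))) (cong ι (*-comm (m div t) (φ t)))) ⟩
      ι (H t) ℚ.* ι (Z t)
        ≡⟨ ι-* (H t) (Z t) ⟨
      ι (H t * Z t) ∎
      where
      open ≡-Reasoning
      xs = filter (λ v → R t ∣? v) (divisors σ)
      inner : sumℚ (map (λ v → F v ÷ 1) xs) ≡ ι (Z t)
      inner = trans (sumℚ-ι₁ (λ v → F v ÷ 1) F xs (λ v → ι-def (F v)))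
        (cong ι (trans (sum-filter (λ v → R t ∣? v) F (divisors σ)) (sum-divisors σ (λ v → 𝟙 (R t ∣? v) * F v))))

    -- m is a multiple c·M v, and M v times the product over its primes is `pillai (M v)`, so the
    -- denominators disappear here as well.
    scaled-term₂ : ∀ {v} → v ∣ σ → ι m ℚ.* ((F v ÷ 1) ℚ.*
      prodℚ (map (λ p → 1ℚ ℚ.+ ((ν p (M v) ÷ 1) ℚ.* ((p ∸ 1) ÷ p))) (primeDivisors (M v)))) ≡ ι (F v * ∑∣ (M v) H)
    scaled-term₂ {v} v∣σ = begin
      ι m ℚ.* ((F v ÷ 1) ℚ.* prodℚ (map (λ p → 1ℚ ℚ.+ ((ν p (M v) ÷ 1) ℚ.* ((p ∸ 1) ÷ p))) ps))
        ≡⟨ cong₂ (λ x y → ι m ℚ.* (x ℚ.* prodℚ y)) (ι-def (F v))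
             (map-cong (λ p → cong (λ x → 1ℚ ℚ.+ (x ℚ.* ((p ∸ 1) ÷ p))) (ι-def (ν p (M v)))) ps) ⟩
      ι m ℚ.* (ι (F v) ℚ.* prodℚ (map (eulerFactor (M v)) ps))
        ≡⟨ cong (ℚ._* (ι (F v) ℚ.* prodℚ (map (eulerFactor (M v)) ps))) (ι-div (M∣m v∣σ)) ⟩
      ι c ℚ.* ι (M v) ℚ.* (ι (F v) ℚ.* prodℚ (map (eulerFactor (M v)) ps))
        ≡⟨ ℚ-push (ι c) (ι (M v)) (ι (F v)) (prodℚ (map (eulerFactor (M v)) ps)) ⟩
      ι (F v) ℚ.* (ι c ℚ.* (ι (M v) ℚ.* prodℚ (map (eulerFactor (M v)) ps)))
        ≡⟨ cong (λ x → ι (F v) ℚ.* (ι c ℚ.* x)) (sym (pillai-product ps (sorted-primeDivisors (M v))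
             (All.tabulate λ p∈ → proj₁ (∈-primeDivisors⁻ {N = M v} p∈)) (M v) {{M≢0}} (∈-primeDivisors⁺ {{M≢0}}))) ⟩
      ι (F v) ℚ.* (ι c ℚ.* ι (pillai (M v)))
        ≡⟨ cong (ι (F v) ℚ.*_) (trans (sym (ι-* c (pillai (M v)))) (cong ι scaled)) ⟩
      ι (F v) ℚ.* ι (∑∣ (M v) H)
        ≡⟨ ι-* (F v) (∑∣ (M v) H) ⟨
      ι (F v * ∑∣ (M v) H) ∎
      where
      open ≡-Reasoning
      instance
        M≢0 : NonZero (M v)
        M≢0 = divisor≢0 (M∣m v∣σ)
      ps = primeDivisors (M v)
      c = m div M v
      scaled : c * pillai (M v) ≡ ∑∣ (M v) H
      scaled = sym (trans (∑∣-cong {M v} (λ t _ → cong (λ x → φ t * (x div t)) m≡cM)) (pillai-scale {M v} c {{M≢0}}))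
        where
        m≡cM : m ≡ c * M v
        m≡cM with M∣m v∣σ
        ... | divides k eq = trans eq (cong (_* M v) (sym (trans (cong (_div M v) eq) (*-div k (M v) {{M≢0}}))))

    normalise : ∀ {C} → total ≡ σ * m * C → ∀ X → ι m ℚ.* X ≡ ι total → (1 ÷ σ) ℚ.* X ≡ ι C
    normalise {C} total≡ X e = begin
      (1 ÷ σ) ℚ.* X                              ≡⟨ cong ((1 ÷ σ) ℚ.*_) (sym (1÷-inverse m X)) ⟩
      (1 ÷ σ) ℚ.* ((1 ÷ m) ℚ.* (ι m ℚ.* X))      ≡⟨ cong (λ x → (1 ÷ σ) ℚ.* ((1 ÷ m) ℚ.* x)) (trans e expand) ⟩
      (1 ÷ σ) ℚ.* ((1 ÷ m) ℚ.* (ι m ℚ.* (ι σ ℚ.* ι C)))  ≡⟨ cong ((1 ÷ σ) ℚ.*_) (1÷-inverse m (ι σ ℚ.* ι C)) ⟩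
      (1 ÷ σ) ℚ.* (ι σ ℚ.* ι C)                  ≡⟨ 1÷-inverse σ (ι C) ⟩
      ι C                                        ∎
      where
      open ≡-Reasoning
      rearrange : ∀ a b c → a * b * c ≡ b * (a * c)
      rearrange = solve-∀
      expand : ι total ≡ ι m ℚ.* (ι σ ℚ.* ι C)
      expand = trans (cong ι (trans total≡ (rearrange σ m C))) (trans (ι-* m (σ * C)) (cong (ι m ℚ.*_) (ι-* σ C)))

    value₁ : ∀ {C} → total ≡ σ * m * C → (1 ÷ σ) ℚ.* sumℚ (map (λ t → (φ t ÷ t) ℚ.*
      sumℚ (map (λ v → F v ÷ 1) (filter (λ v → R t ∣? v) (divisors σ)))) (divisors m)) ≡ ι C
    value₁ total≡ = normalise total≡ _ (trans (sumℚ-ι (ι m) _ (λ t → H t * Z t) (divisors m) (λ t∈ → scaled-term₁ (∈-divisors⁻ {N = m} t∈)))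
      (cong ι (trans (sum-divisors m (λ t → H t * Z t)) (exchange m σ H F R M M∣m R⇔M))))

    value₂ : ∀ {C} → total ≡ σ * m * C → (1 ÷ σ) ℚ.* sumℚ (map (λ v → (F v ÷ 1) ℚ.*
      prodℚ (map (λ p → 1ℚ ℚ.+ ((ν p (M v) ÷ 1) ℚ.* ((p ∸ 1) ÷ p))) (primeDivisors (M v)))) (divisors σ)) ≡ ι C
    value₂ total≡ = normalise total≡ _ (trans (sumℚ-ι (ι m) _ (λ v → F v * ∑∣ (M v) H) (divisors σ) (λ v∈ → scaled-term₂ (∈-divisors⁻ {N = σ} v∈)))
      (cong ι (sum-divisors σ (λ v → F v * ∑∣ (M v) H))))

  module Formulas (n q σ : ℕ) {{n≢0 : NonZero n}} {{σ≢0 : NonZero σ}} (σ≡s : σ ≡ s n q) (1<q : 1 < q)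
    (prime∣P : ∀ {p} → Prime p → p ∣ n → p ∣ q ^ σ ∸ 1) (8∣n⇒4∣P : 8 ∣ n → 4 ∣ q ^ σ ∸ 1) where
    open Interface n q σ σ≡s 1<q prime∣P 8∣n⇒4∣P public

    F : ℕ → ℕ
    F v = g n q v * φ (σ div v)

    -- Both conditions say that t is prime to D v: `r-spec` shows it for the first, the maximality
    -- of m_v for the second.
    r∣v⇔t∣M : ∀ {t v} → t ∣ m → v ∣ σ → 𝟙 (r n q t ∣? v) ≡ 𝟙 (t ∣? mᵥ n q v)
    r∣v⇔t∣M {t} {v} t∣m v∣σ = equivalent (r n q t) (mᵥ n q v) (mᵥ-isMax v∣σ) (r-spec t∣m v∣σ)
      where
      equivalent : ∀ R M → IsMax v (D v) M → (R ∣ v → Coprime (D v) t) × (Coprime (D v) t → R ∣ v) → 𝟙 (R ∣? v) ≡ 𝟙 (t ∣? M)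
      equivalent R M max (to , from) = 𝟙-cong (R ∣? v) (t ∣? M) (λ d → maximal t∣m (to d))
          (λ t∣M → from (λ {x} (x∣D , x∣t) → D⊥M (x∣D , ∣-trans x∣t t∣M)))
        where open IsMax max

    module TotalsFor (R M : ℕ → ℕ) (isMax : ∀ v → v ∣ σ → IsMax v (D v) (M v))
      (R⇔M : ∀ {t v} → t ∣ m → v ∣ σ → 𝟙 (R t ∣? v) ≡ 𝟙 (t ∣? M v)) where
      open Totals m σ {{m≢0}} F R M (λ {v} v∣σ → IsMax.M∣m (isMax v v∣σ)) R⇔M public

      total≡ : ∀ {C} → ∑ (σ * m) G ≡ σ * m * C → total ≡ σ * m * C
      total≡ e = trans (sym (total-sum D M isMax)) e

    module T = TotalsFor (r n q) (mᵥ n q) (λ v → mᵥ-isMax {v}) r∣v⇔t∣M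

    formula₁-value : ∀ {C} → ∑ (σ * m) G ≡ σ * m * C → C ÷ 1 ≡ formula₁ n q
    formula₁-value {C} e = trans (ι-def C) (trans (sym (T.value₁ (T.total≡ e))) (cong₂ f σ≡s (sym mm≡m)))
      where
      f : ℕ → ℕ → ℚ
      f σ m = (1 ÷ σ) ℚ.* sumℚ (map (λ t → (φ t ÷ t) ℚ.*
        sumℚ (map (λ v → (g n q v * φ (σ div v)) ÷ 1) (filter (λ v → r n q t ∣? v) (divisors σ)))) (divisors m))

    formula₂-value : ∀ {C} → ∑ (σ * m) G ≡ σ * m * C → C ÷ 1 ≡ formula₂ n q
    formula₂-value {C} e = trans (ι-def C) (trans (sym (T.value₂ (T.total≡ e))) (cong f σ≡s))
      where
      f : ℕ → ℚ
      f σ = (1 ÷ σ) ℚ.* sumℚ (map (λ v → ((g n q v * φ (σ div v)) ÷ 1) ℚ.*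
        prodℚ (map (λ p → 1ℚ ℚ.+ ((ν p (mᵥ n q v) ÷ 1) ℚ.* ((p ∸ 1) ÷ p))) (primeDivisors (mᵥ n q v)))) (divisors σ))

-- Frobenius on polynomials over F

module Characteristic {c ℓ : Level} {q : ℕ} (F : FiniteField c ℓ q)
  {p a : ℕ} (p-prime : Prime p) (q≡p^a : q ≡ p ℕ.^ a) where
  open Berlekamp F
  open import Algebra.Properties.Semiring.Exp semiring
  open import Algebra.Properties.Semiring.Sum semiring using (sum; sum-cong-≋)
  import Algebra.Properties.Semiring.Mult F.semiring as FMult
  import Algebra.Properties.Semiring.Mult semiring as Mult

  -- q·1 = 0 is the a-th power of p·1, and a field has no zero divisors.
  char-F : p FMult.× F.1# F.≈ F.0#
  char-F = descend a (subst (λ m → m FMult.× F.1# F.≈ F.0#) q≡p^a F.size·1≈0)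
    where
    descend : ∀ b → (p ℕ.^ b) FMult.× F.1# F.≈ F.0# → p FMult.× F.1# F.≈ F.0#
    descend zero    e = ⊥-elim (F.0≉1 (F.sym (F.trans (F.sym (F.+-identityʳ _)) e)))
    descend (suc b) e with p FMult.× F.1# F.≟ F.0#
    ... | yes z = z
    ... | no ≉0 = descend b (F.cancel-nonzero ≉0 (F.trans (F.sym (FMult.×1-homo-* p (p ℕ.^ b))) e))

  char : p Mult.× 1# ≈ 0#
  char = trans (mult-1 p) (trans (const-cong char-F) (wrap λ { zero → F.refl ; (suc i) → F.refl }))
    where
    mult-1 : ∀ m → m Mult.× 1# ≈ constₚ (m FMult.× F.1#)
    mult-1 zero    = wrap λ { zero → F.refl ; (suc i) → F.refl }
    mult-1 (suc m) = trans (+-congˡ (mult-1 m)) (wrap λ i → F.trans (coeff-+ 1# (constₚ (m FMult.× F.1#)) i) (rest i))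
      where
      rest : ∀ i → coeff 1# i F.+ coeff (constₚ (m FMult.× F.1#)) i F.≈ coeff (constₚ (suc m FMult.× F.1#)) i
      rest zero    = F.refl
      rest (suc i) = F.+-identityˡ _

  frobenius : ∀ {m} (v : Fin m → Poly) → sum v ^ q ≈ sum (λ i → v i ^ q)
  frobenius v = subst (λ r → sum v ^ r ≈ sum (λ i → v i ^ r)) (≡.sym q≡p^a)
    (Frobenius.frobenius-sum polynomialRing p-prime char a v)

-- The fixed elements modulo f(X^n)

module OrbitCoordinates {c ℓ : Level} {q : ℕ} (F : FiniteField c ℓ q)
  {p a : ℕ} (p-prime : Prime p) (q≡p^a : q ≡ p ℕ.^ a)
  (n : ℕ) {{n≢0 : ℕ.NonZero n}} where
  open Substitution F n
  open Characteristic F {p} {a} p-prime q≡p^a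

  module _ {f : Poly} {k e w u′ T C : ℕ} (irr : Irreducible f) (D : Degree f k)
    (f∣X^e-1 : f ∣ X ^ suc e - 1#)
    (u-eq : 1 ℕ.+ n ℕ.* w ≡ suc e ℕ.* u′)
    (π : Permutation n n) (π-mod : ∀ i → toℕ (π ⟨$⟩ʳ i) ≡ (q ℕ.* toℕ i) % n)
    (orbits : OrbitSpace (π ⟨$⟩ʳ_) C)
    (period : ∀ i → iterate (π ⟨$⟩ʳ_) T i ≡ i) (k⊥T : Coprime k T) where

    open OrbitSpace orbits

    σ : Fin n → Fin n
    σ = π ⟨$⟩ʳ_

    h : Poly
    h = E f

    module K where
      open ResidueField irr D public
      open FieldTheory residueField using (fermat) public
    module H = Quotient polynomialRing h

    toF : ∀ {x y} → f ∣ x - y → x K.≡ₘ y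
    toF {x} {y} (divs {t} eq) = K.mod {multiplier = t} (trans (solve 2 (λ x y → x := y :+ (x :- y)) refl x y) (+-congˡ (sym eq)))

    toH : ∀ {x y} → h ∣ x - y → x H.≡ₘ y
    toH {x} {y} (divs {t} eq) = H.mod {multiplier = t} (trans (solve 2 (λ x y → x := y :+ (x :- y)) refl x y) (+-congˡ (sym eq)))

    fromH : ∀ {x y} → x H.≡ₘ y → h ∣ x - y
    fromH {x} {y} (H.mod {t} eq) = divs {quot = t} (sym (trans (+-congʳ eq) (solve 2 (λ y u → (y :+ u) :- y := u) refl y (h * t))))

    ∣⇔≡0 : ∀ {x} → h ∣ x → x H.≡ₘ 0#
    ∣⇔≡0 (divs {t} eq) = H.mod {multiplier = t} (trans (sym eq) (sym (+-identityˡ _)))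

    ≡0⇒∣ : ∀ {x} → x H.≡ₘ 0# → h ∣ x
    ≡0⇒∣ (H.mod {t} eq) = divs {quot = t} (sym (trans eq (+-identityˡ _)))

    X^e≡1 : ∀ m → X ^ (suc e ℕ.* m) K.≡ₘ 1#
    X^e≡1 m = K.≡ₘ-trans (K.≈⇒≡ₘ (sym (^-assocʳ X (suc e) m))) (K.≡ₘ-trans (K.^-≡ₘ m (toF f∣X^e-1)) (K.≈⇒≡ₘ (1^ m)))
      where
      1^ : ∀ m → 1# ^ m ≈ 1#
      1^ zero    = refl
      1^ (suc m) = trans (*-identityˡ _) (1^ m)

    X^ne≡1 : ∀ m → X ^ (n ℕ.* (suc e ℕ.* m)) H.≡ₘ 1#
    X^ne≡1 m = toH (∣-resp (trans (E-- (X ^ (suc e ℕ.* m)) 1#) (+-cong (E-X^ (suc e ℕ.* m)) (-‿cong (E-const F.1#))))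
                 (E-∣ (K.≡ₘ⇒∣ (X^e≡1 m))))

    u : ℕ
    u = 1 ℕ.+ n ℕ.* w

    -- z is an n-th root of unity modulo h, and X^n · E(F[X]) contains X/z.
    z : Poly
    z = X ^ u

    z^n≡1 : ∀ m → z ^ (n ℕ.* m) H.≡ₘ 1#
    z^n≡1 m = H.≡ₘ-trans (H.≈⇒≡ₘ (trans (^-assocʳ X u (n ℕ.* m)) (^-congʳ X exponent))) (X^ne≡1 (u′ ℕ.* m))
      where
      open import Algebra.Properties.CommutativeSemigroup ℕₚ.*-commutativeSemigroup using (x∙yz≈y∙xz)
      exponent : u ℕ.* (n ℕ.* m) ≡ n ℕ.* (suc e ℕ.* (u′ ℕ.* m))
      exponent = ≡.trans (x∙yz≈y∙xz u n m) (cong (n ℕ.*_) (≡.trans (cong (ℕ._* m) u-eq) (ℕₚ.*-assoc (suc e) u′ m)))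

    z^-mod : ∀ m → z ^ m H.≡ₘ z ^ (m % n)
    z^-mod m = H.≡ₘ-trans (H.≈⇒≡ₘ (trans (^-congʳ z exponent) (^-homo-* z (m % n) (n ℕ.* (m / n)))))
                 (H.≡ₘ-trans (H.*-≡ₘ H.Q.refl (z^n≡1 (m / n))) (H.≈⇒≡ₘ (*-identityʳ _)))
      where
      exponent : m ≡ m % n ℕ.+ n ℕ.* (m / n)
      exponent = ≡.trans (m≡m%n+[m/n]*n m n) (cong (m % n ℕ.+_) (ℕₚ.*-comm (m / n) n))

    -- An element of K[z]/(z^n - 1): the polynomials dᵢ represent coefficients in K = F[X]/f, which
    -- `E` embeds modulo h.
    combination : (Fin n → Poly) → Poly
    combination d = sum (λ i → E (d i) * z ^ toℕ i)

    InSpan : Poly → Set (c ⊔ ℓ)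
    InSpan b = ∃ λ d → b H.≡ₘ combination d

    span-resp : ∀ {b b′} → b ≈ b′ → InSpan b → InSpan b′
    span-resp eq (d , b≡) = d , H.≡ₘ-trans (H.≈⇒≡ₘ (sym eq)) b≡

    span-+ : ∀ {b b′} → InSpan b → InSpan b′ → InSpan (b + b′)
    span-+ (d , b≡) (d′ , b≡′) = (λ i → d i + d′ i) , H.≡ₘ-trans (H.+-≡ₘ b≡ b≡′) (H.≈⇒≡ₘ (sym (trans
      (sum-cong-≋ {n} (λ i → trans (*-congʳ (E-+ (d i) (d′ i))) (distribʳ _ _ _)))
      (∑-distrib-+ {n} (λ i → E (d i) * z ^ toℕ i) (λ i → E (d′ i) * z ^ toℕ i)))))

    span-monomial : ∀ x m → InSpan (constₚ x * X ^ m)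
    span-monomial x m = d , H.≡ₘ-trans monomial≡ (H.≈⇒≡ₘ (sym single))
      where
      t : ℕ
      -- z^m = X^m·X^(nwm), and X^(n·(e+1)) = 1 modulo h turns the inverse of X^(nwm) into X^(n·t).
      -- The order of f is e + 1 here.
      t = e ℕ.* w ℕ.* m
      m₀ : Fin n
      m₀ = Fin.fromℕ< (m%n<n m n)
      d : Fin n → Poly
      d i with i Fin.≟ m₀
      ... | yes _ = constₚ x * X ^ t
      ... | no  _ = 0#
      d-same : d m₀ ≡ constₚ x * X ^ t
      d-same with m₀ Fin.≟ m₀
      ... | yes _ = ≡.refl
      ... | no  b = ⊥-elim (b ≡.refl)
      d-other : ∀ i → i ≢ m₀ → d i ≡ 0#
      d-other i i≢m₀ with i Fin.≟ m₀
      ... | yes b = ⊥-elim (i≢m₀ b)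
      ... | no  _ = ≡.refl
      single : combination d ≈ constₚ x * X ^ (n ℕ.* t) * z ^ (m % n)
      single = trans (sum-single _ m₀ λ i i≢m₀ → trans (*-congʳ (E-zero (d i) (reflexive (d-other i i≢m₀)))) (zeroˡ _))
        (*-cong (trans (E-cong (reflexive d-same)) (trans (E-const* x (X ^ t)) (*-congˡ (E-X^ t))))
          (reflexive (cong (z ^_) (Finₚ.toℕ-fromℕ< (m%n<n m n)))))
      exponent : u ℕ.* m ℕ.+ n ℕ.* t ≡ m ℕ.+ n ℕ.* (suc e ℕ.* (w ℕ.* m))
      exponent = distribute n w m e
        where
        distribute : ∀ n w m e → (1 ℕ.+ n ℕ.* w) ℕ.* m ℕ.+ n ℕ.* (e ℕ.* w ℕ.* m) ≡ m ℕ.+ n ℕ.* (suc e ℕ.* (w ℕ.* m))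
        distribute = solve-∀
      monomial≡ : constₚ x * X ^ m H.≡ₘ constₚ x * X ^ (n ℕ.* t) * z ^ (m % n)
      monomial≡ = begin
        constₚ x * X ^ m
          ≈⟨ H.≈⇒≡ₘ (*-congˡ (sym (*-identityʳ _))) ⟩
        constₚ x * (X ^ m * 1#)
          ≈⟨ H.*-≡ₘ H.Q.refl (H.*-≡ₘ H.Q.refl (H.≡ₘ-sym (X^ne≡1 (w ℕ.* m)))) ⟩
        constₚ x * (X ^ m * X ^ (n ℕ.* (suc e ℕ.* (w ℕ.* m))))
          ≈⟨ H.≈⇒≡ₘ (*-congˡ (trans (sym (^-homo-* X m _)) (trans (^-congʳ X (≡.sym exponent)) (^-homo-* X (u ℕ.* m) (n ℕ.* t))))) ⟩
        constₚ x * (X ^ (u ℕ.* m) * X ^ (n ℕ.* t))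
          ≈⟨ H.*-≡ₘ H.Q.refl (H.*-≡ₘ (H.≡ₘ-trans (H.≈⇒≡ₘ (sym (^-assocʳ X u m))) (z^-mod m)) H.Q.refl) ⟩
        constₚ x * (z ^ (m % n) * X ^ (n ℕ.* t))
          ≈⟨ H.≈⇒≡ₘ (trans (*-congˡ (*-comm _ _)) (sym (*-assoc _ _ _))) ⟩
        constₚ x * X ^ (n ℕ.* t) * z ^ (m % n) ∎
        where open import Relation.Binary.Reasoning.Setoid H.Q.setoid

    opaque
      span : ∀ b → InSpan b
      span b = span-resp (*-identityˡ b) (shifted 0 b)
        where
        shifted : ∀ m b → InSpan (X ^ m * b)
        shifted m [] = (λ _ → 0#) , H.≈⇒≡ₘ (trans (zeroʳ _) (sym (trans
          (sum-cong-≋ {n} (λ i → zeroˡ _)) (sum-replicate-zero n))))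
        shifted m (x ∷ b) = span-resp (sym (trans (*-congˡ (cons x b))
            (solve 4 (λ y x X b → y :* (x :+ X :* b) := x :* y :+ (X :* y) :* b) refl (X ^ m) (constₚ x) X b)))
          (span-+ (span-monomial x m) (shifted (suc m) b))

    -- X is invertible modulo f: multiplying further by X^(e·m) completes X^m to a power of X^(e+1),
    -- which is 1.
    X^-cancel : ∀ m {d} → f ∣ d * X ^ m → f ∣ d
    X^-cancel m {d} f∣ = ∣-resp (solve 2 (λ d x → d :* x :- (d :* x :- d) := d) refl d (X ^ (suc e ℕ.* m)))
        (∣-+ f∣′ (∣-neg (K.≡ₘ⇒∣ (K.≡ₘ-trans (K.*-≡ₘ K.Q.refl (X^e≡1 m)) (K.≈⇒≡ₘ (*-identityʳ d))))))
      where
      f∣′ : f ∣ d * X ^ (suc e ℕ.* m)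
      f∣′ = ∣-resp (trans (*-assoc d _ _) (*-congˡ (sym (^-homo-* X m (e ℕ.* m))))) (∣-*ʳ (X ^ (e ℕ.* m)) f∣)

    -- z^i is X^i times X^(nwi) = E(X^(wi)), so the j-th component of the combination is d_j·X^(wj).
    -- The j-th component of a multiple of h = E f is a multiple of f, and X^(wj) cancels modulo f.
    independent : ∀ d → h ∣ combination d → ∀ j → f ∣ d j
    independent d (divs {t} eq) j = X^-cancel (w ℕ.* toℕ j) (divs {quot = component (toℕ j) t} (begin
      f * component (toℕ j) t                       ≈⟨ component-E* j<n f t ⟨
      component (toℕ j) (h * t)                     ≈⟨ component-cong (toℕ j) eq ⟩
      component (toℕ j) (combination d)             ≈⟨ component-sum (toℕ j) (λ i → E (d i) * z ^ toℕ i) ⟩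
      sum (λ i → component (toℕ j) (E (d i) * z ^ toℕ i))
        ≈⟨ sum-cong-≋ (λ i → trans (component-cong (toℕ j) (term i)) (component-E* j<n (d i * X ^ (w ℕ.* toℕ i)) (X ^ toℕ i))) ⟩
      sum (λ i → d i * X ^ (w ℕ.* toℕ i) * component (toℕ j) (X ^ toℕ i))
        ≈⟨ sum-single _ j (λ i i≢j → trans (*-congˡ (component-X^-other j<n (Finₚ.toℕ<n i)
             (λ eq → i≢j (≡.sym (Finₚ.toℕ-injective eq))))) (zeroʳ _)) ⟩
      d j * X ^ (w ℕ.* toℕ j) * component (toℕ j) (X ^ toℕ j)
        ≈⟨ trans (*-congˡ (component-X^-same {toℕ j})) (*-identityʳ _) ⟩
      d j * X ^ (w ℕ.* toℕ j)                       ∎))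
      where
      open import Relation.Binary.Reasoning.Setoid setoid
      j<n : toℕ j ℕ.< n
      j<n = Finₚ.toℕ<n j
      exponent : ∀ i → u ℕ.* i ≡ n ℕ.* (w ℕ.* i) ℕ.+ i
      exponent i = ≡.trans (ℕₚ.+-comm i _) (cong (ℕ._+ i) (ℕₚ.*-assoc n w i))
      term : ∀ i → E (d i) * z ^ toℕ i ≈ E (d i * X ^ (w ℕ.* toℕ i)) * X ^ toℕ i
      term i = begin
        E (d i) * z ^ toℕ i
          ≈⟨ *-congˡ (trans (^-assocʳ X u (toℕ i)) (trans (^-congʳ X (exponent (toℕ i))) (^-homo-* X (n ℕ.* (w ℕ.* toℕ i)) (toℕ i)))) ⟩
        E (d i) * (X ^ (n ℕ.* (w ℕ.* toℕ i)) * X ^ toℕ i)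
          ≈⟨ *-assoc _ _ _ ⟨
        E (d i) * X ^ (n ℕ.* (w ℕ.* toℕ i)) * X ^ toℕ i
          ≈⟨ *-congʳ (trans (*-congˡ (sym (E-X^ (w ℕ.* toℕ i)))) (sym (E-* (d i) _))) ⟩
        E (d i * X ^ (w ℕ.* toℕ i)) * X ^ toℕ i ∎

    -- Frobenius carries z^i to z^(σ i), so a q-th power appears naturally with its basis elements
    -- permuted.
    permuted : (Fin n → Poly) → Poly
    permuted d = sum (λ i → E (d i) * z ^ toℕ (σ i))

    combination-permuted : ∀ d → combination d ≈ permuted (λ i → d (σ i))
    combination-permuted d = sum-permute (λ i → E (d i) * z ^ toℕ i) π

    permuted-independent : ∀ d → h ∣ permuted d → ∀ i → f ∣ d i
    permuted-independent d h∣ i = subst (λ j → f ∣ d j) (inverseˡ π)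
      (independent (λ j → d (π ⟨$⟩ˡ j)) (∣-resp (sym (trans (combination-permuted _)
        (sum-cong-≋ {n} (λ i → *-congʳ (reflexive (cong (λ j → E (d j)) (inverseˡ π))))))) h∣) (σ i))

    combination-^q : ∀ d → combination d ^ q H.≡ₘ permuted (λ i → d i ^ q)
    combination-^q d = H.≡ₘ-trans (H.≈⇒≡ₘ (frobenius (λ i → E (d i) * z ^ toℕ i))) (H.sum-≡ₘ λ i →
      H.≡ₘ-trans (H.≈⇒≡ₘ (trans (^-distrib-* _ _ q) (*-cong (sym (E-^ (d i) q)) (trans (^-assocʳ z (toℕ i) q)
          (^-congʳ z (ℕₚ.*-comm (toℕ i) q))))))
        (H.*-≡ₘ H.Q.refl (H.≡ₘ-trans (z^-mod (q ℕ.* toℕ i)) (H.≈⇒≡ₘ (^-congʳ z (≡.sym (π-mod i)))))))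

    permuted-- : ∀ d d′ → permuted (λ i → d i - d′ i) ≈ permuted d - permuted d′
    permuted-- d d′ = x≈y-z (trans (sym (∑-distrib-+ {n} (λ i → E (d i - d′ i) * z ^ toℕ (σ i)) (λ i → E (d′ i) * z ^ toℕ (σ i))))
        (sum-cong-≋ {n} (λ i → trans (sym (distribʳ _ _ _)) (*-congʳ (trans (+-congʳ (E-- (d i) (d′ i)))
          (solve 2 (λ x y → (x :- y) :+ y := x) refl (E (d i)) (E (d′ i))))))))
      where
      x≈y-z : ∀ {x y t} → x + t ≈ y → x ≈ y - t
      x≈y-z {x} {y} {t} eq = trans (solve 2 (λ x t → x := (x :+ t) :- t) refl x t) (+-congʳ eq)

    prime-^ : ∀ m {x} → f ∣ x ^ m → f ∣ x
    prime-^ zero    d = ⊥-elim (irreducible∤1 irr d)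
    prime-^ (suc m) d with irreducible-prime irr _ _ d
    ... | inj₁ d₀ = d₀
    ... | inj₂ d′ = prime-^ m d′

    -- If h ∣ b^q, independence gives f ∣ dᵢ^q for the coefficients of b. As f is prime, f ∣ dᵢ, so
    -- b vanishes modulo h.
    reduced : Reduced h
    reduced b h∣b^q with span b
    ... | d , b≡ = ≡0⇒∣ (H.≡ₘ-trans b≡ (H.≡ₘ-trans (H.sum-≡ₘ λ i → ∣⇔≡0 (∣-*ʳ (z ^ toℕ i) (E-∣ (divides i))))
                     (H.≈⇒≡ₘ (sum-replicate-zero n))))
      where
      divides : ∀ i → f ∣ d i
      divides i = prime-^ q (permuted-independent (λ i → d i ^ q)
        (≡0⇒∣ (H.≡ₘ-trans (H.≡ₘ-sym (combination-^q d)) (H.≡ₘ-trans (H.^-≡ₘ q (H.≡ₘ-sym b≡)) (∣⇔≡0 h∣b^q)))) i)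

    scalars : (Fin n → F.Carrier) → Poly
    scalars x = sum (λ i → constₚ (x i) * z ^ toℕ i)

    combination-const : ∀ x → combination (λ i → constₚ (x i)) ≈ scalars x
    combination-const x = sum-cong-≋ {n} (λ i → *-congʳ (E-const (x i)))

    ^q-iterate : ∀ {A x} → x ^ (q ℕ.^ A) K.≡ₘ x → ∀ t → x ^ (q ℕ.^ (t ℕ.* A)) K.≡ₘ x
    ^q-iterate {A} {x} eq zero    = K.≈⇒≡ₘ (*-identityʳ x)
    ^q-iterate {A} {x} eq (suc t) = K.≡ₘ-trans
      (K.≈⇒≡ₘ (trans (^-congʳ x (ℕₚ.^-distribˡ-+-* q A (t ℕ.* A))) (sym (^-assocʳ x (q ℕ.^ A) _))))
      (K.≡ₘ-trans (K.^-≡ₘ (q ℕ.^ (t ℕ.* A)) eq) (^q-iterate {A} eq t))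

    -- Frobenius to the powers jB and 1 + jB = iA both fix x, hence so does one further application
    -- of Frobenius.
    consecutive-periods : ∀ A B i j {x} → x ^ (q ℕ.^ A) K.≡ₘ x → x ^ (q ℕ.^ B) K.≡ₘ x →
      1 ℕ.+ j ℕ.* B ≡ i ℕ.* A → x ^ q K.≡ₘ x
    consecutive-periods A B i j {x} Ap Bp eq =
      K.≡ₘ-trans (K.^-≡ₘ q (K.≡ₘ-sym (^q-iterate {B} Bp j)))
        (K.≡ₘ-trans (K.≈⇒≡ₘ (trans (^-assocʳ x (q ℕ.^ (j ℕ.* B)) q) (^-congʳ x exponent))) (^q-iterate {A} Ap i))
      where
      exponent : q ℕ.^ (j ℕ.* B) ℕ.* q ≡ q ℕ.^ (i ℕ.* A)
      exponent = ≡.trans (ℕₚ.*-comm (q ℕ.^ (j ℕ.* B)) q) (cong (q ℕ.^_) eq)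

    coprime-periods : ∀ {x} → x ^ (q ℕ.^ k) K.≡ₘ x → x ^ (q ℕ.^ T) K.≡ₘ x → x ^ q K.≡ₘ x
    coprime-periods kp Tp with coprime-Bézout k⊥T
    ... | Bézout.+- i j eq = consecutive-periods k T i j kp Tp eq
    ... | Bézout.-+ i j eq = consecutive-periods T k j i Tp kp eq

    -- Reindexed by σ, b has the coefficient d(σ i) at z^(σ i), where b^q has dᵢ^q; independence
    -- compares them.
    fixed-coefficients : ∀ {b d} → b H.≡ₘ combination d → Fixed h b → ∀ i → d (σ i) K.≡ₘ d i ^ q
    fixed-coefficients {b} {d} b≡ fixed i = toF (permuted-independent (λ i → d (σ i) - d i ^ q)
      (∣-resp (sym (permuted-- (λ i → d (σ i)) (λ i → d i ^ q)))
        (fromH (H.≡ₘ-trans (H.≈⇒≡ₘ (sym (combination-permuted d))) (H.≡ₘ-trans (H.≡ₘ-sym b≡)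
          (H.≡ₘ-trans (H.≡ₘ-sym (toH fixed)) (H.≡ₘ-trans (H.^-≡ₘ q b≡) (combination-^q d))))))) i)

    -- d is σ-equivariant, so each d i is fixed by both the T-th and the k-th power of Frobenius.
    fixed-constants : ∀ {d} → (∀ i → d (σ i) K.≡ₘ d i ^ q) → ∀ i → d i ^ q K.≡ₘ d i
    fixed-constants {d} equiv i = coprime-periods
        (K.≡ₘ-trans (K.Q.reflexive (≡.sym (K.^-quotient (d i) (q ℕ.^ k)))) (K.fermat (d i)))
        (K.≡ₘ-trans (K.≡ₘ-sym (iterated T i)) (K.Q.reflexive (cong d (period i))))
      where
      iterated : ∀ j i → d (iterate σ j i) K.≡ₘ d i ^ (q ℕ.^ j)
      iterated zero    i = K.≈⇒≡ₘ (sym (*-identityʳ _))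
      iterated (suc j) i = K.≡ₘ-trans (equiv _) (K.≡ₘ-trans (K.^-≡ₘ q (iterated j i))
        (K.≈⇒≡ₘ (trans (^-assocʳ (d i) (q ℕ.^ j) q) (^-congʳ (d i) (ℕₚ.*-comm (q ℕ.^ j) q)))))

    orbit-constant : ∀ (x : Fin n → F.Carrier) → (∀ i → x (σ i) F.≈ x i) → ∀ i → x i F.≈ x (rep (cls i))
    orbit-constant x inv i = F.trans (F.reflexive (cong x (≡.sym (proj₂ (reach i))))) (along (proj₁ (reach i)))
      where
      along : ∀ j → x (iterate σ j (rep (cls i))) F.≈ x (rep (cls i))
      along zero    = F.refl
      along (suc j) = F.trans (inv _) (along j)

    constants⇒scalars : ∀ {b} (d : Fin n → Poly) → b H.≡ₘ combination d →
      (∀ i → d (σ i) K.≡ₘ d i) → (x : Fin n → F.Carrier) → (∀ i → f ∣ d i - constₚ (x i)) →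
      b H.≡ₘ scalars (λ i → x (rep (cls i)))
    constants⇒scalars d b≡ invariant x constant = H.≡ₘ-trans b≡ (H.sum-≡ₘ λ i → H.*-≡ₘ (coefficient i) H.Q.refl)
      where
      x-invariant : ∀ i → x (σ i) F.≈ x i
      x-invariant i = residue-unique irr (constant (σ i)) (∣-chain (K.≡ₘ⇒∣ (invariant i)) (constant i))
      coefficient : ∀ i → E (d i) H.≡ₘ constₚ (x (rep (cls i)))
      coefficient i = H.≡ₘ-trans (toH (∣-resp (E-- (d i) (constₚ (x i))) (E-∣ (constant i))))
        (H.≈⇒≡ₘ (trans (E-const (x i)) (const-cong (orbit-constant x x-invariant i))))

    -- `residue` applied to f itself: the elements of K fixed by Frobenius are those of F.
    residues : ∀ (d : Fin n → Poly) → (∀ i → d i ^ q K.≡ₘ d i) → ∀ i → ∃ λ x → f ∣ d i - constₚ x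
    residues d powers i = residue irr (K.≡ₘ⇒∣ (powers i))

    fixed-combination⇒scalars : ∀ {b} → Fixed h b → (d : Fin n → Poly) → b H.≡ₘ combination d →
      ∃ λ x → b H.≡ₘ scalars (λ i → x (cls i))
    fixed-combination⇒scalars {b} fixed d b≡ = choose (residues d powers)
      where
      equiv : ∀ i → d (σ i) K.≡ₘ d i ^ q
      equiv = fixed-coefficients {b} {d} b≡ fixed
      powers : ∀ i → d i ^ q K.≡ₘ d i
      powers = fixed-constants {d} equiv
      choose : (∀ i → ∃ λ x → f ∣ d i - constₚ x) → ∃ λ x → b H.≡ₘ scalars (λ i → x (cls i))
      choose constant = (λ κ → proj₁ (constant (rep κ))) ,
        constants⇒scalars d b≡ (λ i → K.≡ₘ-trans (equiv i) (powers i)) (λ i → proj₁ (constant i)) (λ i → proj₂ (constant i))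

    fixed⇒scalars : ∀ {b} → Fixed h b → ∃ λ x → b H.≡ₘ scalars (λ i → x (cls i))
    fixed⇒scalars {b} fixed = fixed-combination⇒scalars fixed (proj₁ (span b)) (proj₂ (span b))

    scalars-permuted : ∀ y → permuted (λ i → constₚ (y (σ i))) ≈ scalars y
    scalars-permuted y = trans (sym (combination-permuted (λ i → constₚ (y i)))) (combination-const y)

    scalars⇒fixed : ∀ x → scalars (λ i → x (cls i)) ^ q H.≡ₘ scalars (λ i → x (cls i))
    scalars⇒fixed x = H.≡ₘ-trans (H.^-≡ₘ q (H.≈⇒≡ₘ (sym (combination-const y))))
        (H.≡ₘ-trans (combination-^q (λ i → constₚ (y i))) (H.≈⇒≡ₘ (trans permute (scalars-permuted y))))
      where
      y : Fin n → F.Carrier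
      y i = x (cls i)
      coefficient : ∀ i → constₚ (y i) ^ q ≈ constₚ (y (σ i))
      coefficient i = trans (const-^ (y i) q)
        (const-cong (F.trans (F.fermat (y i)) (F.reflexive (cong x (≡.sym (cls-σ i))))))
      permute : permuted (λ i → constₚ (y i) ^ q) ≈ permuted (λ i → constₚ (y (σ i)))
      permute = sum-cong-≋ {n} (λ i → *-congʳ (E-cong (coefficient i)))

    scalars-unique : ∀ y y′ → scalars y H.≡ₘ scalars y′ → ∀ i → y i F.≈ y′ i
    scalars-unique y y′ eq i = residue-unique {b = constₚ (y i)} irr (∣-zero (-‿inverseʳ _))
        (subst (λ j → f ∣ constₚ (y j) - constₚ (y′ j)) (inverseʳ π)
          (permuted-independent (λ j → constₚ (y (σ j)) - constₚ (y′ (σ j))) divisible (π ⟨$⟩ˡ i)))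
      where
      divisible : h ∣ permuted (λ j → constₚ (y (σ j)) - constₚ (y′ (σ j)))
      divisible = ∣-resp (sym (permuted-- (λ j → constₚ (y (σ j))) (λ j → constₚ (y′ (σ j)))))
        (fromH (H.≡ₘ-trans (H.≈⇒≡ₘ (scalars-permuted y)) (H.≡ₘ-trans eq (H.≈⇒≡ₘ (sym (scalars-permuted y′))))))

    scalars-cong : ∀ {y y′} → (∀ i → y i F.≈ y′ i) → scalars y ≈ scalars y′
    scalars-cong e = sum-cong-≋ {n} (λ i → *-congʳ (const-cong (e i)))

    orbitCoordinates : Coordinates h C
    orbitCoordinates = record
      { _HasCoordinates_ = λ b x → b H.≡ₘ scalars (λ i → x (cls i))
      ; exists   = fixed⇒scalars
      ; realises = λ x → scalars (λ i → x (cls i)) , fromH (scalars⇒fixed x) , H.Q.refl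
      ; injects  = λ {b} {b′} {x} {x′} b≡ b≡′ x≈x′ → fromH (H.≡ₘ-trans b≡ (H.≡ₘ-trans
          (H.≈⇒≡ₘ (scalars-cong {λ i → x (cls i)} {λ i → x′ (cls i)} (λ i → x≈x′ (cls i)))) (H.≡ₘ-sym b≡′)))
      ; unique   = λ {b} {b′} {x} {x′} b≡ b≡′ d κ → subst (λ κ → x κ F.≈ x′ κ) (cls-rep κ)
          (scalars-unique (λ i → x (cls i)) (λ i → x′ (cls i))
            (H.≡ₘ-trans (H.≡ₘ-sym b≡) (H.≡ₘ-trans (toH d) b≡′)) (rep κ))
      }

open Arithmetic using (OrbitData; module Multiplication; module Order; module Formulas)

-- Assembly

inverse-exponent : ∀ {n} e → Coprime n (suc e) → ∃ λ w → ∃ λ u → 1 ℕ.+ n ℕ.* w ≡ suc e ℕ.* u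
inverse-exponent {n} e n⊥e with coprime-Bézout n⊥e
... | Bézout.-+ x y eq = x , y , ≡.trans (cong suc (ℕₚ.*-comm n x)) (≡.trans eq (ℕₚ.*-comm y (suc e)))
-- Here x·n is 1 modulo e + 1; multiplying by e, which is -1, gives n·(x·e) the residue -1 that is
-- wanted.
... | Bézout.+- x y eq = x ℕ.* e , 1 ℕ.+ y ℕ.* e , ≡.trans (assoc n x e) (≡.trans (cong (λ z → 1 ℕ.+ z ℕ.* e) (≡.sym eq)) (ring y e))
  where
  assoc : ∀ n x e → 1 ℕ.+ n ℕ.* (x ℕ.* e) ≡ 1 ℕ.+ x ℕ.* n ℕ.* e
  assoc = solve-∀
  ring : ∀ y e → 1 ℕ.+ (1 ℕ.+ y ℕ.* suc e) ℕ.* e ≡ suc e ℕ.* (1 ℕ.+ y ℕ.* e)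
  ring = solve-∀

module Count {c ℓ : Level} {q : ℕ} (F : FiniteField c ℓ q) (n : ℕ) {{n≢0 : NonZero n}} where
  open Substitution F n
  open PolyOver F.ring using (IsOrder; xᵉ-1; monomial; substXⁿ)
  open PolynomialRing F.ring using (⊕-def)

  order-∣ : ∀ {f e} → IsOrder f e → ∃ λ e′ → e ≡ suc e′ × f ∣ X ^ suc e′ - 1#
  order-∣ {f} {zero}  (() , _)
  order-∣ {f} {suc e} (_ , f∣xᵉ-1 , _) = e , ≡.refl ,
      ∣-resp (subst (_≈ X ^ suc e - 1#) (⊕-def (monomial (suc e)) (constₚ (F.- F.1#))) expanded) (∣ₚ⇒∣ f∣xᵉ-1)
    where
    minus-one : constₚ (F.- F.1#) ≈ - 1#
    minus-one = trans (const-cong (F.sym (F.+-identityˡ _)))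
      (trans (sym (const-- F.0# F.1#)) (trans (+-congʳ const-0) (+-identityˡ _)))
    expanded : monomial (suc e) + constₚ (F.- F.1#) ≈ X ^ suc e - 1#
    expanded = +-cong (trans (replicate-X (suc e) 1#) (*-identityʳ _)) minus-one

  -- Component 0 of E f recovers f.
  E≉0 : ∀ {f} → Irreducible f → ¬ E f ≈ 0#
  E≉0 {f} (f≉0 , _) Ef≈0 = f≉0 (unwrap (begin
    f                           ≈⟨ *-identityʳ f ⟨
    f * 1#                      ≈⟨ *-congˡ (component-X^-same {0}) ⟨
    f * component 0 (X ^ 0)     ≈⟨ component-E* (ℕ.>-nonZero⁻¹ n) f (X ^ 0) ⟨
    component 0 (E f * X ^ 0)   ≈⟨ component-cong 0 (zero-product Ef≈0) ⟩
    component 0 0#              ≡⟨⟩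
    0#                          ∎))
    where
    open import Relation.Binary.Reasoning.Setoid setoid
    zero-product : ∀ {x y} → x ≈ 0# → x * y ≈ 0#
    zero-product e = trans (*-congʳ e) (zeroˡ _)

  factorisation-exists : ∀ {f} → Irreducible f → ∃ (IrredFactorization (substXⁿ n f))
  factorisation-exists {f} irr with zero-or-degree (E f)
  ... | inj₁ z = ⊥-elim (E≉0 irr z)
  ... | inj₂ (d , D) with factorise d D ℕₚ.≤-refl
  ...   | fs , fact = fs , fromFactorisation fact

  length≡count : ∀ {p a} → Prime p → q ≡ p ℕ.^ a → ∀ {f k e T} → Irreducible f → HasDegree f k → IsOrder f e →
    Coprime n e → (orbits : OrbitData n q T) → Coprime k T →
    ∀ fs → IrredFactorization (substXⁿ n f) fs → length fs ≡ OrbitData.count orbits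
  length≡count {p} {a} p-prime q≡p^a {f} {k} {e} {T} irr deg order n⊥e orbits k⊥T fs fact with order-∣ {f} order
  ... | e′ , ≡.refl , f∣ with inverse-exponent {n} e′ n⊥e
  ...   | w , u′ , u-eq = coordinates-unique (factorCoordinates (E≉0 irr)
      (reduced {f} {k} {e′} {w} {u′} {T} {count} irr (toDegree deg) f∣ u-eq π π-mod orbitSpace period k⊥T) (toFactorisation fact))
      (orbitCoordinates {f} {k} {e′} {w} {u′} {T} {count} irr (toDegree deg) f∣ u-eq π π-mod orbitSpace period k⊥T)
    where
    open OrbitData orbits
    open OrbitCoordinates F {p} {a} p-prime q≡p^a n using (reduced; orbitCoordinates)

module OrbitFormulas (n q σ : ℕ) {{n≢0 : NonZero n}} {{σ≢0 : NonZero σ}} (σ≡s : σ ≡ s n q) (1<q : 1 ℕ.< q)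
  (n⊥q : Coprime n q) where

  private instance
    q≢0 : NonZero q
    q≢0 = >-nonZero (ℕₚ.<-trans z<s 1<q)

  private module O = Order n q n⊥q

  module Fm = Formulas n q σ σ≡s 1<q
    (λ {p} pp p∣n → subst (λ x → p ℕ∣.∣ q ℕ.^ x ℕ.∸ 1) (≡.sym σ≡s) (O.prime∣P-s pp p∣n))
    (λ 8∣n → subst (λ x → 4 ℕ∣.∣ q ℕ.^ x ℕ.∸ 1) (≡.sym σ≡s) (O.8∣n⇒4∣P 8∣n))

  T : ℕ
  T = σ ℕ.* Fm.m

  orbits : OrbitData n q T
  orbits = Multiplication.orbitData n q (ℕₚ.<-trans z<s 1<q) T {{ℕₚ.m*n≢0 σ Fm.m {{σ≢0}} {{Fm.m≢0}}}}
    (subst (λ x → n ℕ∣.∣ q ℕ.^ x ℕ.∸ 1) (ℕₚ.*-comm Fm.m σ) Fm.n∣P-ms)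

  -- A divisor of k is prime to n and hence to m ∣ n; if it also divides T = σ·m, it divides σ,
  -- which is prime to k.
  coprime-T : ∀ {k} e → Coprime n (e ℕ.* k) → Coprime k σ → Coprime k T
  coprime-T {k} e n⊥ek k⊥σ {x} (x∣k , x∣T) = k⊥σ (x∣k , coprime-divisor x⊥m (subst (x ℕ∣.∣_) (ℕₚ.*-comm σ Fm.m) x∣T))
    where
    x⊥m : Coprime x Fm.m
    x⊥m {y} (y∣x , y∣m) = n⊥ek (ℕ∣.∣-trans y∣m Fm.m∣n , ℕ∣.∣n⇒∣m*n e (ℕ∣.∣-trans y∣x x∣k))

  formula-values : (orbits : OrbitData n q T) →
    (OrbitData.count orbits ÷ 1 ≡ formula₁ n q) × (OrbitData.count orbits ÷ 1 ≡ formula₂ n q)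
  formula-values orbits = Fm.formula₁-value (OrbitData.gcd-sum orbits) , Fm.formula₂-value (OrbitData.gcd-sum orbits)

module _ {c ℓ : Level} {q p a : ℕ} (F : FiniteField c ℓ q) (p-prime : Prime p) (q≡p^a : q ≡ p ℕ.^ a)
  (n σ : ℕ) {{n≢0 : NonZero n}} {{σ≢0 : NonZero σ}} (σ≡s : σ ≡ s n q) (n⊥q : Coprime n q) where
  open PolyOver (FiniteField.ring F)

  factor-count : ∀ {f k e} → Irreducible f → HasDegree f k → IsOrder f e → Coprime n (e ℕ.* k) → Coprime k σ →
    ∀ fs → IrredFactorization (substXⁿ n f) fs → (length fs ÷ 1 ≡ formula₁ n q) × (length fs ÷ 1 ≡ formula₂ n q)
  factor-count {f} {k} {e} irr deg order n⊥ek k⊥σ fs fact = conclude O.orbits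
    where
    module O = OrbitFormulas n q σ σ≡s (subst (1 ℕ.<_) (≡.sym (proj₂ (Berlekamp.size≥2 F))) (s≤s (s≤s z≤n))) n⊥q
    conclude : OrbitData n q O.T → (length fs ÷ 1 ≡ formula₁ n q) × (length fs ÷ 1 ≡ formula₂ n q)
    conclude orbits = subst (λ N → (N ÷ 1 ≡ formula₁ n q) × (N ÷ 1 ≡ formula₂ n q))
      (≡.sym (Count.length≡count F n {p} {a} p-prime q≡p^a {f} {k} {e} irr deg order (λ {x} (x∣n , x∣e) → n⊥ek (x∣n , ℕ∣.∣m⇒∣m*n k x∣e))
        orbits (O.coprime-T {k} e n⊥ek k⊥σ) fs fact))
      (O.formula-values orbits)

open import Data.Nat using (_^_; _*_; _<_; _≤_)

theorem3p8 : ∀ {c ℓ : Level} (p a q : ℕ) → Prime p → 1 ≤ a → q ≡ p ^ a →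
    (F : FiniteField c ℓ q) →
    let open PolyOver (FiniteField.ring F) in
    (f : Poly) (k e n : ℕ) →
    Irreducible f → HasDegree f k → IsOrder f e →
    0 < n → Coprime n q → Coprime n (e * k) → Coprime k (s n q) →
    (∃ λ fs → IrredFactorization (substXⁿ n f) fs)
    × (∀ fs → IrredFactorization (substXⁿ n f) fs →
    (length fs ÷ 1 ≡ formula₁ n q) × (length fs ÷ 1 ≡ formula₂ n q))
theorem3p8 p a q p-prime _ q≡p^a F f k e n irr deg order 0<n n⊥q n⊥ek k⊥s =
    Count.factorisation-exists F n {f} irr , factor-count {p = p} {a} F p-prime q≡p^a n (s n q) ≡.refl n⊥q {f} {k} {e} irr deg order n⊥ek k⊥s
  where
  instance
    n≢0 : NonZero n
    n≢0 = >-nonZero 0<n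
    q≢0 : NonZero q
    q≢0 = >-nonZero (ℕₚ.<-trans z<s (subst (1 <_) (≡.sym (proj₂ (Berlekamp.size≥2 F))) (s≤s (s≤s z≤n))))
    s≢0 : NonZero (s n q)
    s≢0 = Order.s≢0 n q n⊥q
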